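{- Let $k \ge 1$ be an integer (possibly depending on $n$). There is a deterministic $\mathsf{CONGEST}$ algorithm that, on an $n$-node graph $G$, computes in $\widetilde{O}(k\cdot \log^3 n)$ rounds a network decomposition of $G^k$ with $O(\log n \cdot \log \log n)$ colors and weak diameter $O(k \cdot \log n)$ in $G$. Moreover, for each cluster $C$ there is a Steiner tree $T_C$ of radius $O(k \cdot \log n)$ in $G$ with $C$ as its terminal nodes, and for each color, each edge of $G$ is in at most one Steiner tree of clusters of that color.
   Context: $\mathsf{CONGEST}$: communication network $G=(V,E)$, unique $O(\log n)$-bit identifiers, synchronous rounds with $O(\log n)$-bit messages per edge. A network decomposition of $G^k$ with $c$ colors and weak diameter $d$ is a partition of $V$ into clusters together with a coloring of the clusters by $c$ colors such that each cluster $C$ has weak diameter at most $d$ (any two nodes of $C$ are at distance at most $d$ in $G$) and any two distinct clusters of the same color are at distance greater than $k$ in $G$. A Steiner tree with terminal set $C$ is a tree subgraph of $G$ containing all nodes of $C$ (possibly also other nodes). $\widetilde{O}(x)$ hides factors logarithmic in $x$. -}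

module Defs where

open import Data.Nat using (ℕ; zero; suc; _+_; _*_; _^_; _≤_; _<_)
open import Data.Nat.Logarithm using (⌊log₂_⌋)
open import Data.Fin using (Fin)
open import Data.List using (List; filterᵇ; map; allFin; length)
open import Data.Bool using (Bool; T; false)
open import Data.Product using (Σ; ∃; _×_; _,_; proj₁; proj₂)
open import Data.Sum using (_⊎_)
open import Relation.Binary.PropositionalEquality using (_≡_; _≢_)
open import Relation.Nullary using (¬_)

record Graph (n : ℕ) : Set where
  field
    adj    : Fin n → Fin n → Bool
    sym    : ∀ u v → adj u v ≡ adj v u
    irrefl : ∀ v → adj v v ≡ false
open Graph public

Adj : ∀ {n} → Graph n → Fin n → Fin n → Set
Adj G u v = T (adj G u v)

data Within {n : ℕ} (G : Graph n) : ℕ → Fin n → Fin n → Set where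
  here : ∀ {d v} → Within G d v v
  step : ∀ {d u w v} → Adj G u w → Within G d w v → Within G (suc d) u v

neighbours : ∀ {n} → Graph n → Fin n → List (Fin n)
neighbours {n} G v = filterᵇ (λ u → adj G u v) (allFin n)

-- logarithm with lg n ≥ 1 :  lg n = ⌊log₂ n⌋ + 1  (= Θ(log n) for n ≥ 2)

lg : ℕ → ℕ
lg n = ⌊log₂ n ⌋ + 1

-- Deterministic CONGEST algorithms.
-- Each node initially knows n, k, its own ID and the IDs of its neighbours.
-- In each round every node sends to each neighbour (addressed by ID) a
-- bit string, then updates its state from the list of received
-- (sender ID, message) pairs.  Local computation is unrestricted.
-- The output of a node (cluster identifier, color) is read off its state.

record Algorithm : Set₁ where
  field
    State   : Set
    init    : (n k myId : ℕ) → List ℕ → State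
    send    : State → ℕ → List Bool
    receive : State → List (ℕ × List Bool) → State
    output  : State → ℕ × ℕ
open Algorithm public

run : ∀ {n} (A : Algorithm) (G : Graph n) (id : Fin n → ℕ) (k : ℕ) →
      ℕ → Fin n → State A
run {n} A G id k zero    v = init A n k (id v) (map id (neighbours G v))
run {n} A G id k (suc t) v =
  receive A (run A G id k t v)
    (map (λ u → id u , send A (run A G id k t u) (id v)) (neighbours G v))

BandwidthOK : ∀ {n} (A : Algorithm) (G : Graph n) (id : Fin n → ℕ) (k T B : ℕ) → Set
BandwidthOK A G id k T B =
  ∀ t → t < T → ∀ u v → Adj G u v → length (send A (run A G id k t u) (id v)) ≤ B

-- Network decomposition of G^k given by cluster identifiers and colors:
-- a cluster is the set of nodes with a given cluster identifier.

record IsNetworkDecomposition {n : ℕ} (G : Graph n) (cluster color : Fin n → ℕ)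
                              (numColors k diam : ℕ) : Set where
  field
    color-bound   : ∀ v → color v < numColors
    cluster-color : ∀ u v → cluster u ≡ cluster v → color u ≡ color v
    weak-diameter : ∀ u v → cluster u ≡ cluster v → Within G diam u v
    separated     : ∀ u v → color u ≡ color v → cluster u ≢ cluster v →
                    ¬ Within G k u v

-- Steiner trees, represented as rooted trees: a node set, a root and
-- parent pointers; the tree edges are {v, parent v} for non-root v.

iter : ∀ {A : Set} → (A → A) → ℕ → A → A
iter f zero    x = x
iter f (suc m) x = f (iter f m x)

record STree {n : ℕ} (G : Graph n) : Set where
  field
    member : Fin n → Bool
    root   : Fin n
    parent : Fin n → Fin n
open STree public

InTree : ∀ {n} {G : Graph n} → STree G → Fin n → Set
InTree S v = T (member S v)

record IsSteinerTree {n : ℕ} (G : Graph n) (S : STree G) (C : Fin n → Set) (R : ℕ) : Set where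
  field
    root-in   : InTree S (root S)
    parent-ok : ∀ v → InTree S v → v ≢ root S →
                InTree S (parent S v) × Adj G v (parent S v)
    radius    : ∀ v → InTree S v → ∃ λ m → m ≤ R × iter (parent S) m v ≡ root S
    terminals : ∀ v → C v → InTree S v

TreeEdge : ∀ {n} {G : Graph n} → STree G → Fin n → Fin n → Set
TreeEdge S a b =
  (InTree S a × a ≢ root S × parent S a ≡ b) ⊎ (InTree S b × b ≢ root S × parent S b ≡ a)

{-# OPTIONS --safe #-}
-- The colours are produced in O(log n) batches; a batch clusters a constant fraction of the remaining nodes.
--
-- In a batch, nested sets of centres V = Q₀ ⊇ Q₁ ⊇ … ⊇ Q_L = ∅ are chosen such that for almost every node Qᵢ₊₁ hits the
-- list of its Λ nearest centres in Qᵢ whenever Qᵢ offers that many.  If the centres get a head start of h per level, then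
-- a centre that is beaten by a centre of a higher level drops out of the competition, so only L Λ centres come within
-- τ windows of width 2k of the best shifted distance.  Some window therefore at most doubles the number of competing
-- centres.  When centres are sampled with probability inverse to that number, with constant probability exactly one
-- centre of the outer window survives and it lies in the inner window; then the node is more than k away from every
-- cluster of another centre, and the strict Voronoi cells of the sampled centres carry disjoint Steiner trees.  One colour
-- is used for each of the O(log log n) orders of magnitude of the number of competing centres.
--
-- Hitting and isolating are the same derandomization problem, and pairwise independence suffices: the indicator of
-- isolation is at least the number of sampled elements of A minus the number of sampled pairs of A and B, a quadratic form.
-- The sample is obtained by repeated halving; each halving decides the centres class by class along a colouring with few
-- monochromatic pairs, at the loss of these pairs.  Such a colouring arises from the identifiers by replacing a colour
-- a₀ + q a₁ with a point of the line x ↦ a₀ + a₁ x: two lines meet only once, so the best of X points loses at most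
-- the fraction 1/X of the pairs.
--
-- A node talks to the centres in its list along shortest paths, centre a using the slot (distance of a) + (rank of a).
module Submission where

open import Defs renaming (sym to adj-sym; here to here′; step to step′)
open import Data.Nat using (ℕ; zero; suc; _+_; _*_; _∸_; _^_; _⊓_; _≤_; _<_; z≤n; s≤s; _≡ᵇ_; _<ᵇ_; _≤ᵇ_; NonZero; nonZero; >-nonZero; ⌈_/2⌉; ⌊_/2⌋)
open import Data.Nat.Properties
open import Data.Nat.DivMod using (_/_; _%_; m%n<n; m≡m%n+[m/n]*n; m/n*n≤m; +-distrib-/-∣ˡ; +-distrib-/-∣ʳ; m*n/n≡m; m<n⇒m/n≡0; m<n⇒m%n≡m; [m+kn]%n≡m%n; m<n*o⇒m/o<n; m/n≤m; /-monoˡ-≤)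
open import Data.Nat.Divisibility using (divides)
open import Data.Nat.Logarithm using (⌊log₂_⌋; ⌊log₂⌋-mono-≤; ⌊log₂[2^n]⌋≡n; ⌊log₂⌊n/2⌋⌋≡⌊log₂n⌋∸1)
open import Data.Nat.Tactic.RingSolver using (solve-∀)
open import Data.Bool using (Bool; true; false; T; not; _∧_; _∨_; if_then_else_)
open import Data.Bool.Properties using (T?; T-∧)
open import Data.Fin using (Fin; fromℕ<)
open import Data.List using (List; []; _∷_; map; length; filterᵇ; allFin; upTo; cartesianProduct)
open import Data.List.Properties using (map-tabulate; map-applyUpTo; length-upTo; length-tabulate)
open import Data.List.Membership.Propositional using (_∈_)
open import Data.List.Membership.Propositional.Properties using (∈-upTo⁺; ∈-upTo⁻; ∈-allFin; ∈-cartesianProduct⁺; ∈-cartesianProduct⁻; ∈-map⁺; ∈-map⁻; ∈-filter⁺; ∈-filter⁻)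
open import Data.List.Relation.Unary.Any using (here; there)
open import Data.Maybe using (Maybe; just; nothing; is-just; is-nothing)
open import Data.Maybe.Properties using (just-injective)
open import Data.Product using (Σ; ∃; _×_; _,_; proj₁; proj₂)
open import Data.Sum using (_⊎_; inj₁; inj₂)
open import Data.Empty using (⊥; ⊥-elim)
open import Data.Unit using (tt)
open import Function using (_∘_; case_of_; const)
open import Function.Bundles using (Equivalence)
open import Relation.Binary.PropositionalEquality using (_≡_; _≢_; refl; sym; trans; cong; cong₂; subst; subst₂; module ≡-Reasoning)
open import Relation.Binary using (tri<; tri≈; tri>)
open import Relation.Nullary using (¬_; Dec; yes; no)
open import Relation.Nullary.Decidable using (⌊_⌋; toWitness; fromWitness; _×-dec_)

import Data.Fin.Properties
module FinP = Data.Fin.Properties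

private variable
  Elem Elem′ : Set

-- Indicator functions and finite sums

𝟙 : Bool → ℕ
𝟙 b = if b then 1 else 0

if-yes : ∀ {b} {x y : Elem} → T b → (if b then x else y) ≡ x
if-yes {b = true} _ = refl

if-no : ∀ {b} {x y : Elem} → ¬ T b → (if b then x else y) ≡ y
if-no {b = true}  ¬t = ⊥-elim (¬t _)
if-no {b = false} _  = refl

𝟙-mono : ∀ {b c} → (T b → T c) → 𝟙 b ≤ 𝟙 c
𝟙-mono {false}         _ = z≤n
𝟙-mono {true}  {true}  _ = ≤-refl
𝟙-mono {true}  {false} i = ⊥-elim (i _)

𝟙-cong : ∀ {b c} → (T b → T c) → (T c → T b) → 𝟙 b ≡ 𝟙 c
𝟙-cong i j = ≤-antisym (𝟙-mono i) (𝟙-mono j)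

𝟙≤1 : ∀ b → 𝟙 b ≤ 1
𝟙≤1 true  = ≤-refl
𝟙≤1 false = z≤n

𝟙>0 : ∀ {b} → 0 < 𝟙 b → T b
𝟙>0 {true} _ = _

∧-intro : ∀ {b c} → T b → T c → T (b ∧ c)
∧-intro s t = Equivalence.from T-∧ (s , t)

∧-elim : ∀ {b c} → T (b ∧ c) → T b × T c
∧-elim = Equivalence.to T-∧

not-intro : ∀ {b} → ¬ T b → T (not b)
not-intro {true}  ¬t = ¬t _
not-intro {false} _  = _

not-elim : ∀ {b} → T (not b) → ¬ T b
not-elim {false} _ ()

≡ᵇ-refl : ∀ a → T (a ≡ᵇ a)
≡ᵇ-refl a = ≡⇒≡ᵇ a a refl

∑ : List Elem → (Elem → ℕ) → ℕ
∑ []       f = 0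
∑ (x ∷ xs) f = f x + ∑ xs f

∑-cong∈ : (xs : List Elem) {f g : Elem → ℕ} → (∀ x → x ∈ xs → f x ≡ g x) → ∑ xs f ≡ ∑ xs g
∑-cong∈ []       h = refl
∑-cong∈ (x ∷ xs) h = cong₂ _+_ (h x (here refl)) (∑-cong∈ xs λ y y∈ → h y (there y∈))

∑-cong : (xs : List Elem) {f g : Elem → ℕ} → (∀ x → f x ≡ g x) → ∑ xs f ≡ ∑ xs g
∑-cong xs h = ∑-cong∈ xs λ x _ → h x

∑-mono∈ : (xs : List Elem) {f g : Elem → ℕ} → (∀ x → x ∈ xs → f x ≤ g x) → ∑ xs f ≤ ∑ xs g
∑-mono∈ []       h = z≤n
∑-mono∈ (x ∷ xs) h = +-mono-≤ (h x (here refl)) (∑-mono∈ xs λ y y∈ → h y (there y∈))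

∑-mono : (xs : List Elem) {f g : Elem → ℕ} → (∀ x → f x ≤ g x) → ∑ xs f ≤ ∑ xs g
∑-mono xs h = ∑-mono∈ xs λ x _ → h x

interchange : ∀ a b c d → (a + b) + (c + d) ≡ (a + c) + (b + d)
interchange = solve-∀

∑-+ : (xs : List Elem) (f g : Elem → ℕ) → ∑ xs (λ x → f x + g x) ≡ ∑ xs f + ∑ xs g
∑-+ []       f g = refl
∑-+ (x ∷ xs) f g = trans (cong (f x + g x +_) (∑-+ xs f g)) (interchange (f x) (g x) (∑ xs f) (∑ xs g))

∑-0 : (xs : List Elem) → ∑ xs (λ _ → 0) ≡ 0
∑-0 []       = refl
∑-0 (x ∷ xs) = ∑-0 xs

∑-zero∈ : (xs : List Elem) {f : Elem → ℕ} → (∀ x → x ∈ xs → f x ≡ 0) → ∑ xs f ≡ 0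
∑-zero∈ xs h = trans (∑-cong∈ xs h) (∑-0 xs)

∑-const : (xs : List Elem) (c : ℕ) → ∑ xs (λ _ → c) ≡ length xs * c
∑-const []       c = refl
∑-const (x ∷ xs) c = cong (c +_) (∑-const xs c)

∑-*ˡ : (xs : List Elem) (c : ℕ) (f : Elem → ℕ) → ∑ xs (λ x → c * f x) ≡ c * ∑ xs f
∑-*ˡ []       c f = sym (*-zeroʳ c)
∑-*ˡ (x ∷ xs) c f = trans (cong (c * f x +_) (∑-*ˡ xs c f)) (sym (*-distribˡ-+ c (f x) (∑ xs f)))

∑-*ʳ : (xs : List Elem) (c : ℕ) (f : Elem → ℕ) → ∑ xs (λ x → f x * c) ≡ ∑ xs f * c
∑-*ʳ xs c f = trans (∑-cong xs λ x → *-comm (f x) c) (trans (∑-*ˡ xs c f) (*-comm c (∑ xs f)))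

∑-swap : (xs : List Elem) (ys : List Elem′) (f : Elem → Elem′ → ℕ) →
         ∑ xs (λ x → ∑ ys (f x)) ≡ ∑ ys (λ y → ∑ xs (λ x → f x y))
∑-swap []       ys f = sym (∑-0 ys)
∑-swap (x ∷ xs) ys f =
  trans (cong (∑ ys (f x) +_) (∑-swap xs ys f)) (sym (∑-+ ys (f x) (λ y → ∑ xs (λ x → f x y))))

∑-map : (g : Elem → Elem′) (xs : List Elem) (f : Elem′ → ℕ) → ∑ (map g xs) f ≡ ∑ xs (f ∘ g)
∑-map g []       f = refl
∑-map g (x ∷ xs) f = cong (f (g x) +_) (∑-map g xs f)

∑-filter : (p : Elem → Bool) (xs : List Elem) (f : Elem → ℕ) → ∑ (filterᵇ p xs) f ≡ ∑ xs (λ x → 𝟙 (p x) * f x)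
∑-filter p []       f = refl
∑-filter p (x ∷ xs) f with p x
... | true  = cong₂ _+_ (sym (+-identityʳ (f x))) (∑-filter p xs f)
... | false = ∑-filter p xs f

term≤∑ : (xs : List Elem) {f : Elem → ℕ} {x : Elem} → x ∈ xs → f x ≤ ∑ xs f
term≤∑ (x ∷ xs)         (here refl) = m≤m+n _ _
term≤∑ (x ∷ xs) {f = f} (there x∈)  = ≤-trans (term≤∑ xs x∈) (m≤n+m _ (f x))

∑>0 : (xs : List Elem) {f : Elem → ℕ} → 0 < ∑ xs f → ∃ λ x → x ∈ xs × 0 < f x
∑>0 (x ∷ xs) {f} pos with f x in eq
... | suc _ = x , here refl , subst (0 <_) (sym eq) (s≤s z≤n)
... | zero  with ∑>0 xs pos
...   | y , y∈ , fy = y , there y∈ , fy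

∑<⇒∃< : (xs : List Elem) (f g : Elem → ℕ) → ∑ xs f < ∑ xs g → ∃ λ x → x ∈ xs × f x < g x
∑<⇒∃< (x ∷ xs) f g lt with f x <? g x
... | yes p = x , here refl , p
... | no ¬p with ∑<⇒∃< xs f g (+-cancelˡ-< (f x) _ _ (<-≤-trans lt (+-monoˡ-≤ (∑ xs g) (≮⇒≥ ¬p))))
...   | y , y∈ , q = y , there y∈ , q

∑-upTo-suc : ∀ N (f : ℕ → ℕ) → ∑ (upTo (suc N)) f ≡ f 0 + ∑ (upTo N) (f ∘ suc)
∑-upTo-suc N f = cong (f 0 +_) (trans (cong (λ xs → ∑ xs f) (sym (map-applyUpTo (λ x → x) suc N))) (∑-map suc (upTo N) f))

length-allFin : ∀ n → length (allFin n) ≡ n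
length-allFin n = length-tabulate {n = n} (λ x → x)

∑-upTo-single : ∀ N {a} (f : ℕ → ℕ) → a < N → (∀ x → x < N → x ≢ a → f x ≡ 0) → ∑ (upTo N) f ≡ f a
∑-upTo-single (suc N) {zero}  f _ h =
  trans (∑-upTo-suc N f)
    (trans (cong (f 0 +_) (∑-zero∈ (upTo N) λ x x∈ → h (suc x) (s≤s (∈-upTo⁻ x∈)) λ ())) (+-identityʳ _))
∑-upTo-single (suc N) {suc a} f (s≤s a<N) h =
  trans (∑-upTo-suc N f)
    (cong₂ _+_ (h 0 (s≤s z≤n) λ ()) (∑-upTo-single N (f ∘ suc) a<N λ x x< x≢a → h (suc x) (s≤s x<) (x≢a ∘ suc-injective)))

∑-allFin-suc : ∀ n (f : Fin (suc n) → ℕ) → ∑ (allFin (suc n)) f ≡ f Fin.zero + ∑ (allFin n) (f ∘ Fin.suc)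
∑-allFin-suc n f = cong (f Fin.zero +_)
  (trans (cong (λ xs → ∑ xs f) (sym (map-tabulate (λ x → x) Fin.suc))) (∑-map Fin.suc (allFin n) f))

∑-allFin-single : ∀ {n} (a : Fin n) (f : Fin n → ℕ) → (∀ x → x ≢ a → f x ≡ 0) → ∑ (allFin n) f ≡ f a
∑-allFin-single {suc n} Fin.zero f h =
  trans (∑-allFin-suc n f) (trans (cong (f Fin.zero +_) (∑-zero∈ (allFin n) λ x _ → h (Fin.suc x) λ ())) (+-identityʳ _))
∑-allFin-single {suc n} (Fin.suc a) f h =
  trans (∑-allFin-suc n f)
    (cong₂ _+_ (h Fin.zero λ ()) (∑-allFin-single a (f ∘ Fin.suc) λ x x≢a → h (Fin.suc x) (x≢a ∘ FinP.suc-injective)))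

findᵇ : (Elem → Bool) → List Elem → Maybe Elem
findᵇ p []       = nothing
findᵇ p (x ∷ xs) = if p x then just x else findᵇ p xs

findᵇ-sound : (p : Elem → Bool) (xs : List Elem) {x : Elem} → findᵇ p xs ≡ just x → x ∈ xs × T (p x)
findᵇ-sound p (y ∷ xs) eq with p y in py
findᵇ-sound p (y ∷ xs) refl | true = here refl , subst T (sym py) _
... | false with findᵇ-sound p xs eq
...   | x∈ , px = there x∈ , px

findᵇ-complete : (p : Elem → Bool) (xs : List Elem) {x : Elem} → x ∈ xs → T (p x) → ∃ λ y → findᵇ p xs ≡ just y
findᵇ-complete p (y ∷ xs) x∈ px with p y in py
findᵇ-complete p (y ∷ xs) x∈ px           | true = y , refl
findᵇ-complete p (y ∷ xs) (here refl) px  | false = ⊥-elim (subst T py px)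
findᵇ-complete p (y ∷ xs) (there x∈) px   | false = findᵇ-complete p xs x∈ px

findᵇ-unique : (p : Elem → Bool) (xs : List Elem) {x : Elem} → x ∈ xs → T (p x) →
               (∀ y → y ∈ xs → T (p y) → y ≡ x) → findᵇ p xs ≡ just x
findᵇ-unique p xs x∈ px uniq with findᵇ-complete p xs x∈ px
... | y , eq = trans eq (cong just (uniq y (proj₁ (findᵇ-sound p xs eq)) (proj₂ (findᵇ-sound p xs eq))))

findᵇ-none : (p : Elem → Bool) (xs : List Elem) {x : Elem} → findᵇ p xs ≡ nothing → x ∈ xs → ¬ T (p x)
findᵇ-none p xs eq x∈ px with findᵇ-complete p xs x∈ px
... | y , eq′ with trans (sym eq) eq′
...   | ()

count : ℕ → (ℕ → Bool) → ℕ
count N p = ∑ (upTo N) (𝟙 ∘ p)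

count-mono : ∀ N {p q : ℕ → Bool} → (∀ a → a < N → T (p a) → T (q a)) → count N p ≤ count N q
count-mono N h = ∑-mono∈ (upTo N) λ a a∈ → 𝟙-mono (h a (∈-upTo⁻ a∈))

count-cong : ∀ N {p q : ℕ → Bool} → (∀ a → a < N → T (p a) → T (q a)) → (∀ a → a < N → T (q a) → T (p a)) →
             count N p ≡ count N q
count-cong N h k = ≤-antisym (count-mono N h) (count-mono N k)

count≤1 : ∀ N (p : ℕ → Bool) → (∀ a b → a < N → b < N → T (p a) → T (p b) → a ≡ b) → count N p ≤ 1
count≤1 N p uniq with findᵇ p (upTo N) in eq
... | nothing = subst (_≤ 1) (sym (∑-zero∈ (upTo N) λ a a∈ → if-no (findᵇ-none p (upTo N) eq a∈))) z≤n
... | just a with findᵇ-sound p (upTo N) eq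
...   | a∈ , pa =
  subst (_≤ 1)
    (sym (∑-upTo-single N (𝟙 ∘ p) (∈-upTo⁻ a∈) λ x x< x≢ → if-no λ px → x≢ (uniq x a x< (∈-upTo⁻ a∈) px pa)))
    (𝟙≤1 (p a))

count-≡ : ∀ N {a} → a < N → count N (_≡ᵇ a) ≡ 1
count-≡ N {a} a< =
  trans (∑-upTo-single N _ a< λ x _ x≢ → if-no (x≢ ∘ ≡ᵇ⇒≡ x a)) (if-yes (≡ᵇ-refl a))

count<⇒∃ : ∀ N (p q : ℕ → Bool) → count N p < count N q → ∃ λ a → a < N × T (q a) × ¬ T (p a)
count<⇒∃ N p q lt with ∑<⇒∃< (upTo N) (𝟙 ∘ p) (𝟙 ∘ q) lt
... | a , a∈ , pq = a , ∈-upTo⁻ a∈ , 𝟙>0 (≤-<-trans z≤n pq) , λ pa → <⇒≱ pq (𝟙-mono {q a} λ _ → pa)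

least : (ℕ → Bool) → ℕ → ℕ
least p zero    = 0
least p (suc h) = if p 0 then 0 else suc (least (p ∘ suc) h)

least≤ : ∀ p h → least p h ≤ h
least≤ p zero = z≤n
least≤ p (suc h) with p 0
... | true  = z≤n
... | false = s≤s (least≤ (p ∘ suc) h)

least-sound : ∀ p h → least p h < h → T (p (least p h))
least-sound p (suc h) lt with p 0 in eq
... | true  = subst T (sym eq) _
... | false = least-sound (p ∘ suc) h (≤-pred lt)

least-minimal : ∀ p h {r} → T (p r) → least p h ≤ r
least-minimal p zero    _ = z≤n
least-minimal p (suc h) {r} pr with p 0 in eq
... | true  = z≤n
least-minimal p (suc h) {zero}  pr | false = ⊥-elim (subst T eq pr)
least-minimal p (suc h) {suc r} pr | false = s≤s (least-minimal (p ∘ suc) h pr)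

argmin : (ℕ → ℕ) → ℕ → ℕ
argmin f zero    = 0
argmin f (suc h) = if f h ≤ᵇ f (argmin f h) then h else argmin f h

argmin< : ∀ f h → argmin f (suc h) < suc h
argmin< f h with f h ≤ᵇ f (argmin f h)
argmin< f h       | true  = ≤-refl
argmin< f zero    | false = s≤s z≤n
argmin< f (suc h) | false = m<n⇒m<1+n (argmin< f h)

argmin-min : ∀ (f : ℕ → ℕ) h {x} → x < h → f (argmin f h) ≤ f x
argmin-min f (suc h) {x} x< with f h ≤ᵇ f (argmin f h) in eq | m≤n⇒m<n∨m≡n (≤-pred x<)
... | true  | inj₁ x<h  = ≤-trans (≤ᵇ⇒≤ _ _ (subst T (sym eq) _)) (argmin-min f h x<h)
... | true  | inj₂ refl = ≤-refl
... | false | inj₁ x<h  = argmin-min f h x<h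
... | false | inj₂ refl = <⇒≤ (≰⇒> λ le → subst T eq (≤⇒≤ᵇ le))

argmin-cong : ∀ {f g : ℕ → ℕ} h → (∀ x → x < h → f x ≡ g x) → argmin f h ≡ argmin g h
argmin-cong         zero    e = refl
argmin-cong {f} {g} (suc h) e = cong₂ (λ b m → if b then h else m)
  (cong₂ _≤ᵇ_ (e h ≤-refl) (trans (cong f ih) (e (argmin g h) (s≤s (argmin≤ h))))) ih
  where
  argmin≤ : ∀ h → argmin g h ≤ h
  argmin≤ zero    = z≤n
  argmin≤ (suc h) = <⇒≤ (argmin< g h)
  ih : argmin f h ≡ argmin g h
  ih = argmin-cong h λ x x< → e x (m<n⇒m<1+n x<)

argmin-average : ∀ (f : ℕ → ℕ) h → h * f (argmin f h) ≤ ∑ (upTo h) f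
argmin-average f h = begin
  h * f (argmin f h)                  ≡⟨ cong (_* f (argmin f h)) (sym (length-upTo h)) ⟩
  length (upTo h) * f (argmin f h)    ≡⟨ sym (∑-const (upTo h) _) ⟩
  ∑ (upTo h) (λ _ → f (argmin f h))   ≤⟨ ∑-mono∈ (upTo h) (λ x x∈ → argmin-min f h (∈-upTo⁻ x∈)) ⟩
  ∑ (upTo h) f                        ∎
  where open ≤-Reasoning

-- Node programs, as resumptions

data Proc (Y : Set) : Set where
  done : Y → Proc Y
  comm : (ℕ → List Bool) → (List (ℕ × List Bool) → Proc Y) → Proc Y

infixl 1 _>>=_

_>>=_ : ∀ {Y Z : Set} → Proc Y → (Y → Proc Z) → Proc Z
done y   >>= f = f y
comm m κ >>= f = comm m (λ ms → κ ms >>= f)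

loop : ∀ {S : Set} → ℕ → (ℕ → S → Proc S) → S → Proc S
loop zero    body s = done s
loop (suc c) body s = loop c body s >>= body c

procAlgorithm : (ℕ → ℕ → ℕ → List ℕ → Proc (ℕ × ℕ)) → Algorithm
procAlgorithm prog = record
  { State   = Proc (ℕ × ℕ)
  ; init    = prog
  ; send    = sendOf
  ; receive = receiveOf
  ; output  = outputOf
  }
  where
  sendOf : Proc (ℕ × ℕ) → ℕ → List Bool
  sendOf (done _)   _ = []
  sendOf (comm m _) a = m a
  receiveOf : Proc (ℕ × ℕ) → List (ℕ × List Bool) → Proc (ℕ × ℕ)
  receiveOf (done y)   _  = done y
  receiveOf (comm _ κ) ms = κ ms
  outputOf : Proc (ℕ × ℕ) → ℕ × ℕ
  outputOf (done y)   = y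
  outputOf (comm _ _) = 0 , 0

toBits : ℕ → ℕ → List Bool
toBits zero    m = []
toBits (suc B) m = (m % 2 ≡ᵇ 1) ∷ toBits B (m / 2)

fromBits : List Bool → ℕ
fromBits []       = 0
fromBits (b ∷ bs) = 𝟙 b + fromBits bs * 2

length-toBits : ∀ B m → length (toBits B m) ≡ B
length-toBits zero    m = refl
length-toBits (suc B) m = cong suc (length-toBits B (m / 2))

fromBits-toBits : ∀ B m → m < 2 ^ B → fromBits (toBits B m) ≡ m
fromBits-toBits zero    zero    _ = refl
fromBits-toBits zero    (suc m) (s≤s ())
fromBits-toBits (suc B) m m< = begin
  𝟙 (m % 2 ≡ᵇ 1) + fromBits (toBits B (m / 2)) * 2
    ≡⟨ cong₂ (λ x z → x + z * 2) (bit (m % 2) (m%n<n m 2))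
         (fromBits-toBits B (m / 2) (m<n*o⇒m/o<n (subst (m <_) (*-comm 2 (2 ^ B)) m<))) ⟩
  m % 2 + m / 2 * 2
    ≡⟨ sym (m≡m%n+[m/n]*n m 2) ⟩
  m ∎
  where
  open ≡-Reasoning
  bit : ∀ r → r < 2 → 𝟙 (r ≡ᵇ 1) ≡ r
  bit 0 _ = refl
  bit 1 _ = refl
  bit (suc (suc r)) (s≤s (s≤s ()))

received : List (ℕ × List Bool) → ℕ → ℕ
received []             a = 0
received ((b , x) ∷ ms) a = if a ≡ᵇ b then fromBits x else received ms a

exchange : ℕ → (ℕ → ℕ) → Proc (ℕ → ℕ)
exchange B m = comm (λ a → toBits B (m a)) (λ ms → done (received ms))

-- Lockstep executions

module Execution {n : ℕ} (G : Graph n) (id : Fin n → ℕ) (bw : ℕ) where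

  data Runs {Y : Set} : ℕ → (Fin n → Proc Y) → (Fin n → Y) → Set where
    stop : ∀ {P y} → (∀ v → P v ≡ done (y v)) → Runs 0 P y
    next : ∀ {t P y} (m : Fin n → ℕ → List Bool) (κ : Fin n → List (ℕ × List Bool) → Proc Y) →
           (∀ v → P v ≡ comm (m v) (κ v)) →
           (∀ u v → Adj G u v → length (m u (id v)) ≤ bw) →
           Runs t (λ v → κ v (map (λ u → id u , m u (id v)) (neighbours G v))) y →
           Runs (suc t) P y

  Runs-cong : ∀ {Y t} {P P′ : Fin n → Proc Y} {y} → (∀ v → P′ v ≡ P v) → Runs t P y → Runs t P′ y
  Runs-cong e (stop p)         = stop λ v → trans (e v) (p v)
  Runs-cong e (next m κ p l r) = next m κ (λ v → trans (e v) (p v)) l r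

  Runs-bind : ∀ {Y Z t t′} {P : Fin n → Proc Y} {y : Fin n → Y} (f : Fin n → Y → Proc Z) {z} →
              Runs t P y → Runs t′ (λ v → f v (y v)) z → Runs (t + t′) (λ v → P v >>= f v) z
  Runs-bind f (stop p) r′ = Runs-cong (λ v → cong (_>>= f v) (p v)) r′
  Runs-bind f (next m κ p l r) r′ =
    next m (λ v ms → κ v ms >>= f v) (λ v → cong (_>>= f v) (p v)) l (Runs-bind f r r′)

  record Spec {Y : Set} (t : ℕ) (P : Fin n → Proc Y) (Φ : (Fin n → Y) → Set) : Set where
    constructor spec
    field
      {time} : ℕ
      time≤  : time ≤ t
      result : Fin n → Y
      runs   : Runs time P result
      holds  : Φ result

  Spec-done : ∀ {Y : Set} {Φ : (Fin n → Y) → Set} (y : Fin n → Y) → Φ y → Spec 0 (λ v → done (y v)) Φ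
  Spec-done y φ = spec z≤n y (stop λ _ → refl) φ

  Spec-bind : ∀ {Y Z : Set} {t t′} {P : Fin n → Proc Y} {f : Fin n → Y → Proc Z} {Φ : (Fin n → Y) → Set} {Ψ : (Fin n → Z) → Set} →
              Spec t P Φ → (∀ y → Φ y → Spec t′ (λ v → f v (y v)) Ψ) → Spec (t + t′) (λ v → P v >>= f v) Ψ
  Spec-bind {f = f} (spec le y r φ) k with k y φ
  ... | spec le′ z r′ ψ = spec (+-mono-≤ le le′) z (Runs-bind f r r′) ψ

  Spec-weaken : ∀ {Y : Set} {t t′} {P : Fin n → Proc Y} {Φ Ψ : (Fin n → Y) → Set} →
                t ≤ t′ → (∀ y → Φ y → Ψ y) → Spec t P Φ → Spec t′ P Ψ
  Spec-weaken t≤ i (spec le y r φ) = spec (≤-trans le t≤) y r (i y φ)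

  Spec-map : ∀ {Y Z : Set} {t} {P : Fin n → Proc Y} (g : Fin n → Y → Z) {Φ : (Fin n → Y) → Set} {Ψ : (Fin n → Z) → Set} →
             Spec t P Φ → (∀ y → Φ y → Ψ (λ v → g v (y v))) → Spec t (λ v → P v >>= λ y → done (g v y)) Ψ
  Spec-map {t = t} g {Ψ = Ψ} s h =
    Spec-weaken (≤-reflexive (+-identityʳ t)) (λ _ ψ → ψ) (Spec-bind s λ y φ → Spec-done {Φ = Ψ} _ (h y φ))

  Spec-loop : ∀ {S : Set} {t} {body : Fin n → ℕ → S → Proc S} {s₀ : Fin n → S} (Inv : ℕ → (Fin n → S) → Set) c →
              Inv 0 s₀ →
              (∀ i s → i < c → Inv i s → Spec t (λ v → body v i (s v)) (Inv (suc i))) →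
              Spec (c * t) (λ v → loop c (body v) (s₀ v)) (Inv c)
  Spec-loop Inv zero    base body = Spec-done _ base
  Spec-loop {t = t} Inv (suc c) base body =
    Spec-weaken (≤-reflexive (+-comm (c * t) t)) (λ _ φ → φ)
      (Spec-bind (Spec-loop Inv c base (λ i s i< → body i s (m<n⇒m<1+n i<))) (λ s inv → body c s ≤-refl inv))

  Spec-exchange : (m : Fin n → ℕ → ℕ) → (∀ u v → id u ≡ id v → u ≡ v) →
                  (∀ u v → Adj G u v → m u (id v) < 2 ^ bw) →
                  Spec 1 (λ v → exchange bw (m v)) (λ r → ∀ u v → Adj G u v → r v (id u) ≡ m u (id v))
  Spec-exchange m inj bound =
    spec ≤-refl _
      (next _ _ (λ _ → refl) (λ u v _ → ≤-reflexive (length-toBits bw (m u (id v)))) (stop λ _ → refl))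
      (λ u v uv → go v u (neighbours G v) (∈-filter⁺ (T? ∘ λ u → adj G u v) (∈-allFin u) uv) uv)
    where
    go : ∀ v u (us : List (Fin n)) → u ∈ us → Adj G u v →
         received (map (λ u → id u , toBits bw (m u (id v))) us) (id u) ≡ m u (id v)
    go v u (w ∷ us) u∈ uv with id u ≡ᵇ id w in eq
    ... | true with inj u w (≡ᵇ⇒≡ _ _ (subst T (sym eq) _))
    ...   | refl = fromBits-toBits bw _ (bound u v uv)
    go v u (w ∷ us) (here refl) uv | false = ⊥-elim (subst T eq (≡ᵇ-refl (id u)))
    go v u (w ∷ us) (there u∈)  uv | false = go v u us u∈ uv

  -- After its last round every node keeps its result, so an upper bound on the number of rounds suffices.

  run-Spec : ∀ (prog : ℕ → ℕ → ℕ → List ℕ → Proc (ℕ × ℕ)) k {t} {Φ : (Fin n → ℕ × ℕ) → Set} →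
             Spec t (λ v → prog n k (id v) (map id (neighbours G v))) Φ → ∀ {t′} → t ≤ t′ →
             Σ (Fin n → ℕ × ℕ) λ y → Φ y × BandwidthOK (procAlgorithm prog) G id k t′ bw ×
               (∀ v → output (procAlgorithm prog) (run (procAlgorithm prog) G id k t′ v) ≡ y v)
  run-Spec prog k (spec {time} time≤ y r φ) {t′} t≤ =
    y , φ , (λ t t< u v uv → subst (λ s → length (send A (R s u) (id v)) ≤ bw) (+-identityʳ t) (bandwidth 0 (λ _ → refl) r t t< u v uv)) , λ v → cong (output A) (final 0 t′ (λ _ → refl) r (≤-trans (≤-reflexive (+-identityʳ time)) (≤-trans time≤ t≤)) v)
    where
    A = procAlgorithm prog
    R = run A G id k
    final : ∀ {s} {P : Fin n → Proc (ℕ × ℕ)} t₀ t → (∀ v → R t₀ v ≡ P v) → Runs s P y → s + t₀ ≤ t → ∀ v → R t v ≡ done (y v)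
    frozen : ∀ t₀ d v → R t₀ v ≡ done (y v) → R (d + t₀) v ≡ done (y v)
    frozen t₀ zero    v e = e
    frozen t₀ (suc d) v e rewrite frozen t₀ d v e = refl
    advance : ∀ {P : Fin n → Proc (ℕ × ℕ)} t₀ m κ → (∀ v → R t₀ v ≡ P v) → (∀ v → P v ≡ comm (m v) (κ v)) →
              ∀ v → R (suc t₀) v ≡ κ v (map (λ u → id u , m u (id v)) (neighbours G v))
    advance t₀ m κ e p v rewrite trans (e v) (p v) =
      cong (κ v) (msgs (neighbours G v))
      where
      msgs : ∀ us → map (λ u → id u , send A (R t₀ u) (id v)) us ≡ map (λ u → id u , m u (id v)) us
      msgs []       = refl
      msgs (u ∷ us) rewrite trans (e u) (p u) = cong (_ ∷_) (msgs us)
    final t₀ t e (stop p) le v =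
      subst (λ s → R s v ≡ done (y v)) (m∸n+n≡m le) (frozen t₀ (t ∸ t₀) v (trans (e v) (p v)))
    final {suc s} t₀ t e (next m κ p l r) le v =
      final (suc t₀) t (advance t₀ m κ e p) r (≤-trans (≤-reflexive (+-suc s t₀)) le) v
    bandwidth : ∀ {s} {P : Fin n → Proc (ℕ × ℕ)} t₀ → (∀ v → R t₀ v ≡ P v) → Runs s P y →
                ∀ t → t < t′ → ∀ u v → Adj G u v → length (send A (R (t ∸ t₀ + t₀) u) (id v)) ≤ bw
    bandwidth t₀ e (stop p) t _ u v uv rewrite frozen t₀ (t ∸ t₀) u (trans (e u) (p u)) = z≤n
    bandwidth t₀ e (next m κ p l r) t t< u v uv with t ≤? t₀
    ... | yes t≤t₀ rewrite m≤n⇒m∸n≡0 t≤t₀ | trans (e u) (p u) = l u v uv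
    ... | no t≰ = subst (λ s → length (send A (R s u) (id v)) ≤ bw)
                    (trans (m∸n+n≡m (≰⇒> t≰)) (sym (m∸n+n≡m (<⇒≤ (≰⇒> t≰)))))
                    (bandwidth (suc t₀) (advance t₀ m κ e p) r t t< u v uv)

module Walks {n : ℕ} (G : Graph n) where

  Adj-sym : ∀ {u v} → Adj G u v → Adj G v u
  Adj-sym {u} {v} = subst T (adj-sym G u v)

  Within-mono : ∀ {d e u v} → d ≤ e → Within G d u v → Within G e u v
  Within-mono d≤e       here′       = here′
  Within-mono (s≤s d≤e) (step′ a w) = step′ a (Within-mono d≤e w)

  Within-trans : ∀ {d e u v w} → Within G d u v → Within G e v w → Within G (d + e) u w
  Within-trans {d} {e} here′ q = Within-mono (m≤n+m e d) q
  Within-trans (step′ a p)   q = step′ a (Within-trans p q)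

  Within-sym : ∀ {d u v} → Within G d u v → Within G d v u
  Within-sym here′ = here′
  Within-sym {suc d} (step′ a p) =
    Within-mono (≤-reflexive (+-comm d 1)) (Within-trans (Within-sym p) (step′ (Adj-sym a) here′))

  within? : ∀ d u v → Dec (Within G d u v)
  within? zero u v with u FinP.≟ v
  ... | yes refl = yes here′
  ... | no u≢v   = no λ { here′ → u≢v refl }
  within? (suc d) u v with u FinP.≟ v | FinP.any? (λ w → T? (adj G u w) ×-dec within? d w v)
  ... | yes refl | _                 = yes here′
  ... | no _     | yes (w , uw , wv) = yes (step′ uw wv)
  ... | no u≢v   | no ¬w             = no λ { here′ → u≢v refl ; (step′ uw wv) → ¬w (_ , uw , wv) }

-- Distances with an initial offset at every source, capped at Hc

module Distance {n : ℕ} (G : Graph n) (id : Fin n → ℕ) (id-inj : ∀ u v → id u ≡ id v → u ≡ v)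
                (Hc : ℕ) (src : Fin n → ℕ) where
  open Walks G

  private
    test : Fin n → Fin n → ℕ → Bool
    test u v r = ⌊ (src u ≤? r) ×-dec within? (r ∸ src u) v u ⌋

  D : Fin n → Fin n → ℕ
  D u v = least (test u v) Hc

  nodeOf : ℕ → Maybe (Fin n)
  nodeOf a = findᵇ (λ u → id u ≡ᵇ a) (allFin n)

  nodeOf-id : ∀ u → nodeOf (id u) ≡ just u
  nodeOf-id u = findᵇ-unique _ (allFin n) (∈-allFin u) (≡ᵇ-refl (id u)) λ y _ e → id-inj y u (≡ᵇ⇒≡ _ _ e)

  distOf : Fin n → Maybe (Fin n) → ℕ
  distOf v (just u) = D u v
  distOf v nothing  = Hc

  E : Fin n → ℕ → ℕ
  E v a = distOf v (nodeOf a)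

  E-id : ∀ v u → E v (id u) ≡ D u v
  E-id v u = cong (distOf v) (nodeOf-id u)

  E≤Hc : ∀ v a → E v a ≤ Hc
  E≤Hc v a with nodeOf a
  ... | just u  = least≤ _ Hc
  ... | nothing = ≤-refl

  E-node : ∀ v a → E v a < Hc → ∃ λ u → id u ≡ a
  E-node v a lt with nodeOf a in eq
  ... | just u  = u , ≡ᵇ⇒≡ _ _ (proj₂ (findᵇ-sound _ (allFin n) eq))
  ... | nothing = ⊥-elim (<-irrefl refl lt)

  E-walk : ∀ v u → E v (id u) < Hc → src u ≤ E v (id u) × Within G (E v (id u) ∸ src u) v u
  E-walk v u lt rewrite E-id v u = toWitness (least-sound (test u v) Hc lt)

  E-reach : ∀ {d} v u → Within G d v u → E v (id u) ≤ src u + d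
  E-reach {d} v u w rewrite E-id v u =
    least-minimal (test u v) Hc
      (fromWitness (m≤m+n (src u) d , subst (λ e → Within G e v u) (sym (m+n∸m≡n (src u) d)) w))

  E-self : ∀ v → E v (id v) ≤ src v
  E-self v = ≤-trans (E-reach v v (here′ {d = 0})) (≤-reflexive (+-identityʳ (src v)))

  E-lip-walk : ∀ {d} v w a → Within G d v w → E v a ≤ E w a + d
  E-lip-walk {d} v w a vw with E w a <? Hc
  ... | no  ge = ≤-trans (E≤Hc v a) (≤-trans (≮⇒≥ ge) (m≤m+n _ d))
  ... | yes lt with E-node w a lt
  ...   | u , refl with E-walk w u lt
  ...     | s≤ , wu = begin
    E v (id u)                              ≤⟨ E-reach v u (Within-trans vw wu) ⟩
    src u + (d + (E w (id u) ∸ src u))      ≡⟨ rearr (src u) d (E w (id u) ∸ src u) ⟩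
    src u + (E w (id u) ∸ src u) + d        ≡⟨ cong (_+ d) (m+[n∸m]≡n s≤) ⟩
    E w (id u) + d                          ∎
    where
    open ≤-Reasoning
    rearr : ∀ s d x → s + (d + x) ≡ s + x + d
    rearr = solve-∀

  E-lip : ∀ v w a → Adj G v w → E v a ≤ suc (E w a)
  E-lip v w a vw = ≤-trans (E-lip-walk v w a (step′ vw here′)) (≤-reflexive (+-comm (E w a) 1))

  E-descend : ∀ v a → E v a < Hc → (a ≡ id v × E v a ≡ src v) ⊎ (∃ λ w → Adj G v w × suc (E w a) ≡ E v a)
  E-descend v a lt with E-node v a lt
  ... | u , refl with E-walk v u lt
  ...   | s≤ , walk = go walk refl
    where
    go : ∀ {d u′} → Within G d v u′ → d ≡ E v (id u′) ∸ src u′ → {{_ : u′ ≡ u}} →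
         (id u ≡ id v × E v (id u) ≡ src v) ⊎ (∃ λ w → Adj G v w × suc (E w (id u)) ≡ E v (id u))
    go here′ _ {{refl}} = inj₁ (refl , ≤-antisym (E-self v) s≤)
    go {suc d} (step′ {w = w} a p) eq {{refl}} = inj₂ (w , a , ≤-antisym le (E-lip v w (id u) a))
      where
      le : suc (E w (id u)) ≤ E v (id u)
      le = begin
        suc (E w (id u))                     ≤⟨ s≤s (E-reach w u p) ⟩
        suc (src u + d)                      ≡⟨ sym (+-suc (src u) d) ⟩
        src u + suc d                        ≡⟨ cong (src u +_) eq ⟩
        src u + (E v (id u) ∸ src u)         ≡⟨ m+[n∸m]≡n s≤ ⟩
        E v (id u)                           ∎
        where open ≤-Reasoning

-- Ranks of the identifiers below N, ordered by (K a , a)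

module Rank (N : ℕ) where

  key : (ℕ → ℕ) → ℕ → ℕ
  key K a = K a * N + a

  below : (ℕ → ℕ) → ℕ → ℕ
  below K θ = count N λ b → key K b <ᵇ θ

  rank : (ℕ → ℕ) → ℕ → ℕ
  rank K a = below K (key K a)

  key-< : ∀ K {a b} → a < N → K a < K b → key K a < key K b
  key-< K {a} {b} a<N lt = begin-strict
    K a * N + a       <⟨ +-monoʳ-< (K a * N) a<N ⟩
    K a * N + N       ≡⟨ +-comm (K a * N) N ⟩
    suc (K a) * N     ≤⟨ *-monoˡ-≤ N lt ⟩
    K b * N           ≤⟨ m≤m+n _ b ⟩
    K b * N + b       ∎
    where open ≤-Reasoning

  key-≤⁻ : ∀ K {a b} → b < N → key K a ≤ key K b → K a ≤ K b
  key-≤⁻ K b<N le = ≮⇒≥ λ lt → <⇒≱ (key-< K b<N lt) le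

  key-inj : ∀ K {a b} → a < N → b < N → key K a ≡ key K b → a ≡ b
  key-inj K {a} {b} a<N b<N eq = +-cancelˡ-≡ (K a * N) a b (trans eq (cong (λ x → x * N + b) (sym Ka≡Kb)))
    where
    Ka≡Kb : K a ≡ K b
    Ka≡Kb = ≤-antisym (key-≤⁻ K b<N (≤-reflexive eq)) (key-≤⁻ K a<N (≤-reflexive (sym eq)))

  key-mono : ∀ {K K′ : ℕ → ℕ} a → K a ≤ K′ a → key K a ≤ key K′ a
  key-mono a le = +-monoˡ-≤ a (*-monoˡ-≤ N le)

  below-mono : ∀ K {θ θ′} → θ ≤ θ′ → below K θ ≤ below K θ′
  below-mono K le = count-mono N λ b _ lt → <⇒<ᵇ (<-≤-trans (<ᵇ⇒< _ _ lt) le)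

  below-suc≤ : ∀ K θ → below K (suc θ) ≤ suc (below K θ)
  below-suc≤ K θ = begin
    below K (suc θ)
      ≤⟨ ∑-mono (upTo N) (λ b → split (key K b)) ⟩
    ∑ (upTo N) (λ b → 𝟙 (key K b ≡ᵇ θ) + 𝟙 (key K b <ᵇ θ))
      ≡⟨ ∑-+ (upTo N) _ _ ⟩
    count N (λ b → key K b ≡ᵇ θ) + below K θ
      ≤⟨ +-monoˡ-≤ (below K θ) (count≤1 N (λ b → key K b ≡ᵇ θ) λ a b a< b< p q →
           key-inj K a< b< (trans (≡ᵇ⇒≡ _ _ p) (sym (≡ᵇ⇒≡ _ _ q)))) ⟩
    suc (below K θ) ∎
    where
    open ≤-Reasoning
    split : ∀ x → 𝟙 (x <ᵇ suc θ) ≤ 𝟙 (x ≡ᵇ θ) + 𝟙 (x <ᵇ θ)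
    split x with x <? suc θ
    ... | no ge = ≤-trans (≤-reflexive (if-no {b = x <ᵇ suc θ} (ge ∘ <ᵇ⇒< x (suc θ)))) z≤n
    ... | yes (s≤s le) with m≤n⇒m<n∨m≡n le
    ...   | inj₁ lt   = ≤-trans (𝟙≤1 _) (≤-trans (≤-reflexive (sym (if-yes (<⇒<ᵇ lt)))) (m≤n+m _ (𝟙 (x ≡ᵇ θ))))
    ...   | inj₂ refl = ≤-trans (𝟙≤1 _) (≤-trans (≤-reflexive (sym (if-yes (≡ᵇ-refl x)))) (m≤m+n _ _))

  below-key : ∀ K {a θ} → a < N → key K a < θ → rank K a < below K θ
  below-key K {a} {θ} a<N lt = begin
    suc (rank K a)
      ≡⟨ cong (_+ rank K a) (sym (count-≡ N a<N)) ⟩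
    count N (_≡ᵇ a) + rank K a
      ≡⟨ sym (∑-+ (upTo N) _ _) ⟩
    ∑ (upTo N) (λ b → 𝟙 (b ≡ᵇ a) + 𝟙 (key K b <ᵇ key K a))
      ≤⟨ ∑-mono (upTo N) join ⟩
    below K θ ∎
    where
    open ≤-Reasoning
    join : ∀ b → 𝟙 (b ≡ᵇ a) + 𝟙 (key K b <ᵇ key K a) ≤ 𝟙 (key K b <ᵇ θ)
    join b with b ≟ a
    ... | yes refl = ≤-reflexive (trans (cong₂ _+_ (if-yes {b = b ≡ᵇ b} (≡ᵇ-refl b)) (if-no {b = key K b <ᵇ key K b} (<-irrefl refl ∘ <ᵇ⇒< (key K b) (key K b))))
                       (sym (if-yes (<⇒<ᵇ lt))))
    ... | no b≢a   = ≤-trans (≤-reflexive (cong (_+ 𝟙 (key K b <ᵇ key K a)) (if-no {b = b ≡ᵇ a} (b≢a ∘ ≡ᵇ⇒≡ b a))))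
                       (𝟙-mono λ p → <⇒<ᵇ (<-trans (<ᵇ⇒< _ _ p) lt))

  rank-< : ∀ K {a b} → a < N → key K a < key K b → rank K a < rank K b
  rank-< K = below-key K

  rank-<⁻ : ∀ K {a b} → rank K a < rank K b → key K a < key K b
  rank-<⁻ K lt = ≰⇒> λ le → <⇒≱ lt (below-mono K le)

  -- The slot K a + rank K a increases strictly along the order.
  slot-inj : ∀ K {a b} → a < N → b < N → K a + rank K a ≡ K b + rank K b → a ≡ b
  slot-inj K {a} {b} a<N b<N eq = key-inj K a<N b<N (≤-antisym (le b<N a<N (sym eq)) (le a<N b<N eq))
    where
    le : ∀ {a b} → a < N → b < N → K a + rank K a ≡ K b + rank K b → key K b ≤ key K a
    le a<N b<N eq = ≮⇒≥ λ lt →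
      <⇒≢ (+-mono-≤-< (key-≤⁻ K b<N (<⇒≤ lt)) (rank-< K a<N lt)) eq

  module Top (Hc Λ : ℕ) where

    top : (ℕ → ℕ) → ℕ → Bool
    top K a = (K a <ᵇ Hc) ∧ (rank K a <ᵇ Λ)

    top-intro : ∀ K {a} → K a < Hc → rank K a < Λ → T (top K a)
    top-intro K p q = ∧-intro (<⇒<ᵇ p) (<⇒<ᵇ q)

    top-elim : ∀ K {a} → T (top K a) → K a < Hc × rank K a < Λ
    top-elim K {a} t with ∧-elim {K a <ᵇ Hc} t
    ... | p , q = <ᵇ⇒< _ _ p , <ᵇ⇒< _ _ q

    private
      threshold : ∀ K Θ → Σ ℕ λ θ → θ ≤ Θ × below K θ ≤ Λ × (θ ≡ Θ ⊎ below K θ ≡ Λ)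
      threshold K Θ with below K Θ ≤? Λ
      threshold K Θ       | yes le = Θ , ≤-refl , le , inj₁ refl
      threshold K zero    | no gt  = ⊥-elim (gt (≤-trans (≤-reflexive (∑-zero∈ (upTo N) λ _ _ → refl)) z≤n))
      threshold K (suc Θ) | no gt with threshold K Θ
      ... | θ , θ≤ , le , inj₂ eq   = θ , m≤n⇒m≤1+n θ≤ , le , inj₂ eq
      ... | θ , θ≤ , le , inj₁ refl =
        θ , m≤n⇒m≤1+n θ≤ , le , inj₂ (≤-antisym le (≤-pred (≤-trans (≰⇒> gt) (below-suc≤ K θ))))

      module _ (K : ℕ → ℕ) where
        Θ = Hc * N
        θ = proj₁ (threshold K Θ)
        θ≤Θ = proj₁ (proj₂ (threshold K Θ))
        bθ≤Λ = proj₁ (proj₂ (proj₂ (threshold K Θ)))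
        alt = proj₂ (proj₂ (proj₂ (threshold K Θ)))

        key<Θ : ∀ {a} → a < N → K a < Hc → key K a < Θ
        key<Θ {a} a<N lt = begin-strict
          K a * N + a   <⟨ +-monoʳ-< (K a * N) a<N ⟩
          K a * N + N   ≡⟨ +-comm (K a * N) N ⟩
          suc (K a) * N ≤⟨ *-monoˡ-≤ N lt ⟩
          Hc * N        ∎
          where open ≤-Reasoning

        top⇒ : ∀ a → a < N → T (top K a) → key K a < θ
        top⇒ a a<N t with top-elim K t | alt
        ... | p , q | inj₁ eq = <-≤-trans (key<Θ a<N p) (≤-reflexive (sym eq))
        ... | p , q | inj₂ eq = ≰⇒> λ le → <⇒≱ q (≤-trans (≤-reflexive (sym eq)) (below-mono K le))

        ⇒top : ∀ a → a < N → key K a < θ → T (top K a)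
        ⇒top a a<N lt = top-intro K (*-cancelʳ-< N (K a) Hc (≤-<-trans (m≤m+n _ a) (<-≤-trans lt θ≤Θ)))
                          (<-≤-trans (below-key K a<N lt) bθ≤Λ)

        count-top≡ : count N (top K) ≡ below K θ
        count-top≡ = count-cong N (λ a a< t → <⇒<ᵇ (top⇒ a a< t)) (λ a a< p → ⇒top a a< (<ᵇ⇒< _ _ p))

    count-top≤ : ∀ K → count N (top K) ≤ Λ
    count-top≤ K = ≤-trans (≤-reflexive (count-top≡ K)) (bθ≤Λ K)

    count-top≥ : ∀ K → Λ ≤ count N (λ a → K a <ᵇ Hc) → Λ ≤ count N (top K)
    count-top≥ K le with alt K
    ... | inj₂ eq = ≤-reflexive (sym (trans (count-top≡ K) eq))
    ... | inj₁ eq = ≤-trans le (≤-trans (count-mono N λ a a< p → <⇒<ᵇ (<-≤-trans (key<Θ K a< (<ᵇ⇒< _ _ p)) (≤-reflexive (sym eq))))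
                      (≤-reflexive (sym (count-top≡ K))))

    count-top-full : ∀ K {a} → a < N → K a < Hc → Λ ≤ rank K a → Λ ≤ count N (top K)
    count-top-full K {a} a<N p le =
      count-top≥ K (≤-trans le (count-mono N λ b b< q → <⇒<ᵇ (≤-<-trans (key-≤⁻ K a<N (<⇒≤ (<ᵇ⇒< _ _ q))) p)))

    module Approx (L K : ℕ → ℕ) (L≤K : ∀ a → L a ≤ K a)
                  (exact : ∀ a → a < N → T (top L a) → K a ≡ L a) where

      top-exact : ∀ {a} → a < N → T (top L a) → rank K a ≡ rank L a
      top-exact {a} a<N t = count-cong N to from
        where
        keys : ∀ {b} → b < N → T (top L b) → key K b ≡ key L b
        keys {b} b<N s = cong (λ x → x * N + b) (exact b b<N s)
        to : ∀ b → b < N → T (key K b <ᵇ key K a) → T (key L b <ᵇ key L a)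
        to b _ lt = <⇒<ᵇ (≤-<-trans (key-mono {L} {K} b (L≤K b)) (<-≤-trans (<ᵇ⇒< _ _ lt) (≤-reflexive (keys a<N t))))
        from : ∀ b → b < N → T (key L b <ᵇ key L a) → T (key K b <ᵇ key K a)
        from b b<N lt = <⇒<ᵇ (subst₂ _<_ (sym (keys b<N s)) (sym (keys a<N t)) (<ᵇ⇒< _ _ lt))
          where
          s : T (top L b)
          s = top-intro L (≤-<-trans (key-≤⁻ L a<N (<⇒≤ (<ᵇ⇒< _ _ lt))) (proj₁ (top-elim L t)))
                (<-trans (rank-< L b<N (<ᵇ⇒< _ _ lt)) (proj₂ (top-elim L t)))

      top-K⇒L : ∀ {a} → a < N → T (top K a) → T (top L a)
      top-K⇒L {a} a<N t with top-elim K t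
      ... | p , q = top-intro L La< (≰⇒> λ le → <⇒≱ q (many le))
        where
        La< : L a < Hc
        La< = ≤-<-trans (L≤K a) p
        many : Λ ≤ rank L a → Λ ≤ rank K a
        many le = ≤-trans (count-top-full L a<N La< le) (count-mono N inc)
          where
          inc : ∀ b → b < N → T (top L b) → T (key K b <ᵇ key K a)
          inc b b<N s = <⇒<ᵇ (begin-strict
            key K b ≡⟨ cong (λ x → x * N + b) (exact b b<N s) ⟩
            key L b <⟨ rank-<⁻ L (<-≤-trans (proj₂ (top-elim L s)) le) ⟩
            key L a ≤⟨ key-mono {L} {K} a (L≤K a) ⟩
            key K a ∎)
            where open ≤-Reasoning

      top-L⇒K : ∀ {a} → a < N → T (top L a) → T (top K a)
      top-L⇒K {a} a<N t with top-elim L t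
      ... | p , q = top-intro K (subst (_< Hc) (sym (exact a a<N t)) p) (subst (_< Λ) (sym (top-exact a<N t)) q)

-- Messages carrying an identifier and a number

pack : ℕ → ℕ → ℕ → ℕ
pack M a x = suc (a * suc M + x)

isFor : ℕ → ℕ → ℕ → Bool
isFor M a zero    = false
isFor M a (suc m) = m / suc M ≡ᵇ a

payload : ℕ → ℕ → ℕ
payload M m = (m ∸ 1) % suc M

private
  pack-div : ∀ M a {x} → x ≤ M → (a * suc M + x) / suc M ≡ a
  pack-div M a {x} x≤M = begin
    (a * suc M + x) / suc M            ≡⟨ +-distrib-/-∣ˡ x (divides a refl) ⟩
    a * suc M / suc M + x / suc M      ≡⟨ cong₂ _+_ (m*n/n≡m a (suc M)) (m<n⇒m/n≡0 (s≤s x≤M)) ⟩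
    a + 0                              ≡⟨ +-identityʳ a ⟩
    a                                  ∎
    where open ≡-Reasoning

isFor-pack : ∀ M a {x} → x ≤ M → T (isFor M a (pack M a x))
isFor-pack M a x≤M = ≡⇒≡ᵇ _ a (pack-div M a x≤M)

isFor-pack⁻ : ∀ M {a b x} → x ≤ M → T (isFor M b (pack M a x)) → a ≡ b
isFor-pack⁻ M {a} x≤M t = trans (sym (pack-div M a x≤M)) (≡ᵇ⇒≡ _ _ t)

payload-pack : ∀ M a {x} → x ≤ M → payload M (pack M a x) ≡ x
payload-pack M a {x} x≤M = begin
  (a * suc M + x) % suc M ≡⟨ cong (_% suc M) (+-comm (a * suc M) x) ⟩
  (x + a * suc M) % suc M ≡⟨ [m+kn]%n≡m%n x a (suc M) ⟩
  x % suc M               ≡⟨ m<n⇒m%n≡m (s≤s x≤M) ⟩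
  x                       ∎
  where open ≡-Reasoning

pack≤ : ∀ {N M a x} → a < N → x ≤ M → pack M a x ≤ N * suc M
pack≤ {N} {M} {a} {x} a<N x≤M = begin
  suc (a * suc M + x)  ≡⟨ sym (+-suc (a * suc M) x) ⟩
  a * suc M + suc x    ≤⟨ +-monoʳ-≤ (a * suc M) (s≤s x≤M) ⟩
  a * suc M + suc M    ≡⟨ +-comm (a * suc M) (suc M) ⟩
  suc a * suc M        ≤⟨ *-monoˡ-≤ (suc M) a<N ⟩
  N * suc M            ∎
  where open ≤-Reasoning

packMaybe : ℕ → (ℕ → ℕ) → Maybe ℕ → ℕ
packMaybe M f nothing  = 0
packMaybe M f (just a) = pack M a (f a)

packMaybe≤ : ∀ {N M f} (m : Maybe ℕ) → (∀ a → m ≡ just a → a < N × f a ≤ M) → packMaybe M f m ≤ N * suc M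
packMaybe≤ nothing  h = z≤n
packMaybe≤ (just a) h = pack≤ (proj₁ (h a refl)) (proj₂ (h a refl))

packMaybe-isFor : ∀ {M f a} (m : Maybe ℕ) → (∀ b → m ≡ just b → f b ≤ M) → T (isFor M a (packMaybe M f m)) → m ≡ just a
packMaybe-isFor {M} (just b) h t = cong just (isFor-pack⁻ M (h b refl) t)

-- Each node learns the Λ nearest sources

module DetectProgram (bw N Hc Λ : ℕ) (nbrs : List ℕ) where
  open Rank N
  open Top Hc Λ

  due : ℕ → (ℕ → ℕ) → Maybe ℕ
  due r K = findᵇ (λ a → (K a <ᵇ Hc) ∧ (K a + rank K a ≡ᵇ r)) (upTo N)

  heard : ℕ → (ℕ → ℕ) → ℕ → List ℕ → ℕ
  heard r rc a []       = Hc
  heard r rc a (w ∷ ws) =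
    if isFor N a (rc w) then suc (r ∸ payload N (rc w)) ⊓ heard r rc a ws else heard r rc a ws

  round : ℕ → (ℕ → ℕ) → Proc (ℕ → ℕ)
  round r K = exchange bw (λ _ → packMaybe N (rank K) (due r K)) >>= λ rc → done (λ a → K a ⊓ heard r rc a nbrs)

  start : ℕ → ℕ → ℕ → ℕ
  start me σ a = if a ≡ᵇ me then σ ⊓ Hc else Hc

  dist : (ℕ → ℕ) → ℕ → ℕ
  dist K a = if top K a then K a else Hc

  slot : (ℕ → ℕ) → ℕ → ℕ
  slot K a = if top K a then K a + rank K a else Hc + Λ

  detect : ℕ → ℕ → Proc ((ℕ → ℕ) × (ℕ → ℕ))
  detect me σ = loop (Hc + Λ) round (start me σ) >>= λ K → done (dist K , slot K)

record IsSlots {n : ℕ} (G : Graph n) (id : Fin n → ℕ) (t : ℕ) (s : Fin n → ℕ → ℕ) : Set where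
  field
    slots-inj : ∀ v a b → s v a ≡ s v b → s v a < t → a ≡ b
    node      : ∀ v a → s v a < t → ∃ λ u → id u ≡ a
    upward    : ∀ v a → s v a < t → a ≡ id v ⊎ (∃ λ w → Adj G v w × s w a < s v a)

module Detect {n : ℕ} (G : Graph n) (id : Fin n → ℕ) (id-inj : ∀ u v → id u ≡ id v → u ≡ v)
              (N : ℕ) (id<N : ∀ v → id v < N) (bw : ℕ) (fits : N * suc N < 2 ^ bw)
              (Hc Λ : ℕ) (src : Fin n → ℕ) where
  open Execution G id bw
  open Walks G
  open Distance G id id-inj Hc src
  open Rank N
  open Top Hc Λ

  nbrs : Fin n → List ℕ
  nbrs v = map id (neighbours G v)

  open module Prog v = DetectProgram bw N Hc Λ (nbrs v) using (heard; round; detect)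
  open DetectProgram bw N Hc Λ [] using (due; start; dist; slot)

  E<N : ∀ {v a} → E v a < Hc → a < N
  E<N {v} {a} lt with E-node v a lt
  ... | u , refl = id<N u

  rank≤N : ∀ K a → rank K a ≤ N
  rank≤N K a = begin
    rank K a                  ≤⟨ ∑-mono (upTo N) (λ b → 𝟙≤1 _) ⟩
    ∑ (upTo N) (λ _ → 1)      ≡⟨ ∑-const (upTo N) 1 ⟩
    length (upTo N) * 1       ≡⟨ trans (*-identityʳ _) (length-upTo N) ⟩
    N                         ∎
    where open ≤-Reasoning

  rank-descend : ∀ {v w a} → Adj G v w → suc (E w a) ≡ E v a → rank (E w) a ≤ rank (E v) a
  rank-descend {v} {w} {a} vw eq = count-mono N λ b _ lt → <⇒<ᵇ (begin-strict
    E v b * N + b          ≤⟨ +-monoˡ-≤ b (*-monoˡ-≤ N (E-lip v w b vw)) ⟩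
    suc (E w b) * N + b    ≡⟨ +-assoc N _ b ⟩
    N + key (E w) b        <⟨ +-monoʳ-< N (<ᵇ⇒< (key (E w) b) _ lt) ⟩
    N + key (E w) a        ≡⟨ sym (+-assoc N _ a) ⟩
    suc (E w a) * N + a    ≡⟨ cong (λ x → x * N + a) eq ⟩
    E v a * N + a          ∎)
    where open ≤-Reasoning

  record Inv (r : ℕ) (K : Fin n → ℕ → ℕ) : Set where
    field
      sound  : ∀ v a → E v a ≤ K v a
      own    : ∀ v → K v (id v) ≤ src v
      hears  : ∀ v w a → Adj G v w → E w a < Hc → E w a + rank (E w) a < r → K v a ≤ suc (E w a)

    exact : ∀ v a → E v a < Hc → E v a + rank (E v) a ≤ r → K v a ≡ E v a
    exact v a lt le with E-descend v a lt
    ... | inj₁ (refl , eq)    = ≤-antisym (≤-trans (own v) (≤-reflexive (sym eq))) (sound v a)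
    ... | inj₂ (w , vw , eq)  = ≤-antisym (≤-trans (hears v w a vw Ew< (≤-trans Ew+ le)) (≤-reflexive eq)) (sound v a)
      where
      Ew< : E w a < Hc
      Ew< = <-trans (≤-reflexive eq) lt
      Ew+ : E w a + rank (E w) a < E v a + rank (E v) a
      Ew+ = +-mono-<-≤ (≤-reflexive eq) (rank-descend vw eq)

    exact-rank : ∀ v a → E v a < Hc → E v a + rank (E v) a ≤ r → rank (K v) a ≡ rank (E v) a
    exact-rank v a lt le = TopR.Approx.top-exact (E v) (K v) (sound v) ex (E<N lt) (TopR.top-intro (E v) lt ≤-refl)
      where
      module TopR = Top Hc (suc (rank (E v) a))
      ex : ∀ b → b < N → T (TopR.top (E v) b) → K v b ≡ E v b
      ex b b<N t with TopR.top-elim (E v) t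
      ... | p , s≤s q = exact v b p (≤-trans (+-mono-≤ (key-≤⁻ (E v) (E<N lt) kb≤) q) le)
        where
        kb≤ : key (E v) b ≤ key (E v) a
        kb≤ = ≮⇒≥ λ gt → <⇒≱ (rank-< (E v) (E<N lt) gt) q

  message : ℕ → (Fin n → ℕ → ℕ) → Fin n → ℕ
  message r K u = packMaybe N (rank (K u)) (due r (K u))

  due-sound : ∀ r K {a} → due r K ≡ just a → a < N × K a < Hc × K a + rank K a ≡ r
  due-sound r K {a} eq with findᵇ-sound _ (upTo N) eq
  ... | a∈ , t with ∧-elim {K a <ᵇ Hc} t
  ...   | p , q = ∈-upTo⁻ a∈ , <ᵇ⇒< _ _ p , ≡ᵇ⇒≡ _ _ q

  module _ (r : ℕ) (K : Fin n → ℕ → ℕ) (inv : Inv r K) (rc : Fin n → ℕ → ℕ)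
           (got : ∀ u v → Adj G u v → rc v (id u) ≡ message r K u) where
    open Inv inv

    private
      K′ : Fin n → ℕ → ℕ
      K′ v a = K v a ⊓ heard v r (rc v) a (nbrs v)

      heard-sound : ∀ v a (ws : List (Fin n)) → (∀ w → w ∈ ws → Adj G w v) → E v a ≤ heard v r (rc v) a (map id ws)
      heard-sound v a []       h = E≤Hc v a
      heard-sound v a (w ∷ ws) h with isFor N a (rc v (id w)) in eq
      ... | false = heard-sound v a ws λ x x∈ → h x (there x∈)
      ... | true  = ⊓-glb le (heard-sound v a ws λ x x∈ → h x (there x∈))
        where
        wv : Adj G w v
        wv = h w (here refl)
        isd : due r (K w) ≡ just a
        isd = packMaybe-isFor (due r (K w)) (λ b _ → rank≤N (K w) b)
                (subst (λ m → T (isFor N a m)) (got w v wv) (subst T (sym eq) _))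
        pay : payload N (rc v (id w)) ≡ rank (K w) a
        pay = trans (cong (payload N) (trans (got w v wv) (cong (packMaybe N (rank (K w))) isd))) (payload-pack N a (rank≤N (K w) a))
        le : E v a ≤ suc (r ∸ payload N (rc v (id w)))
        le = begin
          E v a                                 ≤⟨ E-lip v w a (Adj-sym wv) ⟩
          suc (E w a)                           ≤⟨ s≤s (sound w a) ⟩
          suc (K w a)                           ≡⟨ cong suc (sym (m+n∸n≡m (K w a) (rank (K w) a))) ⟩
          suc (K w a + rank (K w) a ∸ rank (K w) a)
            ≡⟨ cong₂ (λ x z → suc (x ∸ z)) (proj₂ (proj₂ (due-sound r (K w) isd))) (sym pay) ⟩
          suc (r ∸ payload N (rc v (id w)))     ∎
          where open ≤-Reasoning

      heard-≤ : ∀ v w a (ws : List (Fin n)) → w ∈ ws → Adj G w v → E w a < Hc → E w a + rank (E w) a ≡ r →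
                heard v r (rc v) a (map id ws) ≤ suc (E w a)
      heard-≤ v w a (x ∷ ws) (there w∈) wv lt eq with isFor N a (rc v (id x))
      ... | true  = ≤-trans (m⊓n≤n _ _) (heard-≤ v w a ws w∈ wv lt eq)
      ... | false = heard-≤ v w a ws w∈ wv lt eq
      heard-≤ v w a (x ∷ ws) (here refl) wv lt eq = ≤-trans (≤-reflexive (if-yes forA)) (≤-trans (m⊓n≤m _ _) (≤-reflexive val))
        where
        Kw : K w a ≡ E w a
        Kw = exact w a lt (≤-reflexive eq)
        Rw : rank (K w) a ≡ rank (E w) a
        Rw = exact-rank w a lt (≤-reflexive eq)
        isd : due r (K w) ≡ just a
        isd = findᵇ-unique _ (upTo N) (∈-upTo⁺ (E<N lt))
                (∧-intro (<⇒<ᵇ (subst (_< Hc) (sym Kw) lt)) (≡⇒≡ᵇ _ r (trans (cong₂ _+_ Kw Rw) eq)))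
                λ b b∈ t → slot-inj (K w) (∈-upTo⁻ b∈) (E<N lt)
                  (trans (≡ᵇ⇒≡ _ r (proj₂ (∧-elim {K w b <ᵇ Hc} t))) (sym (trans (cong₂ _+_ Kw Rw) eq)))
        msg : rc v (id w) ≡ pack N a (rank (K w) a)
        msg = trans (got w v wv) (cong (packMaybe N (rank (K w))) isd)
        forA : T (isFor N a (rc v (id w)))
        forA = subst (λ m → T (isFor N a m)) (sym msg) (isFor-pack N a (rank≤N (K w) a))
        val : suc (r ∸ payload N (rc v (id w))) ≡ suc (E w a)
        val = cong suc (begin
          r ∸ payload N (rc v (id w))               ≡⟨ cong₂ _∸_ (sym eq) (trans (cong (payload N) msg) (trans (payload-pack N a (rank≤N (K w) a)) Rw)) ⟩
          E w a + rank (E w) a ∸ rank (E w) a       ≡⟨ m+n∸n≡m (E w a) (rank (E w) a) ⟩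
          E w a                                     ∎)
          where open ≡-Reasoning

    Inv-step : Inv (suc r) K′
    Inv-step = record
      { sound = λ v a → ⊓-glb (sound v a) (heard-sound v a (neighbours G v) λ w w∈ → proj₂ (∈-filter⁻ (T? ∘ λ u → adj G u v) {xs = allFin n} w∈))
      ; own   = λ v → ≤-trans (m⊓n≤m _ _) (own v)
      ; hears = hears′
      }
      where
      hears′ : ∀ v w a → Adj G v w → E w a < Hc → E w a + rank (E w) a < suc r → K′ v a ≤ suc (E w a)
      hears′ v w a vw lt (s≤s le) with m≤n⇒m<n∨m≡n le
      ... | inj₁ lt′ = ≤-trans (m⊓n≤m _ _) (hears v w a vw lt lt′)
      ... | inj₂ eq  = ≤-trans (m⊓n≤n (K v a) _)
                         (heard-≤ v w a (neighbours G v) (∈-filter⁺ (T? ∘ λ u → adj G u v) (∈-allFin w) (Adj-sym vw)) (Adj-sym vw) lt eq)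

  Inv-start : Inv 0 (λ v → start (id v) (src v))
  Inv-start = record { sound = snd ; own = own ; hears = λ _ _ _ _ _ () }
    where
    snd : ∀ v a → E v a ≤ start (id v) (src v) a
    snd v a with a ≡ᵇ id v in eq
    ... | false = E≤Hc v a
    ... | true with ≡ᵇ⇒≡ a (id v) (subst T (sym eq) _)
    ...   | refl = ⊓-glb (E-self v) (E≤Hc v a)
    own : ∀ v → start (id v) (src v) (id v) ≤ src v
    own v = ≤-trans (≤-reflexive (if-yes (≡ᵇ-refl (id v)))) (m⊓n≤m _ Hc)

  E-slots : IsSlots G id (Hc + Λ) (λ v → slot (E v))
  E-slots = record { slots-inj = inj ; node = λ v a lt → E-node v a (proj₁ (top-elim (E v) (isTop lt))) ; upward = up }
    where
    isTop : ∀ {v a} → slot (E v) a < Hc + Λ → T (top (E v) a)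
    isTop {v} {a} lt with top (E v) a
    ... | true  = _
    ... | false = <-irrefl refl lt
    slot≡ : ∀ {v a} → T (top (E v) a) → slot (E v) a ≡ E v a + rank (E v) a
    slot≡ t = if-yes t
    inj : ∀ v a b → slot (E v) a ≡ slot (E v) b → slot (E v) a < Hc + Λ → a ≡ b
    inj v a b eq lt = slot-inj (E v) (E<N (proj₁ (top-elim (E v) ta))) (E<N (proj₁ (top-elim (E v) tb)))
                        (trans (sym (slot≡ ta)) (trans eq (slot≡ tb)))
      where
      ta = isTop {v} {a} lt
      tb = isTop {v} {b} (subst (_< Hc + Λ) eq lt)
    up : ∀ v a → slot (E v) a < Hc + Λ → a ≡ id v ⊎ (∃ λ w → Adj G v w × slot (E w) a < slot (E v) a)
    up v a lt with top-elim (E v) {a} (isTop lt)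
    ... | p , q with E-descend v a p
    ...   | inj₁ (e , _)        = inj₁ e
    ...   | inj₂ (w , vw , eq)  = inj₂ (w , vw ,
      subst₂ _<_ (sym (slot≡ (top-intro (E w) (<-trans (≤-reflexive eq) p) (≤-<-trans (rank-descend vw eq) q))))
        (sym (slot≡ (isTop lt))) (+-mono-<-≤ (≤-reflexive eq) (rank-descend vw eq)))

  Spec-detect : Spec (Hc + Λ) (λ v → detect v (id v) (src v))
                  (λ y → (∀ v a → proj₁ (y v) a ≡ dist (E v) a) × (∀ v a → proj₂ (y v) a ≡ slot (E v) a))
  Spec-detect = Spec-map (λ _ K → dist K , slot K) (Spec-weaken (≤-reflexive (*-identityʳ _)) (λ _ φ → φ) (Spec-loop Inv (Hc + Λ) Inv-start body)) finish
    where
    body : ∀ r K → r < Hc + Λ → Inv r K → Spec 1 (λ v → round v r (K v)) (Inv (suc r))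
    body r K _ inv = Spec-map (λ v rc a → K v a ⊓ heard v r rc a (nbrs v))
      (Spec-exchange (λ u _ → message r K u) id-inj λ u _ _ →
        ≤-<-trans (packMaybe≤ (due r (K u)) λ a e → proj₁ (due-sound r (K u) e) , rank≤N (K u) a) fits)
      (λ rc got → Inv-step r K inv rc got)
    finish : ∀ K → Inv (Hc + Λ) K →
             (∀ v a → dist (K v) a ≡ dist (E v) a) × (∀ v a → slot (K v) a ≡ slot (E v) a)
    finish K inv = (λ v a → proj₁ (both v a)) , (λ v a → proj₂ (both v a))
      where
      open Inv inv
      both : ∀ v a → dist (K v) a ≡ dist (E v) a × slot (K v) a ≡ slot (E v) a
      both v a with T? (top (E v) a)
      ... | yes t = trans (if-yes tK) (trans Ka (sym (if-yes t))) ,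
                    trans (if-yes tK) (trans (cong₂ _+_ Ka (Ap.top-exact a<N t)) (sym (if-yes t)))
        where
        ex : ∀ b → b < N → T (top (E v) b) → K v b ≡ E v b
        ex b _ s = exact v b (proj₁ (top-elim (E v) s)) (<⇒≤ (+-mono-< (proj₁ (top-elim (E v) s)) (proj₂ (top-elim (E v) s))))
        module Ap = Approx (E v) (K v) (sound v) ex
        a<N = E<N (proj₁ (top-elim (E v) {a} t))
        Ka = ex a a<N t
        tK = Ap.top-L⇒K a<N t
      ... | no ¬t = trans (if-no ¬tK) (sym (if-no ¬t)) , trans (if-no ¬tK) (sym (if-no ¬t))
        where
        ex : ∀ b → b < N → T (top (E v) b) → K v b ≡ E v b
        ex b _ s = exact v b (proj₁ (top-elim (E v) s)) (<⇒≤ (+-mono-< (proj₁ (top-elim (E v) s)) (proj₂ (top-elim (E v) s))))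
        module Ap = Approx (E v) (K v) (sound v) ex
        ¬tK : ¬ T (top (K v) a)
        ¬tK t = ¬t (Ap.top-K⇒L (E<N (≤-<-trans (sound v a) (proj₁ (top-elim (K v) {a} t)))) t)

-- Communication between the nodes and the sources in their lists.  A node relays a source in the slot of
-- that source; summation uses the slots in reverse order.

module RelayProgram (bw N cap t : ℕ) (nbrs : List ℕ) (me : ℕ) (s : ℕ → ℕ) where

  inSlot : ℕ → Maybe ℕ
  inSlot r = findᵇ (λ a → s a ≡ᵇ r) (upTo N)

  parentIn : (ℕ → ℕ → ℕ) → ℕ → Maybe (ℕ × ℕ)
  parentIn h a = findᵇ (λ rw → isFor cap a (h (proj₁ rw) (proj₂ rw))) (cartesianProduct (upTo (s a)) nbrs)

  setup : Proc (ℕ → Maybe (ℕ × ℕ))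
  setup = loop t (λ r h → exchange bw (λ _ → packMaybe cap (const 0) (inSlot r)) >>= λ rc →
                          done (λ r′ → if r′ ≡ᵇ r then rc else h r′)) (λ _ _ → 0)
          >>= λ h → done (parentIn h)

  pick : (ℕ → ℕ) → ℕ → Maybe ℕ → ℕ
  pick rc old (just w) = payload cap (rc w)
  pick rc old nothing  = old

  hearValue : (ℕ → ℕ) → (ℕ → ℕ) → ℕ → ℕ
  hearValue rc view a = pick rc (view a) (findᵇ (λ w → isFor cap a (rc w)) nbrs)

  broadcast : ℕ → Proc (ℕ → ℕ)
  broadcast x = loop t (λ r view → exchange bw (λ _ → packMaybe cap view (inSlot r)) >>= λ rc →
                                   done (hearValue rc view)) (λ a → if a ≡ᵇ me then x else 0)

  parentIs : Maybe (ℕ × ℕ) → ℕ → ℕ → Bool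
  parentIs nothing         r b = false
  parentIs (just (r′ , w)) r b = (r′ ≡ᵇ r) ∧ (w ≡ᵇ b)

  reports : (ℕ → Maybe (ℕ × ℕ)) → ℕ → ℕ → ℕ → Bool
  reports p r b a = (s a <ᵇ t) ∧ (not (a ≡ᵇ me) ∧ parentIs (p a) r b)

  answer : (ℕ → ℕ) → Maybe ℕ → ℕ
  answer acc nothing  = 0
  answer acc (just a) = acc a

  report : (ℕ → Maybe (ℕ × ℕ)) → ℕ → (ℕ → ℕ) → ℕ → ℕ
  report p r acc b = answer acc (findᵇ (reports p r b) (upTo N))

  collect : ℕ → (ℕ → ℕ) → (ℕ → ℕ) → ℕ → ℕ
  collect r acc rc a = if s a ≡ᵇ r then acc a + ∑ nbrs rc else acc a

  aggregate : (ℕ → Maybe (ℕ × ℕ)) → (ℕ → ℕ) → Proc ℕ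
  aggregate p c = loop t (λ i acc → exchange bw (report p (t ∸ suc i) acc) >>= λ rc →
                                    done (collect (t ∸ suc i) acc rc)) (λ a → if s a <ᵇ t then c a else 0)
                  >>= λ acc → done (acc me)

IsSlots-cong : ∀ {n} {G : Graph n} {id t s s′} → (∀ v a → s′ v a ≡ s v a) → IsSlots G id t s → IsSlots G id t s′
IsSlots-cong {G = G} {id} {t} {s} {s′} e sl = record
  { slots-inj = λ v a b eq lt → slots-inj v a b (trans (sym (e v a)) (trans eq (e v b))) (subst (_< t) (e v a) lt)
  ; node      = λ v a lt → node v a (subst (_< t) (e v a) lt)
  ; upward    = up
  }
  where
  open IsSlots sl
  up : ∀ v a → s′ v a < t → a ≡ id v ⊎ (∃ λ w → Adj G v w × s′ w a < s′ v a)
  up v a lt with upward v a (subst (_< t) (e v a) lt)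
  ... | inj₁ eq            = inj₁ eq
  ... | inj₂ (w , vw , lt′) = inj₂ (w , vw , subst₂ _<_ (sym (e w a)) (sym (e v a)) lt′)

-- The parent of v in the tree of a, with the slot in which it relays a
IsParents : ∀ {n} → Graph n → (Fin n → ℕ) → ℕ → (Fin n → ℕ → ℕ) → (Fin n → ℕ → Maybe (ℕ × ℕ)) → Set
IsParents G id t s p = ∀ v a → s v a < t → a ≢ id v → ∃ λ w → p v a ≡ just (s w a , id w) × Adj G v w × s w a < s v a

module Relay {n : ℕ} (G : Graph n) (id : Fin n → ℕ) (id-inj : ∀ u v → id u ≡ id v → u ≡ v)
             (N : ℕ) (id<N : ∀ v → id v < N) (bw cap : ℕ) (fits : N * suc cap < 2 ^ bw)
             (t : ℕ) (s : Fin n → ℕ → ℕ) (slots : IsSlots G id t s) where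
  open Execution G id bw
  open Walks G
  open IsSlots slots

  private
    nbrs : Fin n → List ℕ
    nbrs v = map id (neighbours G v)

    nbr-adj : ∀ {v w} → w ∈ neighbours G v → Adj G w v
    nbr-adj {v} w∈ = proj₂ (∈-filter⁻ (T? ∘ λ u → adj G u v) {xs = allFin n} w∈)

    adj-nbr : ∀ {v w} → Adj G w v → w ∈ neighbours G v
    adj-nbr {v} {w} wv = ∈-filter⁺ (T? ∘ λ u → adj G u v) (∈-allFin w) wv

    open module Prog v = RelayProgram bw N cap t (nbrs v) (id v) (s v)
           using (inSlot; parentIn; hearValue; reports; report; collect)

    s<N : ∀ {v a} → s v a < t → a < N
    s<N {v} {a} lt with node v a lt
    ... | u , refl = id<N u

    inSlot-sound : ∀ {v r a} → inSlot v r ≡ just a → a < N × s v a ≡ r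
    inSlot-sound {v} {r} eq with findᵇ-sound (λ a → s v a ≡ᵇ r) (upTo N) eq
    ... | a∈ , e = ∈-upTo⁻ a∈ , ≡ᵇ⇒≡ _ _ e

    inSlot-complete : ∀ {v a} → s v a < t → inSlot v (s v a) ≡ just a
    inSlot-complete {v} {a} lt =
      findᵇ-unique _ (upTo N) (∈-upTo⁺ (s<N lt)) (≡ᵇ-refl (s v a))
        λ b _ e → slots-inj v b a (≡ᵇ⇒≡ _ _ e) (subst (_< t) (sym (≡ᵇ⇒≡ _ _ e)) lt)

  open module Prog′ v = RelayProgram bw N cap t (nbrs v) (id v) (s v) public using (setup; broadcast; aggregate)

  Spec-setup : Spec t setup (IsParents G id t s)
  Spec-setup = Spec-map parentIn (Spec-weaken (≤-reflexive (*-identityʳ t)) (λ _ φ → φ)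
                 (Spec-loop Recorded t (λ _ _ _ ()) body)) finish
    where
    msg : ℕ → Fin n → ℕ
    msg r u = packMaybe cap (const 0) (inSlot u r)

    Recorded : ℕ → (Fin n → ℕ → ℕ → ℕ) → Set
    Recorded i h = ∀ r u v → r < i → Adj G u v → h v r (id u) ≡ msg r u

    body : ∀ r h → r < t → Recorded r h → Spec 1 _ (Recorded (suc r))
    body r h _ rec = Spec-map (λ v rc r′ → if r′ ≡ᵇ r then rc else h v r′)
      (Spec-exchange (λ u _ → msg r u) id-inj
        (λ u _ _ → ≤-<-trans (packMaybe≤ (inSlot u r) λ a e → proj₁ (inSlot-sound e) , z≤n) fits)) step
      where
      step : (rc : Fin n → ℕ → ℕ) → (∀ u v → Adj G u v → rc v (id u) ≡ msg r u) → Recorded (suc r) (λ v r′ → if r′ ≡ᵇ r then rc v else h v r′)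
      step rc got r′ u v (s≤s r′≤) uv with r′ ≡ᵇ r in eq
      ... | true with ≡ᵇ⇒≡ r′ r (subst T (sym eq) _)
      ...   | refl = got u v uv
      step rc got r′ u v (s≤s r′≤) uv | false =
        rec r′ u v (≤∧≢⇒< r′≤ λ { refl → subst T eq (≡ᵇ-refl r) }) uv

    finish : ∀ h → Recorded t h → IsParents G id t s (λ v → parentIn v (h v))
    finish h rec v a lt a≢ with upward v a lt
    ... | inj₁ e = ⊥-elim (a≢ e)
    ... | inj₂ (w , vw , lt′)
      with findᵇ-complete (λ rw → isFor cap a (h v (proj₁ rw) (proj₂ rw))) (cartesianProduct (upTo (s v a)) (nbrs v))
             (∈-cartesianProduct⁺ (∈-upTo⁺ lt′) (∈-map⁺ id (adj-nbr (Adj-sym vw))))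
             (subst (λ m → T (isFor cap a m))
               (sym (trans (rec (s w a) w v (<-trans lt′ lt) (Adj-sym vw)) (cong (packMaybe cap (const 0)) (inSlot-complete (<-trans lt′ lt)))))
               (isFor-pack cap a z≤n))
    ...   | (r , b) , eq with findᵇ-sound (λ rw → isFor cap a (h v (proj₁ rw) (proj₂ rw))) (cartesianProduct (upTo (s v a)) (nbrs v)) eq
    ...     | rb∈ , isf with ∈-cartesianProduct⁻ (upTo (s v a)) (nbrs v) rb∈
    ...       | r∈ , b∈ with ∈-map⁻ id b∈
    ...         | x , x∈ , refl = x , trans eq (cong (λ z → just (z , id x)) (sym sx)) , Adj-sym (nbr-adj x∈) , subst (_< s v a) (sym sx) (∈-upTo⁻ r∈)
      where
      sx : s x a ≡ r
      sx = proj₂ (inSlot-sound (packMaybe-isFor (inSlot x r) (λ _ _ → z≤n)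
             (subst (λ m → T (isFor cap a m)) (rec r x v (<-trans (∈-upTo⁻ r∈) lt) (nbr-adj x∈)) isf)))

  Spec-broadcast : (x : Fin n → ℕ) → (∀ u → x u ≤ cap) →
                   Spec t (λ v → broadcast v (x v)) (λ view → ∀ v u → s v (id u) < t → view v (id u) ≡ x u)
  Spec-broadcast x x≤ = Spec-weaken (≤-reflexive (*-identityʳ t)) finish (Spec-loop Inv t start body)
    where
    Inv : ℕ → (Fin n → ℕ → ℕ) → Set
    Inv r view = ∀ v u → s v (id u) < t → v ≡ u ⊎ (∃ λ w → Adj G v w × s w (id u) < s v (id u) × s w (id u) < r) →
                 view v (id u) ≡ x u

    start : Inv 0 (λ v a → if a ≡ᵇ id v then x v else 0)
    start v u lt (inj₁ refl) = if-yes (≡ᵇ-refl (id v))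

    finish : ∀ view → Inv t view → ∀ v u → s v (id u) < t → view v (id u) ≡ x u
    finish view inv v u lt with upward v (id u) lt
    ... | inj₁ e             = inv v u lt (inj₁ (id-inj v u (sym e)))
    ... | inj₂ (w , vw , lt′) = inv v u lt (inj₂ (w , vw , lt′ , <-trans lt′ lt))

    body : ∀ r view → r < t → Inv r view → Spec 1 _ (Inv (suc r))
    body r view r<t inv = Spec-map (λ v rc → hearValue v rc (view v)) (Spec-exchange (λ u _ → msg u) id-inj bound) step
      where
      msg : Fin n → ℕ
      msg u = packMaybe cap (view u) (inSlot u r)

      -- A node that relays a source has already received its value.
      correct : ∀ w a → inSlot w r ≡ just a → ∃ λ u → a ≡ id u × view w a ≡ x u
      correct w a e with inSlot-sound {w} e
      ... | a<N , sw with node w a (subst (_< t) (sym sw) r<t)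
      ...   | u , refl with upward w (id u) (subst (_< t) (sym sw) r<t)
      ...     | inj₁ e′             = u , refl , inv w u (subst (_< t) (sym sw) r<t) (inj₁ (id-inj w u (sym e′)))
      ...     | inj₂ (y , wy , lt′) = u , refl , inv w u (subst (_< t) (sym sw) r<t) (inj₂ (y , wy , lt′ , subst (s y (id u) <_) sw lt′))

      view≤ : ∀ w a → inSlot w r ≡ just a → view w a ≤ cap
      view≤ w a e with correct w a e
      ... | u , _ , eq = ≤-trans (≤-reflexive eq) (x≤ u)

      bound : ∀ u v → Adj G u v → msg u < 2 ^ bw
      bound u _ _ = ≤-<-trans (packMaybe≤ (inSlot u r) λ a e → proj₁ (inSlot-sound {u} e) , view≤ u a e) fits

      step : (rc : Fin n → ℕ → ℕ) → (∀ u v → Adj G u v → rc v (id u) ≡ msg u) → Inv (suc r) (λ v → hearValue v (rc v) (view v))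
      step rc got v u lt alt with findᵇ (λ b → isFor cap (id u) (rc v b)) (nbrs v) in eq
      ... | just b with findᵇ-sound (λ b → isFor cap (id u) (rc v b)) (nbrs v) eq
      ...   | b∈ , isf with ∈-map⁻ id b∈
      ...     | w , w∈ , refl = trans (cong (payload cap) (trans (got w v (nbr-adj w∈)) (cong (packMaybe cap (view w)) isd)))
                                  (trans (payload-pack cap (id u) (view≤ w (id u) isd)) val)
        where
        isd : inSlot w r ≡ just (id u)
        isd = packMaybe-isFor (inSlot w r) (view≤ w) (subst (λ m → T (isFor cap (id u) m)) (got w v (nbr-adj w∈)) isf)
        val : view w (id u) ≡ x u
        val with correct w (id u) isd
        ... | u′ , e , q = trans q (cong x (id-inj u′ u (sym e)))
      step rc got v u lt (inj₁ e) | nothing = inv v u lt (inj₁ e)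
      step rc got v u lt (inj₂ (w , vw , lt′ , s≤s le)) | nothing with m≤n⇒m<n∨m≡n le
      ... | inj₁ lt″  = inv v u lt (inj₂ (w , vw , lt′ , lt″))
      ... | inj₂ refl = ⊥-elim (findᵇ-none (λ b → isFor cap (id u) (rc v b)) (nbrs v) eq (∈-map⁺ id (adj-nbr (Adj-sym vw)))
                          (subst (λ m → T (isFor cap (id u) m))
                            (sym (trans (got w v (Adj-sym vw)) (cong (packMaybe cap (view w)) isd)))
                            (isFor-pack cap (id u) (view≤ w (id u) isd))))
        where
        isd : inSlot w (s w (id u)) ≡ just (id u)
        isd = inSlot-complete (<-trans lt′ lt)

  module _ (p : Fin n → ℕ → Maybe (ℕ × ℕ)) (parents : IsParents G id t s p) (c : Fin n → ℕ → ℕ) where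

    total : ℕ → ℕ
    total a = ∑ (allFin n) λ v → 𝟙 (s v a <ᵇ t) * c v a

    private
      before : Maybe (ℕ × ℕ) → ℕ → Bool
      before nothing        ρ = false
      before (just (r , _)) ρ = r <ᵇ ρ

      now : Maybe (ℕ × ℕ) → ℕ → Bool
      now nothing        ρ = false
      now (just (r , _)) ρ = r ≡ᵇ ρ

      live : ℕ → Fin n → ℕ → Bool
      live ρ v a = (s v a <ᵇ t) ∧ (if a ≡ᵇ id v then true else before (p v a) ρ)

      dies : ℕ → Fin n → ℕ → Bool
      dies r v a = (s v a <ᵇ t) ∧ (if a ≡ᵇ id v then false else now (p v a) r)

      record Inv (ρ : ℕ) (acc : Fin n → ℕ → ℕ) : Set where
        field
          conserved : ∀ a → ∑ (allFin n) (λ v → 𝟙 (live ρ v a) * acc v a) ≡ total a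
          masked    : ∀ v a → ¬ (s v a < t) → acc v a ≡ 0

      live-split : ∀ r v a → 𝟙 (live (suc r) v a) ≡ 𝟙 (live r v a) + 𝟙 (dies r v a)
      live-split r v a with s v a <ᵇ t
      ... | false = refl
      ... | true with a ≡ᵇ id v
      ...   | true = refl
      ...   | false with p v a
      ...     | nothing = refl
      ...     | just (q , _) = split q
        where
        split : ∀ q → 𝟙 (q <ᵇ suc r) ≡ 𝟙 (q <ᵇ r) + 𝟙 (q ≡ᵇ r)
        split q with <-cmp q r
        ... | tri< l n _ = trans (if-yes (<⇒<ᵇ (m<n⇒m<1+n l))) (sym (cong₂ _+_ (if-yes (<⇒<ᵇ l)) (if-no (n ∘ ≡ᵇ⇒≡ q r))))
        ... | tri≈ n e _ = trans (if-yes (<⇒<ᵇ (s≤s (≤-reflexive e)))) (sym (cong₂ _+_ (if-no (n ∘ <ᵇ⇒< q r)) (if-yes (≡⇒≡ᵇ q r e))))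
        ... | tri> n m g = trans (if-no (<⇒≱ g ∘ ≤-pred ∘ <ᵇ⇒< q (suc r))) (sym (cong₂ _+_ (if-no (n ∘ <ᵇ⇒< q r)) (if-no (m ∘ ≡ᵇ⇒≡ q r))))

      live-slot : ∀ r w a → s w a ≡ r → s w a < t → T (live r w a)
      live-slot r w a refl lt with a ≡ᵇ id w in eq
      ... | true  = ∧-intro (<⇒<ᵇ lt) _
      ... | false with parents w a lt (λ e → subst T eq (≡⇒≡ᵇ _ _ e))
      ...   | x , e , _ , lt′ = ∧-intro (<⇒<ᵇ lt) (subst (λ m → T (before m (s w a))) (sym e) (<⇒<ᵇ lt′))

      reports-elim : ∀ {v r b a} → T (reports v (p v) r b a) →
                     s v a < t × a ≢ id v × (∃ λ w → id w ≡ b × s w a ≡ r × Adj G v w × p v a ≡ just (s w a , id w))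
      reports-elim {v} {r} {b} {a} t₁ with ∧-elim {s v a <ᵇ t} t₁
      ... | l , t₂ with ∧-elim {not (a ≡ᵇ id v)} t₂
      ...   | ne , t₃ with parents v a (<ᵇ⇒< _ _ l) (λ e → not-elim ne (≡⇒≡ᵇ _ _ e))
      ...     | w , e , vw , _ with ∧-elim {s w a ≡ᵇ r} (subst (λ m → T (RelayProgram.parentIs bw N cap t [] 0 (λ _ → 0) m r b)) e t₃)
      ...       | q₁ , q₂ = <ᵇ⇒< _ _ l , (λ e′ → not-elim ne (≡⇒≡ᵇ _ _ e′)) , w , ≡ᵇ⇒≡ _ _ q₂ , ≡ᵇ⇒≡ _ _ q₁ , vw , e

      report≡ : ∀ (acc : Fin n → ℕ → ℕ) r v w a → s w a ≡ r → s w a < t →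
                report v (p v) r (acc v) (id w) ≡ 𝟙 (reports v (p v) r (id w) a) * acc v a
      report≡ acc r v w a sw lt with T? (reports v (p v) r (id w) a)
      ... | yes y = trans (cong (RelayProgram.answer bw N cap t [] 0 (λ _ → 0) (acc v))
                      (findᵇ-unique (reports v (p v) r (id w)) (upTo N) (∈-upTo⁺ (s<N lt)) y λ b _ z → same b z))
                      (sym (trans (cong (_* acc v a) (if-yes y)) (*-identityˡ _)))
        where
        same : ∀ b → T (reports v (p v) r (id w) b) → b ≡ a
        same b z with reports-elim {v} z
        ... | _ , _ , x , ix , sx , _ with id-inj x w ix
        ...   | refl = slots-inj w b a (trans sx (sym sw)) (subst (_< t) (sym (trans sx (sym sw))) lt)
      ... | no ¬y with findᵇ (reports v (p v) r (id w)) (upTo N) in eq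
      ...   | nothing = sym (cong (_* acc v a) (if-no ¬y))
      ...   | just b with reports-elim {v} (proj₂ (findᵇ-sound _ (upTo N) eq))
      ...     | _ , _ , x , ix , sx , _ with id-inj x w ix
      ...       | refl = ⊥-elim (¬y (subst (λ z → T (reports v (p v) r (id w) z))
                           (slots-inj w b a (trans sx (sym sw)) (subst (_< t) (sym (trans sx (sym sw))) lt))
                           (proj₂ (findᵇ-sound _ (upTo N) eq))))

      dies-elim : ∀ r v a → T (dies r v a) → s v a < t × a ≢ id v × T (now (p v a) r)
      dies-elim r v a d with ∧-elim {s v a <ᵇ t} d
      ... | l , d₂ with a ≡ᵇ id v in eq
      ...   | false = <ᵇ⇒< _ _ l , (λ e → subst T eq (≡⇒≡ᵇ _ _ e)) , d₂

      kill : ∀ x y z {b} → ¬ T b → x * (y * (z * 𝟙 b)) ≡ 0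
      kill x y z ¬b rewrite if-no {x = 1} {y = 0} ¬b | *-zeroʳ z | *-zeroʳ y = *-zeroʳ x

      -- Every dying contribution reaches exactly one live node.
      one-parent : ∀ r v a → r < t →
        ∑ (allFin n) (λ w → 𝟙 (live r w a) * (𝟙 (s w a ≡ᵇ r) * (𝟙 (adj G v w) * 𝟙 (reports v (p v) r (id w) a)))) ≡ 𝟙 (dies r v a)
      one-parent r v a r<t with T? (dies r v a)
      ... | no ¬d = trans (∑-zero∈ (allFin n) λ w _ → zero₃ w) (sym (if-no ¬d))
        where
        notrep : ∀ w → ¬ T (reports v (p v) r (id w) a)
        notrep w y with reports-elim {v} y
        ... | l , ne , x , _ , sx , _ , e = ¬d (∧-intro (<⇒<ᵇ l) (subst T (sym (trans (if-no {b = a ≡ᵇ id v} (ne ∘ ≡ᵇ⇒≡ _ _)) (cong (λ m → now m r) e))) (≡⇒≡ᵇ _ _ sx)))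
        zero₃ : ∀ w → 𝟙 (live r w a) * (𝟙 (s w a ≡ᵇ r) * (𝟙 (adj G v w) * 𝟙 (reports v (p v) r (id w) a))) ≡ 0
        zero₃ w = kill (𝟙 (live r w a)) (𝟙 (s w a ≡ᵇ r)) (𝟙 (adj G v w)) (notrep w)
      ... | yes d with dies-elim r v a d
      ...   | l , ne , d₂ with parents v a l ne
      ...     | w₀ , e , vw , lt′ = trans (∑-allFin-single w₀ _ other) (trans here₁ (sym (if-yes d)))
        where
        sw : s w₀ a ≡ r
        sw = ≡ᵇ⇒≡ _ _ (subst (λ m → T (now m r)) e d₂)
        other : ∀ w → w ≢ w₀ → 𝟙 (live r w a) * (𝟙 (s w a ≡ᵇ r) * (𝟙 (adj G v w) * 𝟙 (reports v (p v) r (id w) a))) ≡ 0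
        other w w≢ = kill (𝟙 (live r w a)) (𝟙 (s w a ≡ᵇ r)) (𝟙 (adj G v w)) notrep
          where
          notrep : ¬ T (reports v (p v) r (id w) a)
          notrep y with reports-elim {v} y
          ... | _ , _ , x , ix , _ , _ , e′ with id-inj x w ix
          ...   | refl = w≢ (id-inj w w₀ (cong proj₂ (just-injective (trans (sym e′) e))))
        here₁ : 𝟙 (live r w₀ a) * (𝟙 (s w₀ a ≡ᵇ r) * (𝟙 (adj G v w₀) * 𝟙 (reports v (p v) r (id w₀) a))) ≡ 1
        here₁ = cong₂ _*_ (if-yes (live-slot r w₀ a sw (subst (_< t) (sym sw) r<t)))
                  (cong₂ _*_ (if-yes (≡⇒≡ᵇ _ _ sw)) (cong₂ _*_ (if-yes vw) (if-yes
                    (∧-intro (<⇒<ᵇ l) (∧-intro (not-intro (ne ∘ ≡ᵇ⇒≡ _ _))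
                      (subst (λ m → T (RelayProgram.parentIs bw N cap t [] 0 (λ _ → 0) m r (id w₀))) (sym e) (∧-intro (≡⇒≡ᵇ _ _ sw) (≡ᵇ-refl (id w₀)))))))))

      step : ∀ r acc → r < t → Inv (suc r) acc → (rc : Fin n → ℕ → ℕ) →
             (∀ u v → Adj G u v → rc v (id u) ≡ report u (p u) r (acc u) (id v)) →
             Inv r (λ v → collect v r (acc v) (rc v))
      step r acc r<t inv rc got = record { conserved = cons ; masked = mask }
        where
        open Inv inv
        mask : ∀ v a → ¬ (s v a < t) → collect v r (acc v) (rc v) a ≡ 0
        mask v a ge = trans (if-no λ e → ge (subst (_< t) (sym (≡ᵇ⇒≡ _ _ e)) r<t)) (masked v a ge)

        gain : ∀ w a → collect w r (acc w) (rc w) a ≡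
               acc w a + ∑ (allFin n) (λ v → 𝟙 (s w a ≡ᵇ r) * (𝟙 (adj G v w) * (𝟙 (reports v (p v) r (id w) a) * acc v a)))
        gain w a with s w a ≡ᵇ r in eq
        ... | false = sym (trans (cong (acc w a +_) (∑-0 (allFin n))) (+-identityʳ _))
        ... | true  = cong (acc w a +_) (begin
          ∑ (nbrs w) (rc w)                          ≡⟨ ∑-map id (neighbours G w) (rc w) ⟩
          ∑ (neighbours G w) (rc w ∘ id)             ≡⟨ ∑-cong∈ (neighbours G w) (λ v v∈ → trans (got v w (nbr-adj v∈)) (report≡ acc r v w a sw (subst (_< t) (sym sw) r<t))) ⟩
          ∑ (neighbours G w) (λ v → 𝟙 (reports v (p v) r (id w) a) * acc v a)
                                                     ≡⟨ ∑-filter (λ v → adj G v w) (allFin n) _ ⟩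
          ∑ (allFin n) (λ v → 𝟙 (adj G v w) * (𝟙 (reports v (p v) r (id w) a) * acc v a))
                                                     ≡⟨ ∑-cong (allFin n) (λ v → sym (*-identityˡ _)) ⟩
          ∑ (allFin n) (λ v → 1 * (𝟙 (adj G v w) * (𝟙 (reports v (p v) r (id w) a) * acc v a))) ∎)
          where
          open ≡-Reasoning
          sw : s w a ≡ r
          sw = ≡ᵇ⇒≡ _ _ (subst T (sym eq) _)

        cons : ∀ a → ∑ (allFin n) (λ w → 𝟙 (live r w a) * collect w r (acc w) (rc w) a) ≡ total a
        cons a = begin
          ∑ (allFin n) (λ w → 𝟙 (live r w a) * collect w r (acc w) (rc w) a)
            ≡⟨ ∑-cong (allFin n) (λ w → trans (cong (𝟙 (live r w a) *_) (gain w a)) (trans (*-distribˡ-+ (𝟙 (live r w a)) _ _) (cong (𝟙 (live r w a) * acc w a +_) (sym (∑-*ˡ (allFin n) (𝟙 (live r w a)) _))))) ⟩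
          ∑ (allFin n) (λ w → 𝟙 (live r w a) * acc w a + ∑ (allFin n) (λ v → 𝟙 (live r w a) * (𝟙 (s w a ≡ᵇ r) * (𝟙 (adj G v w) * (𝟙 (reports v (p v) r (id w) a) * acc v a)))))
            ≡⟨ ∑-+ (allFin n) _ _ ⟩
          ∑ (allFin n) (λ w → 𝟙 (live r w a) * acc w a) + ∑ (allFin n) (λ w → ∑ (allFin n) (λ v → 𝟙 (live r w a) * (𝟙 (s w a ≡ᵇ r) * (𝟙 (adj G v w) * (𝟙 (reports v (p v) r (id w) a) * acc v a)))))
            ≡⟨ cong (∑ (allFin n) (λ w → 𝟙 (live r w a) * acc w a) +_) (trans (∑-swap (allFin n) (allFin n) _) (∑-cong (allFin n) inner)) ⟩
          ∑ (allFin n) (λ v → 𝟙 (live r v a) * acc v a) + ∑ (allFin n) (λ v → 𝟙 (dies r v a) * acc v a)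
            ≡⟨ sym (∑-+ (allFin n) _ _) ⟩
          ∑ (allFin n) (λ v → 𝟙 (live r v a) * acc v a + 𝟙 (dies r v a) * acc v a)
            ≡⟨ ∑-cong (allFin n) (λ v → trans (sym (*-distribʳ-+ (acc v a) (𝟙 (live r v a)) _)) (cong (_* acc v a) (sym (live-split r v a)))) ⟩
          ∑ (allFin n) (λ v → 𝟙 (live (suc r) v a) * acc v a)
            ≡⟨ conserved a ⟩
          total a ∎
          where
          open ≡-Reasoning
          assoc₄ : ∀ a b c d e → a * (b * (c * (d * e))) ≡ (a * (b * (c * d))) * e
          assoc₄ = solve-∀
          inner : ∀ v → ∑ (allFin n) (λ w → 𝟙 (live r w a) * (𝟙 (s w a ≡ᵇ r) * (𝟙 (adj G v w) * (𝟙 (reports v (p v) r (id w) a) * acc v a)))) ≡ 𝟙 (dies r v a) * acc v a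
          inner v = trans (∑-cong (allFin n) (λ w → assoc₄ (𝟙 (live r w a)) (𝟙 (s w a ≡ᵇ r)) (𝟙 (adj G v w)) (𝟙 (reports v (p v) r (id w) a)) (acc v a)))
                      (trans (∑-*ʳ (allFin n) (acc v a) _) (cong (_* acc v a) (one-parent r v a r<t)))

      report-bound : ∀ r acc → Inv (suc r) acc → (∀ a → total a < 2 ^ bw) → ∀ v w → report v (p v) r (acc v) (id w) < 2 ^ bw
      report-bound r acc inv tot v w with findᵇ (reports v (p v) r (id w)) (upTo N) in eq
      ... | nothing = m^n>0 2 bw
      ... | just a with reports-elim {v} (proj₂ (findᵇ-sound (reports v (p v) r (id w)) (upTo N) eq))
      ...   | l , ne , x , _ , sx , _ , e = ≤-<-trans le (tot a)
        where
        open Inv inv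
        lv : T (live (suc r) v a)
        lv = ∧-intro (<⇒<ᵇ l) (subst T (sym (trans (if-no {b = a ≡ᵇ id v} (ne ∘ ≡ᵇ⇒≡ _ _)) (cong (λ m → before m (suc r)) e))) (<⇒<ᵇ (s≤s (≤-reflexive sx))))
        le : acc v a ≤ total a
        le = ≤-trans (≤-reflexive (sym (trans (cong (_* acc v a) (if-yes lv)) (*-identityˡ _))))
               (≤-trans (term≤∑ (allFin n) {λ v → 𝟙 (live (suc r) v a) * acc v a} (∈-allFin v)) (≤-reflexive (conserved a)))

    Spec-aggregate : (∀ a → total a < 2 ^ bw) →
                     Spec t (λ v → aggregate v (p v) (c v)) (λ y → ∀ u → y u ≡ total (id u))
    Spec-aggregate tot = Spec-map (λ v acc → acc (id v)) (Spec-weaken (≤-reflexive (*-identityʳ t)) (λ _ φ → φ)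
                           (Spec-loop (λ i → Inv (t ∸ i)) t start body)) finish
      where
      start : Inv t (λ v a → if s v a <ᵇ t then c v a else 0)
      start = record { conserved = λ a → ∑-cong (allFin n) (term a) ; masked = λ v a ge → if-no (ge ∘ <ᵇ⇒< _ _) }
        where
        term : ∀ a v → 𝟙 (live t v a) * (if s v a <ᵇ t then c v a else 0) ≡ 𝟙 (s v a <ᵇ t) * c v a
        term a v with s v a <? t
        ... | no ge  rewrite if-no {b = s v a <ᵇ t} {x = c v a} {y = 0} (ge ∘ <ᵇ⇒< _ _) | if-no {b = s v a <ᵇ t} {x = 1} {y = 0} (ge ∘ <ᵇ⇒< _ _) = *-zeroʳ (𝟙 (live t v a))
        ... | yes lt = cong₂ _*_ (trans (if-yes lv) (sym (if-yes (<⇒<ᵇ lt)))) (if-yes (<⇒<ᵇ lt))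
          where
          lv : T (live t v a)
          lv with a ≡ᵇ id v in eq
          ... | true  = ∧-intro (<⇒<ᵇ lt) _
          ... | false with parents v a lt (λ e → subst T eq (≡⇒≡ᵇ _ _ e))
          ...   | w , e , _ , lt′ = ∧-intro (<⇒<ᵇ lt) (subst (λ m → T (before m t)) (sym e) (<⇒<ᵇ (<-trans lt′ lt)))

      body : ∀ i acc → i < t → Inv (t ∸ i) acc → Spec 1 _ (Inv (t ∸ suc i))
      body i acc i<t inv = Spec-map (λ v rc → collect v (t ∸ suc i) (acc v) rc)
        (Spec-exchange (λ u → report u (p u) (t ∸ suc i) (acc u)) id-inj λ u v _ → report-bound (t ∸ suc i) acc inv′ tot u v)
        (λ rc got → step (t ∸ suc i) acc (∸-monoʳ-< (s≤s z≤n) i<t) inv′ rc got)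
        where
        inv′ : Inv (suc (t ∸ suc i)) acc
        inv′ = subst (λ ρ → Inv ρ acc) (+-∸-assoc 1 i<t) inv

      finish : ∀ acc → Inv (t ∸ t) acc → ∀ u → acc u (id u) ≡ total (id u)
      finish acc inv u = sym (begin
        total (id u)                                                ≡⟨ sym (conserved (id u)) ⟩
        ∑ (allFin n) (λ v → 𝟙 (live (t ∸ t) v (id u)) * acc v (id u)) ≡⟨ ∑-allFin-single u _ other ⟩
        𝟙 (live (t ∸ t) u (id u)) * acc u (id u)                    ≡⟨ self ⟩
        acc u (id u)                                                ∎)
        where
        open ≡-Reasoning
        open Inv inv
        noBefore : ∀ m → ¬ T (before m (t ∸ t))
        noBefore (just (r , _)) x = <⇒≱ (<ᵇ⇒< r _ x) (subst (_≤ r) (sym (n∸n≡0 t)) z≤n)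
        other : ∀ v → v ≢ u → 𝟙 (live (t ∸ t) v (id u)) * acc v (id u) ≡ 0
        other v v≢ = cong (_* acc v (id u)) (if-no {b = live (t ∸ t) v (id u)} λ l →
          noBefore (p v (id u)) (subst T (if-no {b = id u ≡ᵇ id v} (λ e → v≢ (id-inj v u (sym (≡ᵇ⇒≡ _ _ e))))) (proj₂ (∧-elim {s v (id u) <ᵇ t} l))))
        self : 𝟙 (live (t ∸ t) u (id u)) * acc u (id u) ≡ acc u (id u)
        self with s u (id u) <? t
        ... | no ge  rewrite masked u (id u) ge = *-zeroʳ (𝟙 (live (t ∸ t) u (id u)))
        ... | yes lt = trans (cong (_* acc u (id u)) (if-yes (∧-intro (<⇒<ᵇ lt) (subst T (sym (if-yes (≡ᵇ-refl (id u)))) _)))) (*-identityˡ _)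

-- Rounding a quadratic form: a sequential choice along the classes of a colouring with few monochromatic pairs

pair-inj : ∀ X {x x′} p p′ → x < X → x′ < X → x + p * X ≡ x′ + p′ * X → x ≡ x′ × p ≡ p′
pair-inj X@(suc _) {x} {x′} p p′ x< x′< eq = x≡ , *-cancelʳ-≡ p p′ X (+-cancelˡ-≡ x _ _ (trans eq (cong (_+ p′ * X) (sym x≡))))
  where
  x≡ : x ≡ x′
  x≡ = begin
    x                  ≡⟨ sym (m<n⇒m%n≡m x<) ⟩
    x % X              ≡⟨ sym ([m+kn]%n≡m%n x p X) ⟩
    (x + p * X) % X    ≡⟨ cong (_% X) eq ⟩
    (x′ + p′ * X) % X  ≡⟨ [m+kn]%n≡m%n x′ p′ X ⟩
    x′ % X             ≡⟨ m<n⇒m%n≡m x′< ⟩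
    x′                 ∎
    where open ≡-Reasoning

low high : ℕ → ℕ → ℕ
low  h c = _%_ c (2 ^ h) {{m^n≢0 2 h}}
high h c = _/_ c (2 ^ h) {{m^n≢0 2 h}}

line : ℕ → ℕ → ℕ → ℕ
line h c x = low h c + high h c * x

clash : ℕ → ℕ → ℕ → ℕ → Bool
clash h x c d = not (c ≡ᵇ d) ∧ (line h c x ≡ᵇ line h d x)

low-high : ∀ h {c d} → low h c ≡ low h d → high h c ≡ high h d → c ≡ d
low-high h {c} {d} e f = trans (split c) (trans (cong₂ (λ x y → x + y * 2 ^ h) e f) (sym (split d)))
  where
  split : ∀ c → c ≡ low h c + high h c * 2 ^ h
  split c = m≡m%n+[m/n]*n c (2 ^ h) {{m^n≢0 2 h}}

private
  steeper : ∀ a₀ a₁ b₀ b₁ x x′ → a₁ < b₁ → a₀ + a₁ * x ≡ b₀ + b₁ * x → a₀ + a₁ * x′ ≡ b₀ + b₁ * x′ → x ≡ x′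
  steeper a₀ a₁ b₀ b₁ x x′ lt e e′ with m≤n⇒∃[o]m+o≡n lt
  ... | d , refl = *-cancelˡ-≡ x x′ (suc d) (+-cancelˡ-≡ b₀ _ _ (trans (sym (drop x e)) (drop x′ e′)))
    where
    drop : ∀ x → a₀ + a₁ * x ≡ b₀ + (suc a₁ + d) * x → a₀ ≡ b₀ + suc d * x
    drop x e = +-cancelʳ-≡ (a₁ * x) a₀ (b₀ + suc d * x) (trans e (eqn b₀ a₁ d x))
      where
      eqn : ∀ b a d x → b + (suc a + d) * x ≡ b + suc d * x + a * x
      eqn = solve-∀

lines-meet : ∀ a₀ a₁ b₀ b₁ x x′ → a₀ + a₁ * x ≡ b₀ + b₁ * x → a₀ + a₁ * x′ ≡ b₀ + b₁ * x′ → x ≢ x′ → a₀ ≡ b₀ × a₁ ≡ b₁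
lines-meet a₀ a₁ b₀ b₁ x x′ e e′ x≢ with <-cmp a₁ b₁
... | tri≈ _ refl _ = +-cancelʳ-≡ (a₁ * x) a₀ b₀ e , refl
... | tri< lt _ _   = ⊥-elim (x≢ (steeper a₀ a₁ b₀ b₁ x x′ lt e e′))
... | tri> _ _ gt   = ⊥-elim (x≢ (steeper b₀ b₁ a₀ a₁ x x′ gt (sym e) (sym e′)))

module Quadratic (N : ℕ) (Q : ℕ → ℕ → ℕ) where

  I : List ℕ
  I = upTo N

  form : (ℕ → ℕ) → (ℕ → ℕ) → ℕ
  form f g = ∑ I λ a → ∑ I λ b → Q a b * (f a * g b)

  grad : (ℕ → ℕ) → ℕ → ℕ
  grad y a = ∑ I λ b → Q a b * y b

  form-cong : ∀ {f f′ g g′} → (∀ a → f a ≡ f′ a) → (∀ a → g a ≡ g′ a) → form f g ≡ form f′ g′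
  form-cong e e′ = ∑-cong I λ a → ∑-cong I λ b → cong₂ (λ x y → Q a b * (x * y)) (e a) (e′ b)

  form-mono : ∀ {f f′ g g′} → (∀ a → f a ≤ f′ a) → (∀ a → g a ≤ g′ a) → form f g ≤ form f′ g′
  form-mono e e′ = ∑-mono I λ a → ∑-mono I λ b → *-monoʳ-≤ (Q a b) (*-mono-≤ (e a) (e′ b))

  form-+ˡ : ∀ f f′ g → form (λ a → f a + f′ a) g ≡ form f g + form f′ g
  form-+ˡ f f′ g = trans (∑-cong I λ a → trans (∑-cong I λ b → dist (Q a b) (f a) (f′ a) (g b)) (∑-+ I _ _)) (∑-+ I _ _)
    where
    dist : ∀ q x y z → q * ((x + y) * z) ≡ q * (x * z) + q * (y * z)
    dist = solve-∀

  form-grad : ∀ f y → form f y ≡ ∑ I (λ a → f a * grad y a)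
  form-grad f y = ∑-cong I λ a → trans (∑-cong I λ b → swap (Q a b) (f a) (y b)) (∑-*ˡ I (f a) _)
    where
    swap : ∀ q x y → q * (x * y) ≡ x * (q * y)
    swap = solve-∀

  form-scale : ∀ c f → form (λ a → c * f a) (λ a → c * f a) ≡ c * c * form f f
  form-scale c f = trans (∑-cong I λ a → trans (∑-cong I λ b → eqn c (Q a b) (f a) (f b)) (∑-*ˡ I (c * c) _)) (∑-*ˡ I (c * c) _)
    where
    eqn : ∀ c q x y → q * (c * x * (c * y)) ≡ c * c * (q * (x * y))
    eqn = solve-∀

  mono : (ℕ → ℕ) → (ℕ → ℕ) → ℕ
  mono F col = ∑ I λ a → ∑ I λ b → Q a b * ((F a * F b) * 𝟙 (col a ≡ᵇ col b))

  module Recolour (h X′ : ℕ) (F col : ℕ → ℕ) where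
    X = suc X′

    conflicts : ℕ → ℕ → ℕ
    conflicts a x = ∑ I λ b → Q a b * (F b * 𝟙 (clash h x (col a) (col b)))

    point : ℕ → ℕ
    point a = argmin (conflicts a) X

    recolour : ℕ → ℕ
    recolour a = point a + line h (col a) (point a) * X

    private
      clash-once : ∀ c d → ∑ (upTo X) (λ x → 𝟙 (clash h x c d)) ≤ 1
      clash-once c d = count≤1 X (λ x → clash h x c d) uniq
        where
        uniq : ∀ x x′ → x < X → x′ < X → T (clash h x c d) → T (clash h x′ c d) → x ≡ x′
        uniq x x′ _ _ t t′ with x ≟ x′
        ... | yes e = e
        ... | no ne with ∧-elim {not (c ≡ᵇ d)} t | ∧-elim {not (c ≡ᵇ d)} t′
        ...   | c≢d , e | _ , e′ =
          ⊥-elim (not-elim c≢d (≡⇒≡ᵇ c d (low-high h (proj₁ same) (proj₂ same))))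
          where
          same = lines-meet (low h c) (high h c) (low h d) (high h d) x x′ (≡ᵇ⇒≡ _ _ e) (≡ᵇ⇒≡ _ _ e′) ne

      conflicts-sum : ∀ a → ∑ (upTo X) (conflicts a) ≤ ∑ I (λ b → Q a b * F b)
      conflicts-sum a = begin
        ∑ (upTo X) (λ x → ∑ I λ b → Q a b * (F b * 𝟙 (clash h x (col a) (col b))))
          ≡⟨ ∑-swap (upTo X) I _ ⟩
        ∑ I (λ b → ∑ (upTo X) λ x → Q a b * (F b * 𝟙 (clash h x (col a) (col b))))
          ≡⟨ ∑-cong I (λ b → trans (∑-*ˡ (upTo X) (Q a b) _) (cong (Q a b *_) (∑-*ˡ (upTo X) (F b) _))) ⟩
        ∑ I (λ b → Q a b * (F b * ∑ (upTo X) λ x → 𝟙 (clash h x (col a) (col b))))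
          ≤⟨ ∑-mono I (λ b → *-monoʳ-≤ (Q a b) (*-monoʳ-≤ (F b) (clash-once (col a) (col b)))) ⟩
        ∑ I (λ b → Q a b * (F b * 1))
          ≡⟨ ∑-cong I (λ b → cong (Q a b *_) (*-identityʳ (F b))) ⟩
        ∑ I (λ b → Q a b * F b) ∎
        where open ≤-Reasoning

      same-colour : ∀ a b → 𝟙 (recolour a ≡ᵇ recolour b) ≤ 𝟙 (col a ≡ᵇ col b) + 𝟙 (clash h (point a) (col a) (col b))
      same-colour a b with T? (recolour a ≡ᵇ recolour b)
      ... | no ne = ≤-trans (≤-reflexive (if-no ne)) z≤n
      ... | yes e with T? (col a ≡ᵇ col b)
      ...   | yes c = ≤-trans (𝟙≤1 _) (≤-trans (≤-reflexive (sym (if-yes c))) (m≤m+n _ _))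
      ...   | no c  = ≤-trans (𝟙≤1 _) (≤-trans (≤-reflexive (sym (if-yes cl))) (m≤n+m _ (𝟙 (col a ≡ᵇ col b))))
        where
        eqs = pair-inj X {point a} {point b} (line h (col a) (point a)) (line h (col b) (point b))
                (argmin< (conflicts a) X′) (argmin< (conflicts b) X′) (≡ᵇ⇒≡ (recolour a) (recolour b) e)
        cl : T (clash h (point a) (col a) (col b))
        cl = ∧-intro (not-intro c) (≡⇒≡ᵇ _ _ (trans (proj₂ eqs) (cong (line h (col b)) (sym (proj₁ eqs)))))

    recolour-mono : X * mono F recolour ≤ X * mono F col + form F F
    recolour-mono = begin
      X * mono F recolour
        ≤⟨ *-monoʳ-≤ X (∑-mono I λ a → ∑-mono I λ b → *-monoʳ-≤ (Q a b) (*-monoʳ-≤ (F a * F b) (same-colour a b))) ⟩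
      X * ∑ I (λ a → ∑ I λ b → Q a b * ((F a * F b) * (𝟙 (col a ≡ᵇ col b) + 𝟙 (clash h (point a) (col a) (col b)))))
        ≡⟨ cong (X *_) (trans (∑-cong I λ a → trans (∑-cong I λ b → dist (Q a b) (F a) (F b) (𝟙 (col a ≡ᵇ col b)) (𝟙 (clash h (point a) (col a) (col b)))) (trans (∑-+ I _ _) (cong (∑ I (λ b → Q a b * ((F a * F b) * 𝟙 (col a ≡ᵇ col b))) +_) (∑-*ˡ I (F a) _)))) (∑-+ I _ _)) ⟩
      X * (mono F col + ∑ I (λ a → F a * conflicts a (point a)))
        ≡⟨ trans (*-distribˡ-+ X (mono F col) _) (cong (X * mono F col +_) (trans (sym (∑-*ˡ I X _)) (∑-cong I λ a → comm₃ X (F a) (conflicts a (point a))))) ⟩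
      X * mono F col + ∑ I (λ a → F a * (X * conflicts a (point a)))
        ≤⟨ +-monoʳ-≤ (X * mono F col) (∑-mono I λ a → *-monoʳ-≤ (F a) (≤-trans (argmin-average (conflicts a) X) (conflicts-sum a))) ⟩
      X * mono F col + ∑ I (λ a → F a * grad F a)
        ≡⟨ cong (X * mono F col +_) (sym (form-grad F F)) ⟩
      X * mono F col + form F F ∎
      where
      open ≤-Reasoning
      dist : ∀ q x y u v → q * ((x * y) * (u + v)) ≡ q * ((x * y) * u) + x * (q * (y * v))
      dist = solve-∀
      comm₃ : ∀ x y z → x * (y * z) ≡ y * (x * z)
      comm₃ = solve-∀

    recolour< : ∀ a → col a < 2 ^ h * 2 ^ h → recolour a < 2 ^ h * (X * X)
    recolour< a c< = begin-strict
      point a + line h (col a) (point a) * X     <⟨ +-monoˡ-< (line h (col a) (point a) * X) (argmin< (conflicts a) X′) ⟩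
      suc (line h (col a) (point a)) * X         ≤⟨ *-monoˡ-≤ X line< ⟩
      2 ^ h * X * X                              ≡⟨ *-assoc (2 ^ h) X X ⟩
      2 ^ h * (X * X)                            ∎
      where
      open ≤-Reasoning
      lo< : low h (col a) < 2 ^ h
      lo< = m%n<n (col a) (2 ^ h) {{m^n≢0 2 h}}
      hi< : high h (col a) < 2 ^ h
      hi< = m<n*o⇒m/o<n {{m^n≢0 2 h}} c<
      line< : line h (col a) (point a) < 2 ^ h * X
      line< = begin-strict
        low h (col a) + high h (col a) * point a   ≤⟨ +-monoʳ-≤ (low h (col a)) (*-monoʳ-≤ (high h (col a)) (≤-pred (argmin< (conflicts a) X′))) ⟩
        low h (col a) + high h (col a) * X′        <⟨ +-mono-<-≤ lo< (*-monoˡ-≤ X′ (<⇒≤ hi<)) ⟩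
        2 ^ h + 2 ^ h * X′                         ≡⟨ sym (*-suc (2 ^ h) X′) ⟩
        2 ^ h * X                                  ∎

  module Sequential (Q-sym : ∀ a b → Q a b ≡ Q b a) (α s λ′ : ℕ) (ℓ col F : ℕ → ℕ) where

    size weight : (ℕ → ℕ) → ℕ
    size y   = ∑ I y
    weight y = ∑ I λ a → ℓ a * y a

    chosen keep : ℕ → (ℕ → ℕ) → ℕ → Bool
    chosen c y a = (y a ≡ᵇ 1) ∧ (col a ≡ᵇ c)
    keep c y a   = α * grad y a + s ≤ᵇ λ′ * ℓ a

    -- The values 0, 1, 2 stand for out, undecided and in.
    class : ℕ → (ℕ → ℕ) → ℕ → ℕ
    class c y a = if chosen c y a then (if keep c y a then 2 else 0) else y a

    classes : ℕ → ℕ → ℕ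
    classes zero    = F
    classes (suc c) = class c (classes c)

    form-sym : ∀ f g → form f g ≡ form g f
    form-sym f g = trans (∑-swap I I _) (∑-cong I λ b → ∑-cong I λ a → cong₂ _*_ (Q-sym a b) (*-comm (f a) (g b)))

    form-square : ∀ f g → form (λ a → f a + g a) (λ a → f a + g a) ≡ form f f + 2 * form f g + form g g
    form-square f g = begin
      form fg fg                                            ≡⟨ form-+ˡ f g fg ⟩
      form f fg + form g fg                                 ≡⟨ cong₂ _+_ (expand f) (expand g) ⟩
      (form f f + form g f) + (form f g + form g g)         ≡⟨ cong (λ x → (form f f + x) + (form f g + form g g)) (form-sym g f) ⟩
      (form f f + form f g) + (form f g + form g g)         ≡⟨ eqn (form f f) (form f g) (form g g) ⟩
      form f f + 2 * form f g + form g g                    ∎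
      where
      open ≡-Reasoning
      fg : ℕ → ℕ
      fg a = f a + g a
      expand : ∀ k → form k fg ≡ form f k + form g k
      expand k = trans (form-sym k fg) (form-+ˡ f g k)
      eqn : ∀ a b c → (a + b) + (b + c) ≡ a + 2 * b + c
      eqn = solve-∀

    module Step (c : ℕ) (y : ℕ → ℕ) where
      y′ up down sel : ℕ → ℕ
      y′ = class c y
      up a   = 𝟙 (chosen c y a) * 𝟙 (keep c y a)
      down a = 𝟙 (chosen c y a) * 𝟙 (not (keep c y a))
      sel a  = 𝟙 (chosen c y a)

      balance : ∀ a → y′ a + down a ≡ y a + up a
      balance a with chosen c y a in eq
      ... | false = refl
      ... | true with keep c y a
      ...   | true  = cong (λ z → z + 1) {1} (sym (≡ᵇ⇒≡ (y a) 1 (proj₁ (∧-elim {y a ≡ᵇ 1} (subst T (sym eq) _)))))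
      ...   | false = sym (trans (+-identityʳ (y a)) (≡ᵇ⇒≡ (y a) 1 (proj₁ (∧-elim {y a ≡ᵇ 1} (subst T (sym eq) _)))))

      up+down : ∀ a → up a + down a ≡ sel a
      up+down a with chosen c y a | keep c y a
      ... | true  | true  = refl
      ... | true  | false = refl
      ... | false | _     = refl

      sum-balance : (f : ℕ → ℕ) → ∑ I (λ a → f a * y′ a) + ∑ I (λ a → f a * down a) ≡ ∑ I (λ a → f a * y a) + ∑ I (λ a → f a * up a)
      sum-balance f = trans (sym (∑-+ I _ _)) (trans (∑-cong I λ a →
        trans (sym (*-distribˡ-+ (f a) (y′ a) (down a))) (trans (cong (f a *_) (balance a)) (*-distribˡ-+ (f a) (y a) (up a)))) (∑-+ I _ _))

      size-balance : size y′ + size down ≡ size y + size up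
      size-balance = trans (sym (∑-+ I _ _)) (trans (∑-cong I balance) (∑-+ I _ _))

      up-gain : α * form up y + s * size up ≤ λ′ * weight up
      up-gain = begin
        α * form up y + s * size up
          ≡⟨ cong₂ _+_ (trans (cong (α *_) (form-grad up y)) (sym (∑-*ˡ I α _))) (sym (∑-*ˡ I s _)) ⟩
        ∑ I (λ a → α * (up a * grad y a)) + ∑ I (λ a → s * up a)
          ≡⟨ sym (∑-+ I _ _) ⟩
        ∑ I (λ a → α * (up a * grad y a) + s * up a)
          ≤⟨ ∑-mono I term ⟩
        ∑ I (λ a → λ′ * (ℓ a * up a))
          ≡⟨ ∑-*ˡ I λ′ _ ⟩
        λ′ * weight up ∎
        where
        open ≤-Reasoning
        e₁ : ∀ a u g s → a * (u * g) + s * u ≡ u * (a * g + s)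
        e₁ = solve-∀
        e₂ : ∀ l w u → u * (l * w) ≡ l * (w * u)
        e₂ = solve-∀
        le : ∀ a → up a * (α * grad y a + s) ≤ up a * (λ′ * ℓ a)
        le a with chosen c y a | keep c y a in eq
        ... | true  | true  = *-monoʳ-≤ 1 (≤ᵇ⇒≤ _ _ (subst T (sym eq) _))
        ... | true  | false = z≤n
        ... | false | _     = z≤n
        term : ∀ a → α * (up a * grad y a) + s * up a ≤ λ′ * (ℓ a * up a)
        term a = ≤-trans (≤-reflexive (e₁ α (up a) (grad y a) s)) (≤-trans (le a) (≤-reflexive (e₂ λ′ (ℓ a) (up a))))

      down-gain : λ′ * weight down ≤ α * form down y + s * size down
      down-gain = begin
        λ′ * weight down
          ≡⟨ sym (∑-*ˡ I λ′ _) ⟩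
        ∑ I (λ a → λ′ * (ℓ a * down a))
          ≤⟨ ∑-mono I term ⟩
        ∑ I (λ a → α * (down a * grad y a) + s * down a)
          ≡⟨ ∑-+ I _ _ ⟩
        ∑ I (λ a → α * (down a * grad y a)) + ∑ I (λ a → s * down a)
          ≡⟨ cong₂ _+_ (trans (∑-*ˡ I α _) (cong (α *_) (sym (form-grad down y)))) (∑-*ˡ I s _) ⟩
        α * form down y + s * size down ∎
        where
        open ≤-Reasoning
        e₁ : ∀ a u g s → u * (a * g + s) ≡ a * (u * g) + s * u
        e₁ = solve-∀
        e₂ : ∀ l w u → l * (w * u) ≡ u * (l * w)
        e₂ = solve-∀
        le : ∀ a → down a * (λ′ * ℓ a) ≤ down a * (α * grad y a + s)
        le a with chosen c y a | keep c y a in eq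
        ... | true  | false = *-monoʳ-≤ 1 (<⇒≤ (≰⇒> λ p → subst T eq (≤⇒≤ᵇ p)))
        ... | true  | true  = z≤n
        ... | false | _     = z≤n
        term : ∀ a → λ′ * (ℓ a * down a) ≤ α * (down a * grad y a) + s * down a
        term a = ≤-trans (≤-reflexive (e₂ λ′ (ℓ a) (down a))) (≤-trans (le a) (≤-reflexive (e₁ α (down a) (grad y a) s)))

      form-balance : form y′ y′ + 2 * form down y ≤ form y y + 2 * form up y + form sel sel
      form-balance = begin
        form y′ y′ + 2 * form down y
          ≤⟨ m≤m+n _ (2 * form up down) ⟩
        form y′ y′ + 2 * form down y + 2 * form up down
          ≡⟨ main ⟩
        form y y + 2 * form up y + form up up + form down down
          ≤⟨ ≤-trans (≤-reflexive (+-assoc (form y y + 2 * form up y) (form up up) (form down down))) (+-monoʳ-≤ (form y y + 2 * form up y) pairs) ⟩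
        form y y + 2 * form up y + form sel sel ∎
        where
        open ≤-Reasoning
        squares : form y′ y′ + 2 * form y′ down + form down down ≡ form y y + 2 * form y up + form up up
        squares = trans (sym (form-square y′ down)) (trans (form-cong balance balance) (form-square y up))
        cross : form y′ down + form down down ≡ form y down + form up down
        cross = trans (sym (form-+ˡ y′ down down)) (trans (form-cong {g = down} balance (λ _ → refl)) (form-+ˡ y up down))
        algebra : ∀ p x d r z → p + 2 * x + d ≡ r → x + d ≡ z → p + 2 * z ≡ r + d
        algebra p x d _ _ refl refl = eqn p x d
          where
          eqn : ∀ p x d → p + 2 * (x + d) ≡ p + 2 * x + d + d
          eqn = solve-∀
        main : form y′ y′ + 2 * form down y + 2 * form up down ≡ form y y + 2 * form up y + form up up + form down down
        main = trans (trans (+-assoc (form y′ y′) _ _) (cong (form y′ y′ +_) (trans (sym (*-distribˡ-+ 2 (form down y) _)) (cong (λ z → 2 * (z + form up down)) (form-sym down y)))))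
                 (trans (algebra (form y′ y′) (form y′ down) (form down down) _ _ squares cross)
                   (cong (λ z → form y y + 2 * z + form up up + form down down) (form-sym y up)))
        pairs : form up up + form down down ≤ form sel sel
        pairs = begin
          form up up + form down down                         ≤⟨ +-monoˡ-≤ (form down down) (m≤m+n _ (2 * form up down)) ⟩
          form up up + 2 * form up down + form down down      ≡⟨ sym (form-square up down) ⟩
          form (λ a → up a + down a) (λ a → up a + down a)    ≡⟨ form-cong up+down up+down ⟩
          form sel sel                                        ∎

      progress : α * form y′ y′ + 2 * (s * size y′) + 2 * (λ′ * weight y) ≤
                 α * form y y + α * form sel sel + 2 * (s * size y) + 2 * (λ′ * weight y′)
      progress = combine (form y′ y′) (form down y) (form y y) (form up y) (form sel sel)
                   (size y′) (size down) (size y) (size up) (weight y′) (weight down) (weight y) (weight up)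
                   form-balance size-balance (sum-balance ℓ) up-gain down-gain
        where
        combine : ∀ p d y u e S′ Sd S Su W′ Wd W Wu →
          p + 2 * d ≤ y + 2 * u + e → S′ + Sd ≡ S + Su → W′ + Wd ≡ W + Wu →
          α * u + s * Su ≤ λ′ * Wu → λ′ * Wd ≤ α * d + s * Sd →
          α * p + 2 * (s * S′) + 2 * (λ′ * W) ≤ α * y + α * e + 2 * (s * S) + 2 * (λ′ * W′)
        combine p d y u e S′ Sd S Su W′ Wd W Wu f eS eW g₁ g₂ = +-cancelʳ-≤ (2 * (α * d + s * Sd)) _ _ (begin
          α * p + 2 * (s * S′) + 2 * (λ′ * W) + 2 * (α * d + s * Sd)
            ≡⟨ r₁ α p s S′ λ′ W d Sd ⟩
          α * (p + 2 * d) + 2 * (s * (S′ + Sd)) + 2 * (λ′ * W)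
            ≤⟨ +-monoˡ-≤ (2 * (λ′ * W)) (+-mono-≤ (*-monoʳ-≤ α f) (≤-reflexive (cong (λ z → 2 * (s * z)) eS))) ⟩
          α * (y + 2 * u + e) + 2 * (s * (S + Su)) + 2 * (λ′ * W)
            ≡⟨ r₂ α y u e s S Su λ′ W ⟩
          α * y + α * e + 2 * (s * S) + 2 * (λ′ * W) + 2 * (α * u + s * Su)
            ≤⟨ +-monoʳ-≤ (α * y + α * e + 2 * (s * S) + 2 * (λ′ * W)) (*-monoʳ-≤ 2 g₁) ⟩
          α * y + α * e + 2 * (s * S) + 2 * (λ′ * W) + 2 * (λ′ * Wu)
            ≡⟨ r₃ (α * y + α * e + 2 * (s * S)) λ′ W Wu ⟩
          α * y + α * e + 2 * (s * S) + 2 * (λ′ * (W + Wu))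
            ≡⟨ cong (λ z → α * y + α * e + 2 * (s * S) + 2 * (λ′ * z)) (sym eW) ⟩
          α * y + α * e + 2 * (s * S) + 2 * (λ′ * (W′ + Wd))
            ≡⟨ sym (r₃ (α * y + α * e + 2 * (s * S)) λ′ W′ Wd) ⟩
          α * y + α * e + 2 * (s * S) + 2 * (λ′ * W′) + 2 * (λ′ * Wd)
            ≤⟨ +-monoʳ-≤ (α * y + α * e + 2 * (s * S) + 2 * (λ′ * W′)) (*-monoʳ-≤ 2 g₂) ⟩
          α * y + α * e + 2 * (s * S) + 2 * (λ′ * W′) + 2 * (α * d + s * Sd) ∎)
          where
          open ≤-Reasoning
          r₁ : ∀ α p s S′ l W d Sd → α * p + 2 * (s * S′) + 2 * (l * W) + 2 * (α * d + s * Sd) ≡ α * (p + 2 * d) + 2 * (s * (S′ + Sd)) + 2 * (l * W)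
          r₁ = solve-∀
          r₂ : ∀ α y u e s S Su l W → α * (y + 2 * u + e) + 2 * (s * (S + Su)) + 2 * (l * W) ≡ α * y + α * e + 2 * (s * S) + 2 * (l * W) + 2 * (α * u + s * Su)
          r₂ = solve-∀
          r₃ : ∀ c l W Wu → c + 2 * (l * W) + 2 * (l * Wu) ≡ c + 2 * (l * (W + Wu))
          r₃ = solve-∀

    monoBelow : ℕ → ℕ
    monoBelow c = ∑ I λ a → ∑ I λ b → Q a b * ((F a * F b) * (𝟙 (col a ≡ᵇ col b) * 𝟙 (col a <ᵇ c)))

    undecided : ∀ c a → c ≤ col a → classes c a ≡ F a
    undecided zero    a _  = refl
    undecided (suc c) a lt = trans (if-no λ t → <⇒≢ lt (sym (≡ᵇ⇒≡ _ _ (proj₂ (∧-elim {classes c a ≡ᵇ 1} t))))) (undecided c a (<⇒≤ lt))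

    decided : (∀ a → F a ≤ 1) → ∀ c a → col a < c → classes c a ≡ 0 ⊎ (classes c a ≡ 2 × F a ≡ 1)
    decided F≤1 (suc c) a (s≤s le) with m≤n⇒m<n∨m≡n le
    ... | inj₁ lt = subst (λ z → z ≡ 0 ⊎ (z ≡ 2 × F a ≡ 1)) (sym (if-no λ t → <⇒≢ lt (≡ᵇ⇒≡ _ _ (proj₂ (∧-elim {classes c a ≡ᵇ 1} t))))) (decided F≤1 c a lt)
    ... | inj₂ eq with chosen c (classes c) a in ch
    ...   | true with keep c (classes c) a
    ...     | true  = inj₂ (refl , trans (sym (undecided c a (≤-reflexive (sym eq)))) (≡ᵇ⇒≡ _ 1 (proj₁ (∧-elim {classes c a ≡ᵇ 1} (subst T (sym ch) _)))))
    ...     | false = inj₁ refl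
    decided F≤1 (suc c) a (s≤s le) | inj₂ eq | false = inj₁ (trans (undecided c a (≤-reflexive (sym eq))) (F0 (F≤1 a) λ F1 →
      subst T ch (∧-intro (≡⇒≡ᵇ _ 1 (trans (undecided c a (≤-reflexive (sym eq))) F1)) (≡⇒≡ᵇ _ _ eq))))
      where
      F0 : ∀ {x} → x ≤ 1 → x ≢ 1 → x ≡ 0
      F0 {zero}  _         _  = refl
      F0 {suc zero} _      ne = ⊥-elim (ne refl)
      F0 {suc (suc x)} (s≤s ()) _

    private
      sel≤ : ∀ c a → 𝟙 (chosen c (classes c) a) ≤ F a * 𝟙 (col a ≡ᵇ c)
      sel≤ c a with chosen c (classes c) a in ch
      ... | false = z≤n
      ... | true with ∧-elim {classes c a ≡ᵇ 1} (subst T (sym ch) _)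
      ...   | y1 , ec = ≤-reflexive (sym (cong₂ _*_ (trans (sym (undecided c a (≤-reflexive (sym (≡ᵇ⇒≡ _ _ ec))))) (≡ᵇ⇒≡ _ _ y1)) (if-yes ec)))

      monoBelow-step : ∀ c → monoBelow c + form (λ a → 𝟙 (chosen c (classes c) a)) (λ a → 𝟙 (chosen c (classes c) a)) ≤ monoBelow (suc c)
      monoBelow-step c = ≤-trans (+-monoʳ-≤ (monoBelow c) (form-mono (sel≤ c) (sel≤ c)))
        (≤-trans (≤-reflexive (trans (sym (∑-+ I _ _)) (∑-cong I λ a → sym (∑-+ I _ _))))
          (∑-mono I λ a → ∑-mono I λ b → ≤-trans (≤-reflexive (e (Q a b) (F a) (F b) (𝟙 (col a ≡ᵇ col b)) (𝟙 (col a <ᵇ c)) (𝟙 (col a ≡ᵇ c)) (𝟙 (col b ≡ᵇ c))))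
            (*-monoʳ-≤ (Q a b) (*-monoʳ-≤ (F a * F b) (bits (col a) (col b))))))
        where
        e : ∀ q x y m l u v → q * ((x * y) * (m * l)) + q * ((x * u) * (y * v)) ≡ q * ((x * y) * (m * l + u * v))
        e = solve-∀
        bits : ∀ x y → 𝟙 (x ≡ᵇ y) * 𝟙 (x <ᵇ c) + 𝟙 (x ≡ᵇ c) * 𝟙 (y ≡ᵇ c) ≤ 𝟙 (x ≡ᵇ y) * 𝟙 (x <ᵇ suc c)
        bits x y with x ≟ c
        ... | no x≢ rewrite if-no {b = x ≡ᵇ c} {x = 1} {y = 0} (x≢ ∘ ≡ᵇ⇒≡ x c) | +-identityʳ (𝟙 (x ≡ᵇ y) * 𝟙 (x <ᵇ c)) =
          *-monoʳ-≤ (𝟙 (x ≡ᵇ y)) (𝟙-mono λ t → <⇒<ᵇ (m<n⇒m<1+n (<ᵇ⇒< x c t)))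
        ... | yes refl rewrite if-no {b = x <ᵇ x} {x = 1} {y = 0} (<-irrefl refl ∘ <ᵇ⇒< x x) | if-yes {b = x ≡ᵇ x} {x = 1} {y = 0} (≡ᵇ-refl x)
                             | if-yes {b = x <ᵇ suc x} {x = 1} {y = 0} (<⇒<ᵇ (≤-refl {suc x})) | *-zeroʳ (𝟙 (x ≡ᵇ y)) | *-identityʳ (𝟙 (x ≡ᵇ y)) | +-identityʳ (𝟙 (y ≡ᵇ x)) =
          𝟙-mono λ t → ≡⇒≡ᵇ x y (sym (≡ᵇ⇒≡ y x t))

    classes-progress : ∀ c → α * form (classes c) (classes c) + 2 * (s * size (classes c)) + 2 * (λ′ * weight F) ≤
                             α * form F F + α * monoBelow c + 2 * (s * size F) + 2 * (λ′ * weight (classes c))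
    classes-progress zero    = ≤-trans (m≤m+n _ (α * monoBelow 0)) (≤-reflexive (e (α * form F F) (2 * (s * size F)) (2 * (λ′ * weight F)) (α * monoBelow 0)))
      where
      e : ∀ a b c d → a + b + c + d ≡ a + d + b + c
      e = solve-∀
    classes-progress (suc c) = chain (form (classes (suc c)) (classes (suc c))) (2 * (s * size (classes (suc c)))) (2 * (λ′ * weight (classes (suc c))))
                                 (form (classes c) (classes c)) (2 * (s * size (classes c))) (2 * (λ′ * weight (classes c)))
                                 (form F F) (2 * (s * size F)) (2 * (λ′ * weight F)) (form (Step.sel c (classes c)) (Step.sel c (classes c))) (monoBelow c) (monoBelow (suc c))
                                 (Step.progress c (classes c)) (classes-progress c) (monoBelow-step c)
      where
      chain : ∀ p S W p₀ S₀ W₀ p₁ S₁ W₁ e m m′ →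
              α * p + S + W₀ ≤ α * p₀ + α * e + S₀ + W → α * p₀ + S₀ + W₁ ≤ α * p₁ + α * m + S₁ + W₀ → m + e ≤ m′ →
              α * p + S + W₁ ≤ α * p₁ + α * m′ + S₁ + W
      chain p S W p₀ S₀ W₀ p₁ S₁ W₁ e m m′ h₁ h₂ h₃ = +-cancelʳ-≤ (W₀ + (α * p₀ + S₀)) _ _ (begin
        α * p + S + W₁ + (W₀ + (α * p₀ + S₀))
          ≡⟨ r₁ (α * p) S W₁ W₀ (α * p₀) S₀ ⟩
        (α * p + S + W₀) + (α * p₀ + S₀ + W₁)
          ≤⟨ +-mono-≤ h₁ h₂ ⟩
        (α * p₀ + α * e + S₀ + W) + (α * p₁ + α * m + S₁ + W₀)
          ≡⟨ r₂ α p₀ e S₀ W p₁ m S₁ W₀ ⟩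
        α * p₁ + α * (m + e) + S₁ + W + (W₀ + (α * p₀ + S₀))
          ≤⟨ +-monoˡ-≤ (W₀ + (α * p₀ + S₀)) (+-monoˡ-≤ W (+-monoˡ-≤ S₁ (+-monoʳ-≤ (α * p₁) (*-monoʳ-≤ α h₃)))) ⟩
        α * p₁ + α * m′ + S₁ + W + (W₀ + (α * p₀ + S₀)) ∎)
        where
        open ≤-Reasoning
        r₁ : ∀ a b c d e f → a + b + c + (d + (e + f)) ≡ (a + b + d) + (e + f + c)
        r₁ = solve-∀
        r₂ : ∀ α p₀ e S₀ W p₁ m S₁ W₀ → (α * p₀ + α * e + S₀ + W) + (α * p₁ + α * m + S₁ + W₀) ≡ α * p₁ + α * (m + e) + S₁ + W + (W₀ + (α * p₀ + S₀))
        r₂ = solve-∀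

    monoBelow≤ : ∀ c → monoBelow c ≤ mono F col
    monoBelow≤ c = ∑-mono I λ a → ∑-mono I λ b → *-monoʳ-≤ (Q a b) (*-monoʳ-≤ (F a * F b)
      (≤-trans (*-monoʳ-≤ (𝟙 (col a ≡ᵇ col b)) (𝟙≤1 _)) (≤-reflexive (*-identityʳ _))))

    halved : ℕ → ℕ → ℕ
    halved C a = classes C a / 2

    halved≤1 : (∀ a → F a ≤ 1) → ∀ C a → halved C a ≤ 1
    halved≤1 F≤1 C a = /-monoˡ-≤ 2 (classes≤2 C)
      where
      classes≤2 : ∀ c → classes c a ≤ 2
      classes≤2 zero = m≤n⇒m≤1+n (F≤1 a)
      classes≤2 (suc c) with chosen c (classes c) a
      ... | false = classes≤2 c
      ... | true with keep c (classes c) a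
      ...   | true  = ≤-refl
      ...   | false = z≤n

    module _ (F≤1 : ∀ a → F a ≤ 1) (C : ℕ) (col<C : ∀ a → a < N → col a < C) where

      twice : ∀ a → a < N → classes C a ≡ 2 * halved C a
      twice a a<N with decided F≤1 C a (col<C a a<N)
      ... | inj₁ e       = trans e (sym (cong (λ z → 2 * (z / 2)) e))
      ... | inj₂ (e , _) = trans e (sym (cong (λ z → 2 * (z / 2)) e))

      halved≤ : ∀ a → a < N → halved C a ≤ F a
      halved≤ a a<N with decided F≤1 C a (col<C a a<N)
      ... | inj₁ e        = ≤-trans (≤-reflexive (cong (_/ 2) e)) z≤n
      ... | inj₂ (e , F1) = ≤-reflexive (trans (cong (_/ 2) e) (sym F1))

      halving : 4 * (α * form (halved C) (halved C)) + 4 * (s * size (halved C)) + 2 * (λ′ * weight F) ≤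
                α * (form F F + mono F col) + 2 * (s * size F) + 4 * (λ′ * weight (halved C))
      halving = begin
        4 * (α * form H H) + 4 * (s * size H) + 2 * (λ′ * weight F)
          ≡⟨ cong₂ (λ x y → x + y + 2 * (λ′ * weight F)) (trans (e₁ α (form H H)) (cong (α *_) (sym (trans form≡ (form-scale 2 H))))) (trans (e₂ s (size H)) (cong (λ z → 2 * (s * z)) (sym size≡))) ⟩
        α * form (classes C) (classes C) + 2 * (s * size (classes C)) + 2 * (λ′ * weight F)
          ≤⟨ classes-progress C ⟩
        α * form F F + α * monoBelow C + 2 * (s * size F) + 2 * (λ′ * weight (classes C))
          ≤⟨ +-mono-≤ (+-monoˡ-≤ (2 * (s * size F)) (≤-trans (+-monoʳ-≤ (α * form F F) (*-monoʳ-≤ α (monoBelow≤ C))) (≤-reflexive (sym (*-distribˡ-+ α (form F F) (mono F col))))))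
               (≤-reflexive (trans (cong (λ z → 2 * (λ′ * z)) weight≡) (sym (e₂ λ′ (weight H))))) ⟩
        α * (form F F + mono F col) + 2 * (s * size F) + 4 * (λ′ * weight H) ∎
        where
        open ≤-Reasoning
        H = halved C
        e₁ : ∀ a x → 4 * (a * x) ≡ a * (2 * 2 * x)
        e₁ = solve-∀
        e₂ : ∀ a x → 4 * (a * x) ≡ 2 * (a * (2 * x))
        e₂ = solve-∀
        e₃ : ∀ x y → x * (2 * y) ≡ 2 * (x * y)
        e₃ = solve-∀
        size≡ : size (classes C) ≡ 2 * size H
        size≡ = trans (∑-cong∈ I λ a a∈ → twice a (∈-upTo⁻ a∈)) (∑-*ˡ I 2 H)
        weight≡ : weight (classes C) ≡ 2 * weight H
        weight≡ = trans (∑-cong∈ I λ a a∈ → trans (cong (ℓ a *_) (twice a (∈-upTo⁻ a∈))) (e₃ (ℓ a) (H a))) (∑-*ˡ I 2 _)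
        form≡ : form (classes C) (classes C) ≡ form (λ a → 2 * H a) (λ a → 2 * H a)
        form≡ = ∑-cong∈ I λ a a∈ → ∑-cong∈ I λ b b∈ → cong₂ (λ x y → Q a b * (x * y)) (twice a (∈-upTo⁻ a∈)) (twice b (∈-upTo⁻ b∈))

-- J halvings, each along a fresh colouring

module Halvings (ξ m J β₀ : ℕ) where

  X′ X : ℕ
  X′ = 2 ^ ξ ∸ 1
  X  = suc X′

  X≡ : X ≡ 2 ^ ξ
  X≡ = m+[n∸m]≡n {1} (m^n>0 2 ξ)

  colourBits : ℕ → ℕ
  colourBits zero    = β₀
  colourBits (suc i) = ⌈ colourBits i /2⌉ + 2 * ξ

  ⌈/2⌉-≥ : ∀ b → b ≤ ⌈ b /2⌉ + ⌈ b /2⌉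
  ⌈/2⌉-≥ zero          = z≤n
  ⌈/2⌉-≥ (suc zero)    = s≤s z≤n
  ⌈/2⌉-≥ (suc (suc b)) = ≤-trans (s≤s (s≤s (⌈/2⌉-≥ b))) (≤-reflexive (cong suc (sym (+-suc ⌈ b /2⌉ ⌈ b /2⌉))))

  ⌈/2⌉-≤ : ∀ b → 2 * ⌈ b /2⌉ ≤ suc b
  ⌈/2⌉-≤ zero          = z≤n
  ⌈/2⌉-≤ (suc zero)    = ≤-refl
  ⌈/2⌉-≤ (suc (suc b)) = ≤-trans (≤-reflexive (*-suc 2 ⌈ b /2⌉)) (s≤s (s≤s (⌈/2⌉-≤ b)))

  classCount : ℕ
  classCount = 2 ^ (4 * ξ + 1)

  private
    doubled : ∀ i → 2 * colourBits (suc i) ≤ colourBits i + (4 * ξ + 1)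
    doubled i = begin
      2 * (⌈ colourBits i /2⌉ + 2 * ξ)         ≡⟨ *-distribˡ-+ 2 ⌈ colourBits i /2⌉ (2 * ξ) ⟩
      2 * ⌈ colourBits i /2⌉ + 2 * (2 * ξ)     ≤⟨ +-monoˡ-≤ (2 * (2 * ξ)) (⌈/2⌉-≤ (colourBits i)) ⟩
      suc (colourBits i) + 2 * (2 * ξ)         ≡⟨ e (colourBits i) ξ ⟩
      colourBits i + (4 * ξ + 1)               ∎
      where
      open ≤-Reasoning
      e : ∀ b x → suc b + 2 * (2 * x) ≡ b + (4 * x + 1)
      e = solve-∀

  colourBits-decay : ∀ i → 2 ^ i * colourBits i ≤ β₀ + 2 ^ i * (4 * ξ + 1)
  colourBits-decay zero    = ≤-trans (≤-reflexive (+-identityʳ β₀)) (m≤m+n β₀ _)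
  colourBits-decay (suc i) = begin
    2 * 2 ^ i * colourBits (suc i)                        ≡⟨ e₁ (2 ^ i) (colourBits (suc i)) ⟩
    2 ^ i * (2 * colourBits (suc i))                      ≤⟨ *-monoʳ-≤ (2 ^ i) (doubled i) ⟩
    2 ^ i * (colourBits i + (4 * ξ + 1))                  ≡⟨ *-distribˡ-+ (2 ^ i) (colourBits i) _ ⟩
    2 ^ i * colourBits i + 2 ^ i * (4 * ξ + 1)            ≤⟨ +-monoˡ-≤ (2 ^ i * (4 * ξ + 1)) (colourBits-decay i) ⟩
    β₀ + 2 ^ i * (4 * ξ + 1) + 2 ^ i * (4 * ξ + 1)        ≡⟨ e₂ β₀ (2 ^ i) (4 * ξ + 1) ⟩
    β₀ + 2 * 2 ^ i * (4 * ξ + 1)                          ∎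
    where
    open ≤-Reasoning
    e₁ : ∀ p b → 2 * p * b ≡ p * (2 * b)
    e₁ = solve-∀
    e₂ : ∀ b p x → b + p * x + p * x ≡ b + 2 * p * x
    e₂ = solve-∀

  colourBits≤ : ∀ i → colourBits i ≤ β₀ + (4 * ξ + 1)
  colourBits≤ zero    = m≤m+n β₀ _
  colourBits≤ (suc i) = *-cancelˡ-≤ 2 (begin
    2 * colourBits (suc i)              ≤⟨ doubled i ⟩
    colourBits i + (4 * ξ + 1)          ≤⟨ +-monoˡ-≤ (4 * ξ + 1) (colourBits≤ i) ⟩
    β₀ + (4 * ξ + 1) + (4 * ξ + 1)      ≤⟨ ≤-trans (m≤n+m _ β₀) (≤-reflexive (e β₀ (4 * ξ + 1))) ⟩
    2 * (β₀ + (4 * ξ + 1))              ∎)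
    where
    open ≤-Reasoning
    e : ∀ b x → b + (b + x + x) ≡ 2 * (b + x)
    e = solve-∀

  colourBits-final : β₀ < 2 ^ m → colourBits m ≤ 4 * ξ + 1
  colourBits-final β₀< = ≤-pred (*-cancelˡ-< (2 ^ m) (colourBits m) (suc (4 * ξ + 1)) (begin-strict
    2 ^ m * colourBits m                ≤⟨ colourBits-decay m ⟩
    β₀ + 2 ^ m * (4 * ξ + 1)            <⟨ +-monoˡ-< _ β₀< ⟩
    2 ^ m + 2 ^ m * (4 * ξ + 1)         ≡⟨ sym (*-suc (2 ^ m) (4 * ξ + 1)) ⟩
    2 ^ m * suc (4 * ξ + 1)             ∎))
    where open ≤-Reasoning

  -- The coefficient of the quadratic part absorbs the error (X + m) / X of each later halving.
  coeff : ℕ → ℕ → ℕ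
  coeff r e = 2 ^ r * 2 ^ r * (X + m) ^ e * X ^ r

  error-bound : 4 * (m * J) ≤ X → 3 * (X + m) ^ J ≤ 4 * X ^ J
  error-bound small = *-cancelˡ-≤ X (+-cancelʳ-≤ (X * (X + m) ^ J) _ _ (begin
    X * (3 * (X + m) ^ J) + X * (X + m) ^ J           ≡⟨ e₁ X ((X + m) ^ J) ⟩
    4 * ((X + m) ^ J * X)                             ≤⟨ *-monoʳ-≤ 4 (bernoulli J) ⟩
    4 * (X ^ J * X + m * J * (X + m) ^ J)             ≡⟨ e₂ (X ^ J) X (m * J) ((X + m) ^ J) ⟩
    X * (4 * X ^ J) + 4 * (m * J) * (X + m) ^ J       ≤⟨ +-monoʳ-≤ (X * (4 * X ^ J)) (*-monoˡ-≤ ((X + m) ^ J) small) ⟩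
    X * (4 * X ^ J) + X * (X + m) ^ J                 ∎))
    where
    open ≤-Reasoning
    e₁ : ∀ x y → x * (3 * y) + x * y ≡ 4 * (y * x)
    e₁ = solve-∀
    e₂ : ∀ p x k q → 4 * (p * x + k * q) ≡ x * (4 * p) + 4 * k * q
    e₂ = solve-∀
    bernoulli : ∀ j → (X + m) ^ j * X ≤ X ^ j * X + m * j * (X + m) ^ j
    bernoulli zero    = m≤m+n _ _
    bernoulli (suc j) = begin
      (X + m) * (X + m) ^ j * X                                   ≡⟨ *-assoc (X + m) ((X + m) ^ j) X ⟩
      (X + m) * ((X + m) ^ j * X)                                 ≤⟨ *-monoʳ-≤ (X + m) (bernoulli j) ⟩
      (X + m) * (X ^ j * X + m * j * (X + m) ^ j)                 ≡⟨ f₁ X m (X ^ j) (m * j) ((X + m) ^ j) ⟩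
      X * X ^ j * X + m * j * ((X + m) * (X + m) ^ j) + m * (X * X ^ j)
        ≤⟨ +-monoʳ-≤ (X * X ^ j * X + m * j * ((X + m) * (X + m) ^ j)) (*-monoʳ-≤ m (^-monoˡ-≤ (suc j) (m≤m+n X m))) ⟩
      X * X ^ j * X + m * j * ((X + m) * (X + m) ^ j) + m * ((X + m) * (X + m) ^ j)
        ≡⟨ f₂ (X * X ^ j * X) m j ((X + m) * (X + m) ^ j) ⟩
      X * X ^ j * X + m * suc j * ((X + m) * (X + m) ^ j)         ∎
      where
      f₁ : ∀ x m p k q → (x + m) * (p * x + k * q) ≡ x * p * x + k * ((x + m) * q) + m * (x * p)
      f₁ = solve-∀
      f₂ : ∀ c m j q → c + m * j * q + m * q ≡ c + m * suc j * q
      f₂ = solve-∀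

  module Rounding (N : ℕ) (N≤ : N ≤ 2 ^ β₀) (Q : ℕ → ℕ → ℕ) (Q-sym : ∀ a b → Q a b ≡ Q b a) (Q-diag : ∀ a → Q a a ≡ 0)
                  (ω σ′ λ′ : ℕ) (ℓ : ℕ → ℕ) where
    open Quadratic N Q hiding (module Recolour)
    module Recolour = Quadratic.Recolour N Q

    colours : (ℕ → ℕ) → ℕ → ℕ → ℕ
    colours F zero    a = a
    colours F (suc i)   = Recolour.recolour ⌈ colourBits i /2⌉ X′ F (colours F i)

    colours< : ∀ F i a → a < N → colours F i a < 2 ^ colourBits i
    colours< F zero    a a<N = <-≤-trans a<N N≤
    colours< F (suc i) a a<N = <-≤-trans
      (Recolour.recolour< h X′ F (colours F i) a
        (<-≤-trans (colours< F i a a<N) (≤-trans (^-monoʳ-≤ 2 (⌈/2⌉-≥ (colourBits i))) (≤-reflexive (^-distribˡ-+-* 2 h h)))))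
      (≤-reflexive (begin
        2 ^ h * (X * X)            ≡⟨ cong (λ x → 2 ^ h * (x * x)) X≡ ⟩
        2 ^ h * (2 ^ ξ * 2 ^ ξ)    ≡⟨ cong (2 ^ h *_) (sym (^-distribˡ-+-* 2 ξ ξ)) ⟩
        2 ^ h * 2 ^ (ξ + ξ)        ≡⟨ sym (^-distribˡ-+-* 2 h (ξ + ξ)) ⟩
        2 ^ (h + (ξ + ξ))          ≡⟨ cong (λ x → 2 ^ (h + (ξ + x))) (sym (+-identityʳ ξ)) ⟩
        2 ^ (h + 2 * ξ)            ∎))
      where
      open ≡-Reasoning
      h = ⌈ colourBits i /2⌉

    colours-mono : ∀ F i → X * mono F (colours F i) ≤ i * form F F
    colours-mono F zero    = ≤-reflexive (trans (cong (X *_) zero-mono) (*-zeroʳ X))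
      where
      zero-mono : mono F (λ a → a) ≡ 0
      zero-mono = ∑-zero∈ I λ a _ → ∑-zero∈ I λ b _ → term a b
        where
        term : ∀ a b → Q a b * ((F a * F b) * 𝟙 (a ≡ᵇ b)) ≡ 0
        term a b with a ≟ b
        ... | yes refl = cong (_* ((F a * F a) * 𝟙 (a ≡ᵇ a))) (Q-diag a)
        ... | no ne    = trans (cong (λ z → Q a b * ((F a * F b) * z)) (if-no (ne ∘ ≡ᵇ⇒≡ a b))) (trans (cong (Q a b *_) (*-zeroʳ (F a * F b))) (*-zeroʳ (Q a b)))
    colours-mono F (suc i) = ≤-trans (Recolour.recolour-mono ⌈ colourBits i /2⌉ X′ F (colours F i))
      (≤-trans (+-monoˡ-≤ (form F F) (colours-mono F i)) (≤-reflexive (+-comm (i * form F F) (form F F))))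

    quad lin cost : ℕ → ℕ
    quad r = ω * coeff (suc r) (J ∸ suc r)
    lin  r = 2 ^ suc r * λ′
    cost r = 2 ^ suc r * σ′

    module Seq r F = Sequential Q-sym (quad r) (cost r) (lin r) ℓ (colours F m) F

    halve : ℕ → (ℕ → ℕ) → ℕ → ℕ
    halve r F = Seq.halved r F classCount

    size weight : (ℕ → ℕ) → ℕ
    size y   = ∑ I y
    weight y = ∑ I λ a → ℓ a * y a

    module Bounds (β₀< : β₀ < 2 ^ m) (small : 4 * (m * J) ≤ X) where

      col<C : ∀ F a → a < N → colours F m a < classCount
      col<C F a a<N = <-≤-trans (colours< F m a a<N) (^-monoʳ-≤ 2 (colourBits-final β₀<))

      halve≤ : ∀ r F → (∀ a → F a ≤ 1) → ∀ a → a < N → halve r F a ≤ F a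
      halve≤ r F F≤1 = Seq.halved≤ r F F≤1 classCount (col<C F)

      halve≤1 : ∀ r F → (∀ a → F a ≤ 1) → ∀ a → halve r F a ≤ 1
      halve≤1 r F F≤1 = Seq.halved≤1 r F F≤1 classCount

      Potential : (F₀ : ℕ → ℕ) → ℕ → (ℕ → ℕ) → Set
      Potential F₀ r F = ω * coeff r (J ∸ r) * form F F + 2 ^ r * (σ′ * size F) + λ′ * weight F₀ ≤
                         ω * coeff 0 J * form F₀ F₀ + σ′ * size F₀ + 2 ^ r * (λ′ * weight F)

      potential-start : ∀ F₀ → Potential F₀ 0 F₀
      potential-start F₀ = ≤-reflexive (cong₂ (λ x y → ω * coeff 0 J * form F₀ F₀ + x + y) (*-identityˡ _) (sym (*-identityˡ _)))

      potential-step : ∀ F₀ r F → r < J → (∀ a → F a ≤ 1) → Potential F₀ r F → Potential F₀ (suc r) (halve r F)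
      potential-step F₀ r F r<J F≤1 pot =
        arith (form F F) (form H H) (mono F (colours F m)) (size F) (size H) (weight F) (weight H) (2 ^ r) (ω * coeff r (J ∸ r)) (quad r)
          (ω * coeff 0 J * form F₀ F₀ + σ′ * size F₀) (λ′ * weight F₀)
          (Seq.halving r F F≤1 classCount (col<C F)) (colours-mono F m) coeff-step pot
        where
        H = halve r F
        coeff-step : quad r * (X + m) ≡ 4 * X * (ω * coeff r (J ∸ r))
        coeff-step = trans (e ω (2 ^ r) (X + m) X ((X + m) ^ (J ∸ suc r)) (X ^ r))
                       (cong (λ k → 4 * X * (ω * (2 ^ r * 2 ^ r * (X + m) ^ k * X ^ r))) (sym J∸r))
          where
          J∸r : J ∸ r ≡ suc (J ∸ suc r)
          J∸r = +-∸-assoc 1 r<J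
          e : ∀ w p d x q g → w * (2 * p * (2 * p) * q * (x * g)) * d ≡ 4 * x * (w * (p * p * (d * q) * g))
          e = solve-∀
        arith : ∀ B B′ M S S′ W W′ P a₀ a′ K L₀ →
          4 * (a′ * B′) + 4 * ((2 * P * σ′) * S′) + 2 * ((2 * P * λ′) * W) ≤ a′ * (B + M) + 2 * ((2 * P * σ′) * S) + 4 * ((2 * P * λ′) * W′) →
          X * M ≤ m * B → a′ * (X + m) ≡ 4 * X * a₀ →
          a₀ * B + P * (σ′ * S) + L₀ ≤ K + P * (λ′ * W) →
          a′ * B′ + 2 * P * (σ′ * S′) + L₀ ≤ K + 2 * P * (λ′ * W′)
        arith B B′ M S S′ W W′ P a₀ a′ K L₀ h hM hg pot =
          +-cancelʳ-≤ (P * (λ′ * W) + (a₀ * B + P * (σ′ * S))) _ _ (begin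
            a′ * B′ + 2 * P * (σ′ * S′) + L₀ + (P * (λ′ * W) + (a₀ * B + P * (σ′ * S)))
              ≡⟨ r₁ (a′ * B′) (2 * P * (σ′ * S′)) L₀ (P * (λ′ * W)) (a₀ * B) (P * (σ′ * S)) ⟩
            (a′ * B′ + 2 * P * (σ′ * S′) + P * (λ′ * W)) + (a₀ * B + P * (σ′ * S) + L₀)
              ≤⟨ +-mono-≤ step pot ⟩
            (a₀ * B + P * (σ′ * S) + 2 * P * (λ′ * W′)) + (K + P * (λ′ * W))
              ≡⟨ r₂ (a₀ * B) (P * (σ′ * S)) (2 * P * (λ′ * W′)) K (P * (λ′ * W)) ⟩
            K + 2 * P * (λ′ * W′) + (P * (λ′ * W) + (a₀ * B + P * (σ′ * S))) ∎)
          where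
          open ≤-Reasoning
          r₁ : ∀ a b c d e f → a + b + c + (d + (e + f)) ≡ (a + b + d) + (e + f + c)
          r₁ = solve-∀
          r₂ : ∀ a b c k d → (a + b + c) + (k + d) ≡ k + c + (d + (a + b))
          r₂ = solve-∀
          step : a′ * B′ + 2 * P * (σ′ * S′) + P * (λ′ * W) ≤ a₀ * B + P * (σ′ * S) + 2 * P * (λ′ * W′)
          step = *-cancelˡ-≤ (4 * X) (begin
            4 * X * (a′ * B′ + 2 * P * (σ′ * S′) + P * (λ′ * W))
              ≡⟨ s₁ X a′ B′ P σ′ S′ λ′ W ⟩
            X * (4 * (a′ * B′) + 4 * ((2 * P * σ′) * S′) + 2 * ((2 * P * λ′) * W))
              ≤⟨ *-monoʳ-≤ X h ⟩
            X * (a′ * (B + M) + 2 * ((2 * P * σ′) * S) + 4 * ((2 * P * λ′) * W′))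
              ≡⟨ s₂ X a′ B M (2 * ((2 * P * σ′) * S)) (4 * ((2 * P * λ′) * W′)) ⟩
            a′ * (X * B + X * M) + X * (2 * ((2 * P * σ′) * S) + 4 * ((2 * P * λ′) * W′))
              ≤⟨ +-monoˡ-≤ _ (*-monoʳ-≤ a′ (+-monoʳ-≤ (X * B) hM)) ⟩
            a′ * (X * B + m * B) + X * (2 * ((2 * P * σ′) * S) + 4 * ((2 * P * λ′) * W′))
              ≡⟨ cong (_+ X * (2 * ((2 * P * σ′) * S) + 4 * ((2 * P * λ′) * W′))) (trans (s₃ a′ X B m) (cong (_* B) hg)) ⟩
            4 * X * a₀ * B + X * (2 * ((2 * P * σ′) * S) + 4 * ((2 * P * λ′) * W′))
              ≡⟨ s₄ X a₀ B P σ′ S λ′ W′ ⟩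
            4 * X * (a₀ * B + P * (σ′ * S) + 2 * P * (λ′ * W′)) ∎)
            where
            s₁ : ∀ X a B P s S l W → 4 * X * (a * B + 2 * P * (s * S) + P * (l * W)) ≡ X * (4 * (a * B) + 4 * ((2 * P * s) * S) + 2 * ((2 * P * l) * W))
            s₁ = solve-∀
            s₂ : ∀ X a B M u v → X * (a * (B + M) + u + v) ≡ a * (X * B + X * M) + X * (u + v)
            s₂ = solve-∀
            s₃ : ∀ a X B m → a * (X * B + m * B) ≡ a * (X + m) * B
            s₃ = solve-∀
            s₄ : ∀ X a B P s S l W → 4 * X * a * B + X * (2 * ((2 * P * s) * S) + 4 * ((2 * P * l) * W)) ≡ 4 * X * (a * B + P * (s * S) + 2 * P * (l * W))
            s₄ = solve-∀

-- Isolation: a node succeeds if exactly one element of B is selected and this element lies in A ⊆ B.  The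
-- indicator of success is at least |A ∩ F| minus the number of pairs of selected elements of A and B.

pairs : (ℕ → Bool) → (ℕ → Bool) → ℕ → ℕ → ℕ
pairs A B a b = if a ≡ᵇ b then 0 else 𝟙 (A a) * 𝟙 (B b) + 𝟙 (A b) * 𝟙 (B a)

pairs-sym : ∀ A B a b → pairs A B a b ≡ pairs A B b a
pairs-sym A B a b with a ≟ b
... | yes refl = refl
... | no ne    = trans (if-no (ne ∘ ≡ᵇ⇒≡ a b)) (trans (+-comm (𝟙 (A a) * 𝟙 (B b)) _) (sym (if-no (ne ∘ sym ∘ ≡ᵇ⇒≡ b a))))

pairs-diag : ∀ A B a → pairs A B a a ≡ 0
pairs-diag A B a = if-yes (≡ᵇ-refl a)

pairs≤2 : ∀ A B a b → pairs A B a b ≤ 2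
pairs≤2 A B a b with a ≡ᵇ b
... | true  = z≤n
... | false = +-mono-≤ (*-mono-≤ (𝟙≤1 (A a)) (𝟙≤1 (B b))) (*-mono-≤ (𝟙≤1 (A b)) (𝟙≤1 (B a)))

hits : ℕ → (ℕ → Bool) → (ℕ → ℕ) → ℕ
hits N A F = ∑ (upTo N) λ a → 𝟙 (A a) * F a

hits-cong : ∀ N (C : ℕ → Bool) {f g : ℕ → ℕ} → (∀ a → T (C a) → f a ≡ g a) → hits N C f ≡ hits N C g
hits-cong N C {f} {g} e = ∑-cong (upTo N) term
  where
  term : ∀ a → 𝟙 (C a) * f a ≡ 𝟙 (C a) * g a
  term a with T? (C a)
  ... | no ¬c = trans (cong (_* f a) (if-no ¬c)) (sym (cong (_* g a) (if-no ¬c)))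
  ... | yes c = cong (𝟙 (C a) *_) (e a c)

-- Two distinct selected elements count twice.
hits-unique : ∀ N (B : ℕ → Bool) F {a a′} → a < N → a′ < N → T (B a) → T (B a′) → F a ≡ 1 → F a′ ≡ 1 → hits N B F ≡ 1 → a ≡ a′
hits-unique N B F {a} {a′} a<N a′<N Ba Ba′ Fa Fa′ one with a ≟ a′
... | yes e = e
... | no ne = ⊥-elim (<⇒≱ (s≤s (s≤s z≤n)) (≤-trans (≤-reflexive (sym (cong₂ _+_ (count-≡ N a<N) (count-≡ N a′<N))))
                (≤-trans (≤-reflexive (sym (∑-+ (upTo N) _ _))) (≤-trans (∑-mono (upTo N) le) (≤-reflexive one)))))
  where
  le : ∀ x → 𝟙 (x ≡ᵇ a) + 𝟙 (x ≡ᵇ a′) ≤ 𝟙 (B x) * F x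
  le x with x ≟ a | x ≟ a′
  ... | yes refl | yes refl = ⊥-elim (ne refl)
  ... | yes refl | no n₂    = ≤-reflexive (trans (cong₂ _+_ (if-yes (≡ᵇ-refl x)) (if-no (n₂ ∘ ≡ᵇ⇒≡ x a′))) (sym (cong₂ _*_ (if-yes Ba) Fa)))
  ... | no n₁    | yes refl = ≤-reflexive (trans (cong₂ _+_ (if-no (n₁ ∘ ≡ᵇ⇒≡ x a)) (if-yes (≡ᵇ-refl x))) (sym (cong₂ _*_ (if-yes Ba′) Fa′)))
  ... | no n₁    | no n₂    = ≤-trans (≤-reflexive (cong₂ _+_ (if-no (n₁ ∘ ≡ᵇ⇒≡ x a)) (if-no (n₂ ∘ ≡ᵇ⇒≡ x a′)))) z≤n

hits-selected : ∀ N (C : ℕ → Bool) F → (∀ a → F a ≤ 1) → hits N C F ≡ 1 → ∃ λ a → a < N × T (C a) × F a ≡ 1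
hits-selected N C F F≤1 e with ∑>0 (upTo N) {λ a → 𝟙 (C a) * F a} (≤-reflexive (sym e))
... | a , a∈ , pos with T? (C a)
...   | no ¬c = ⊥-elim (<⇒≢ pos (sym (cong (_* F a) (if-no ¬c))))
...   | yes c = a , ∈-upTo⁻ a∈ , c , ≤-antisym (F≤1 a) (subst (0 <_) (trans (cong (_* F a) (if-yes c)) (*-identityˡ _)) pos)

succeeds : ℕ → (ℕ → Bool) → (ℕ → Bool) → (ℕ → ℕ) → Bool
succeeds N A B F = (hits N A F ≡ᵇ 1) ∧ (hits N B F ≡ᵇ 1)

module Isolation {n : ℕ} (N : ℕ) (A B : Fin n → ℕ → Bool) (A⊆B : ∀ v a → T (A v a) → T (B v a)) where

  Q : ℕ → ℕ → ℕ
  Q a b = ∑ (allFin n) λ v → pairs (A v) (B v) a b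

  ℓ : ℕ → ℕ
  ℓ a = ∑ (allFin n) λ v → 𝟙 (A v a)

  Q-sym : ∀ a b → Q a b ≡ Q b a
  Q-sym a b = ∑-cong (allFin n) λ v → pairs-sym (A v) (B v) a b

  Q-diag : ∀ a → Q a a ≡ 0
  Q-diag a = ∑-zero∈ (allFin n) λ v _ → pairs-diag (A v) (B v) a

  open Quadratic N Q using (I; form)

  hitsA hitsB pairSum : (ℕ → ℕ) → Fin n → ℕ
  hitsA F v = hits N (A v) F
  hitsB F v = hits N (B v) F
  pairSum F v  = ∑ I λ a → ∑ I λ b → pairs (A v) (B v) a b * (F a * F b)

  form≡ : ∀ F → form F F ≡ ∑ (allFin n) (pairSum F)
  form≡ F = begin
    ∑ I (λ a → ∑ I λ b → Q a b * (F a * F b))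
      ≡⟨ ∑-cong I (λ a → trans (∑-cong I λ b → sym (∑-*ʳ (allFin n) (F a * F b) _)) (∑-swap I (allFin n) _)) ⟩
    ∑ I (λ a → ∑ (allFin n) λ v → ∑ I λ b → pairs (A v) (B v) a b * (F a * F b))
      ≡⟨ ∑-swap I (allFin n) _ ⟩
    ∑ (allFin n) (pairSum F) ∎
    where open ≡-Reasoning

  weight≡ : ∀ F → ∑ I (λ a → ℓ a * F a) ≡ ∑ (allFin n) (hitsA F)
  weight≡ F = trans (∑-cong I λ a → sym (∑-*ʳ (allFin n) (F a) _)) (∑-swap I (allFin n) _)

  hitsA≤hitsB : ∀ F v → hitsA F v ≤ hitsB F v
  hitsA≤hitsB F v = ∑-mono I λ a → *-monoˡ-≤ (F a) (𝟙-mono (A⊆B v a))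

  quad-identity : ∀ F v → (∀ a → F a ≤ 1) → pairSum F v + 2 * hitsA F v ≡ 2 * (hitsA F v * hitsB F v)
  quad-identity F v F≤1 = begin
    pairSum F v + 2 * hitsA F v
      ≡⟨ cong (pairSum F v +_) (sym (∑-*ˡ I 2 _)) ⟩
    pairSum F v + ∑ I (λ a → 2 * (𝟙 (A v a) * F a))
      ≡⟨ sym (∑-+ I _ _) ⟩
    ∑ I (λ a → ∑ I (λ b → pairs (A v) (B v) a b * (F a * F b)) + 2 * (𝟙 (A v a) * F a))
      ≡⟨ ∑-cong∈ I (λ a a∈ → row a (∈-upTo⁻ a∈)) ⟩
    ∑ I (λ a → ∑ I λ b → full a b)
      ≡⟨ ∑-cong I (λ a → trans (∑-cong I λ b → e (𝟙 (A v a)) (F a) (𝟙 (B v b)) (F b) (𝟙 (A v b)) (𝟙 (B v a))) (trans (∑-+ I _ _) (cong₂ _+_ (∑-*ˡ I (𝟙 (A v a) * F a) _) (∑-*ˡ I (𝟙 (B v a) * F a) _)))) ⟩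
    ∑ I (λ a → 𝟙 (A v a) * F a * hitsB F v + 𝟙 (B v a) * F a * hitsA F v)
      ≡⟨ trans (∑-+ I _ _) (cong₂ _+_ (∑-*ʳ I (hitsB F v) _) (∑-*ʳ I (hitsA F v) _)) ⟩
    hitsA F v * hitsB F v + hitsB F v * hitsA F v
      ≡⟨ f (hitsA F v) (hitsB F v) ⟩
    2 * (hitsA F v * hitsB F v) ∎
    where
    open ≡-Reasoning
    full : ℕ → ℕ → ℕ
    full a b = (𝟙 (A v a) * 𝟙 (B v b) + 𝟙 (A v b) * 𝟙 (B v a)) * (F a * F b)
    e : ∀ x p y q z w → (x * y + z * w) * (p * q) ≡ x * p * (y * q) + w * p * (z * q)
    e = solve-∀
    f : ∀ x y → x * y + y * x ≡ 2 * (x * y)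
    f = solve-∀
    diag : ∀ a → full a a ≡ 2 * (𝟙 (A v a) * F a)
    diag a with A v a in eq
    ... | false = refl
    ... | true with B v a in eq′
    ...   | false = ⊥-elim (subst T eq′ (A⊆B v a (subst T (sym eq) _)))
    ...   | true with F a | F≤1 a
    ...     | 0 | _ = refl
    ...     | 1 | _ = refl
    ...     | suc (suc _) | s≤s ()
    row : ∀ a → a < N → ∑ I (λ b → pairs (A v) (B v) a b * (F a * F b)) + 2 * (𝟙 (A v a) * F a) ≡ ∑ I (full a)
    row a a<N = begin
      ∑ I (λ b → pairs (A v) (B v) a b * (F a * F b)) + 2 * (𝟙 (A v a) * F a)
        ≡⟨ cong (∑ I (λ b → pairs (A v) (B v) a b * (F a * F b)) +_) (sym (trans (∑-upTo-single N _ a<N λ b _ b≢ → cong (_* full a b) (if-no {b = a ≡ᵇ b} (b≢ ∘ sym ∘ ≡ᵇ⇒≡ a b)))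
             (trans (cong (_* full a a) (if-yes (≡ᵇ-refl a))) (trans (*-identityˡ _) (diag a))))) ⟩
      ∑ I (λ b → pairs (A v) (B v) a b * (F a * F b)) + ∑ I (λ b → 𝟙 (a ≡ᵇ b) * full a b)
        ≡⟨ sym (∑-+ I _ _) ⟩
      ∑ I (λ b → pairs (A v) (B v) a b * (F a * F b) + 𝟙 (a ≡ᵇ b) * full a b)
        ≡⟨ ∑-cong I (λ b → term a b) ⟩
      ∑ I (full a) ∎
      where
      term : ∀ a b → pairs (A v) (B v) a b * (F a * F b) + 𝟙 (a ≡ᵇ b) * full a b ≡ full a b
      term a b with a ≡ᵇ b
      ... | true  = *-identityˡ (full a b)
      ... | false = +-identityʳ (full a b)

  wins : (ℕ → ℕ) → Fin n → Bool
  wins F v = succeeds N (A v) (B v) F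

  private
    isolated : ∀ x y → x ≤ y → 2 * x ≤ 𝟙 ((x ≡ᵇ 1) ∧ (y ≡ᵇ 1)) + x * y
    isolated 0       y       _ = z≤n
    isolated (suc x) 0       ()
    isolated (suc x) 1       (s≤s z≤n) = ≤-refl
    isolated (suc x) (suc (suc y)) _ = ≤-trans (≤-trans (≤-reflexive (*-comm 2 (suc x))) (*-monoʳ-≤ (suc x) (s≤s (s≤s z≤n)))) (m≤n+m _ _)

  wins-bound : ∀ F → (∀ a → F a ≤ 1) → 2 * ∑ (allFin n) (hitsA F) ≤ form F F + 2 * ∑ (allFin n) (λ v → 𝟙 (wins F v))
  wins-bound F F≤1 = +-cancelʳ-≤ (2 * ∑ (allFin n) (hitsA F)) _ _ (begin
    2 * ∑ (allFin n) (hitsA F) + 2 * ∑ (allFin n) (hitsA F)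
      ≡⟨ trans (e₁ (∑ (allFin n) (hitsA F))) (cong (2 *_) (sym (∑-*ˡ (allFin n) 2 _))) ⟩
    2 * ∑ (allFin n) (λ v → 2 * hitsA F v)
      ≤⟨ *-monoʳ-≤ 2 (∑-mono (allFin n) λ v → isolated (hitsA F v) (hitsB F v) (hitsA≤hitsB F v)) ⟩
    2 * ∑ (allFin n) (λ v → 𝟙 (wins F v) + hitsA F v * hitsB F v)
      ≡⟨ trans (cong (2 *_) (∑-+ (allFin n) _ _)) (trans (*-distribˡ-+ 2 (∑ (allFin n) λ v → 𝟙 (wins F v)) _) (cong (2 * ∑ (allFin n) (λ v → 𝟙 (wins F v)) +_) (sym (∑-*ˡ (allFin n) 2 _)))) ⟩
    2 * ∑ (allFin n) (λ v → 𝟙 (wins F v)) + ∑ (allFin n) (λ v → 2 * (hitsA F v * hitsB F v))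
      ≡⟨ cong (2 * ∑ (allFin n) (λ v → 𝟙 (wins F v)) +_) (trans (∑-cong (allFin n) λ v → sym (quad-identity F v F≤1)) (trans (∑-+ (allFin n) _ _) (cong₂ _+_ (sym (form≡ F)) (∑-*ˡ (allFin n) 2 _)))) ⟩
    2 * ∑ (allFin n) (λ v → 𝟙 (wins F v)) + (form F F + 2 * ∑ (allFin n) (hitsA F))
      ≡⟨ e₂ (2 * ∑ (allFin n) (λ v → 𝟙 (wins F v))) (form F F) (2 * ∑ (allFin n) (hitsA F)) ⟩
    form F F + 2 * ∑ (allFin n) (λ v → 𝟙 (wins F v)) + 2 * ∑ (allFin n) (hitsA F) ∎)
    where
    open ≤-Reasoning
    e₁ : ∀ x → 2 * x + 2 * x ≡ 2 * (2 * x)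
    e₁ = solve-∀
    e₂ : ∀ x y z → x + (y + z) ≡ y + x + z
    e₂ = solve-∀

  module Result (ξ m J β₀ : ℕ) (N≤ : N ≤ 2 ^ β₀) (β₀< : β₀ < 2 ^ m) (ω σ : ℕ) where
    open Halvings ξ m J β₀

    σ′ λ′ : ℕ
    σ′ = 2 * 2 ^ J * X ^ J * σ
    λ′ = 2 * 2 ^ J * X ^ J * ω

    open Rounding N N≤ Q Q-sym Q-diag ω σ′ λ′ ℓ public

    module _ (small : 4 * (m * J) ≤ X) (U : Fin n → Bool)
             (scale : ∀ v → T (U v) → 2 * count N (B v) ≤ 2 ^ J × 2 ^ J ≤ 8 * count N (A v))
             (outside : ∀ v → ¬ T (U v) → ∀ a → ¬ T (A v a))
             (F₀ F : ℕ → ℕ) (F₀≤1 : ∀ a → F₀ a ≤ 1) (F≤1 : ∀ a → F a ≤ 1) (B⊆F₀ : ∀ v a → T (B v a) → F₀ a ≡ 1) where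
      open Bounds β₀< small

      private
        P = 2 ^ J

        hits-all : ∀ (C : ℕ → Bool) → (∀ a → T (C a) → F₀ a ≡ 1) → hits N C F₀ ≡ count N C
        hits-all C h = ∑-cong I λ a → term a
          where
          term : ∀ a → 𝟙 (C a) * F₀ a ≡ 𝟙 (C a)
          term a with C a in eq
          ... | false = refl
          ... | true  = trans (+-identityʳ (F₀ a)) (h a (subst T (sym eq) _))

        W₀≥ : P * ∑ (allFin n) (λ v → 𝟙 (U v)) ≤ 8 * ∑ (allFin n) (hitsA F₀)
        W₀≥ = begin
          P * ∑ (allFin n) (λ v → 𝟙 (U v))      ≡⟨ sym (∑-*ˡ (allFin n) P _) ⟩
          ∑ (allFin n) (λ v → P * 𝟙 (U v))      ≤⟨ ∑-mono (allFin n) term ⟩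
          ∑ (allFin n) (λ v → 8 * hitsA F₀ v)   ≡⟨ ∑-*ˡ (allFin n) 8 _ ⟩
          8 * ∑ (allFin n) (hitsA F₀)           ∎
          where
          open ≤-Reasoning
          term : ∀ v → P * 𝟙 (U v) ≤ 8 * hitsA F₀ v
          term v with T? (U v)
          ... | no ¬u = ≤-trans (≤-reflexive (trans (cong (P *_) (if-no ¬u)) (*-zeroʳ P))) z≤n
          ... | yes u = ≤-trans (≤-reflexive (trans (cong (P *_) (if-yes u)) (*-identityʳ P)))
                          (≤-trans (proj₂ (scale v u)) (≤-reflexive (cong (8 *_) (sym (hits-all (A v) λ a t → B⊆F₀ v a (A⊆B v a t))))))

        B₀≤ : form F₀ F₀ ≤ P * ∑ (allFin n) (hitsA F₀)
        B₀≤ = begin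
          form F₀ F₀                               ≡⟨ form≡ F₀ ⟩
          ∑ (allFin n) (pairSum F₀)                   ≤⟨ ∑-mono (allFin n) term ⟩
          ∑ (allFin n) (λ v → P * hitsA F₀ v)      ≡⟨ ∑-*ˡ (allFin n) P _ ⟩
          P * ∑ (allFin n) (hitsA F₀)              ∎
          where
          open ≤-Reasoning
          term : ∀ v → pairSum F₀ v ≤ P * hitsA F₀ v
          term v with T? (U v)
          ... | yes u = begin
            pairSum F₀ v                        ≤⟨ m≤m+n _ _ ⟩
            pairSum F₀ v + 2 * hitsA F₀ v       ≡⟨ quad-identity F₀ v F₀≤1 ⟩
            2 * (hitsA F₀ v * hitsB F₀ v)    ≡⟨ e (hitsA F₀ v) (hitsB F₀ v) ⟩
            2 * hitsB F₀ v * hitsA F₀ v      ≤⟨ *-monoˡ-≤ (hitsA F₀ v) (≤-trans (≤-reflexive (cong (2 *_) (hits-all (B v) (B⊆F₀ v)))) (proj₁ (scale v u))) ⟩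
            P * hitsA F₀ v                   ∎
            where
            e : ∀ x y → 2 * (x * y) ≡ 2 * y * x
            e = solve-∀
          ... | no ¬u = ≤-trans (≤-trans (m≤m+n _ (2 * hitsA F₀ v)) (≤-reflexive (trans (quad-identity F₀ v F₀≤1) (cong (λ z → 2 * (z * hitsB F₀ v)) none)))) z≤n
            where
            none : hitsA F₀ v ≡ 0
            none = ∑-zero∈ I λ a _ → cong (_* F₀ a) (if-no (outside v ¬u a))

      isolation : Potential F₀ J F →
                  24 * P * (σ * size F) + ω * P * ∑ (allFin n) (λ v → 𝟙 (U v)) ≤
                  24 * (σ * size F₀) + 24 * (ω * P) * ∑ (allFin n) (λ v → 𝟙 (wins F v))
      isolation pot =
        arith (form F F) (size F) (∑ (allFin n) (hitsA F)) (form F₀ F₀) (size F₀) (∑ (allFin n) (hitsA F₀))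
          (∑ (allFin n) (λ v → 𝟙 (U v))) (∑ (allFin n) (λ v → 𝟙 (wins F v))) (X ^ J) ((X + m) ^ J) P
          (m^n>0 X J) (m^n>0 2 J) (error-bound small)
          (subst₂ (λ w w₀ → ω * (P * P * 1 * X ^ J) * form F F + P * (σ′ * size F) + λ′ * w₀ ≤ ω * (1 * (X + m) ^ J * 1) * form F₀ F₀ + σ′ * size F₀ + P * (λ′ * w))
            (weight≡ F) (weight≡ F₀) pot′)
          (wins-bound F F≤1) B₀≤ W₀≥
        where
        pot′ : ω * (P * P * 1 * X ^ J) * form F F + P * (σ′ * size F) + λ′ * weight F₀ ≤ ω * (1 * (X + m) ^ J * 1) * form F₀ F₀ + σ′ * size F₀ + P * (λ′ * weight F)
        pot′ = subst (λ e → ω * (P * P * (X + m) ^ e * X ^ J) * form F F + P * (σ′ * size F) + λ′ * weight F₀ ≤ ω * (1 * (X + m) ^ J * 1) * form F₀ F₀ + σ′ * size F₀ + P * (λ′ * weight F)) (n∸n≡0 J) pot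
        arith : ∀ B S W B₀ S₀ W₀ U s x y p → 0 < x → 0 < p → 3 * y ≤ 4 * x →
          ω * (p * p * 1 * x) * B + p * ((2 * p * x * σ) * S) + (2 * p * x * ω) * W₀ ≤ ω * (1 * y * 1) * B₀ + (2 * p * x * σ) * S₀ + p * ((2 * p * x * ω) * W) →
          2 * W ≤ B + 2 * s → B₀ ≤ p * W₀ → p * U ≤ 8 * W₀ →
          24 * p * (σ * S) + ω * p * U ≤ 24 * (σ * S₀) + 24 * (ω * p) * s
        arith B S W B₀ S₀ W₀ U s x@(suc _) y p@(suc _) _ _ hy hp hW hB hU =
          *-cancelˡ-≤ p (+-cancelʳ-≤ (12 * (ω * p * p * B) + 16 * (ω * p * W₀)) _ _ (begin
            p * (24 * p * (σ * S) + ω * p * U) + (12 * (ω * p * p * B) + 16 * (ω * p * W₀))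
              ≡⟨ a₁ p σ S ω U B W₀ ⟩
            24 * p * p * σ * S + 12 * ω * p * p * B + ω * p * (p * U) + 16 * (ω * p * W₀)
              ≤⟨ +-monoˡ-≤ (16 * (ω * p * W₀)) (+-monoʳ-≤ (24 * p * p * σ * S + 12 * ω * p * p * B) (*-monoʳ-≤ (ω * p) hU)) ⟩
            24 * p * p * σ * S + 12 * ω * p * p * B + ω * p * (8 * W₀) + 16 * (ω * p * W₀)
              ≡⟨ a₂ p σ S ω B W₀ ⟩
            4 * (3 * (ω * p * p * B) + 6 * (p * p * σ * S) + 6 * (p * ω * W₀))
              ≤⟨ *-monoʳ-≤ 4 divided ⟩
            4 * (4 * (ω * B₀) + 6 * (p * σ * S₀) + 6 * (p * p * ω * W))
              ≤⟨ *-monoʳ-≤ 4 (+-mono-≤ (+-monoˡ-≤ (6 * (p * σ * S₀)) (*-monoʳ-≤ 4 (*-monoʳ-≤ ω hB)))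
                   (≤-trans (≤-reflexive (a₃ p ω W)) (*-monoʳ-≤ (3 * (p * p * ω)) hW))) ⟩
            4 * (4 * (ω * (p * W₀)) + 6 * (p * σ * S₀) + 3 * (p * p * ω) * (B + 2 * s))
              ≡⟨ a₄ p σ S₀ ω s B W₀ ⟩
            p * (24 * (σ * S₀) + 24 * (ω * p) * s) + (12 * (ω * p * p * B) + 16 * (ω * p * W₀)) ∎))
          where
          open ≤-Reasoning
          a₁ : ∀ p σ S ω U B W₀ → p * (24 * p * (σ * S) + ω * p * U) + (12 * (ω * p * p * B) + 16 * (ω * p * W₀)) ≡ 24 * p * p * σ * S + 12 * ω * p * p * B + ω * p * (p * U) + 16 * (ω * p * W₀)
          a₁ = solve-∀
          a₂ : ∀ p σ S ω B W₀ → 24 * p * p * σ * S + 12 * ω * p * p * B + ω * p * (8 * W₀) + 16 * (ω * p * W₀) ≡ 4 * (3 * (ω * p * p * B) + 6 * (p * p * σ * S) + 6 * (p * ω * W₀))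
          a₂ = solve-∀
          a₃ : ∀ p ω W → 6 * (p * p * ω * W) ≡ 3 * (p * p * ω) * (2 * W)
          a₃ = solve-∀
          a₄ : ∀ p σ S₀ ω s B W₀ → 4 * (4 * (ω * (p * W₀)) + 6 * (p * σ * S₀) + 3 * (p * p * ω) * (B + 2 * s)) ≡ p * (24 * (σ * S₀) + 24 * (ω * p) * s) + (12 * (ω * p * p * B) + 16 * (ω * p * W₀))
          a₄ = solve-∀
          divided : 3 * (ω * p * p * B) + 6 * (p * p * σ * S) + 6 * (p * ω * W₀) ≤ 4 * (ω * B₀) + 6 * (p * σ * S₀) + 6 * (p * p * ω * W)
          divided = *-cancelˡ-≤ x (begin
            x * (3 * (ω * p * p * B) + 6 * (p * p * σ * S) + 6 * (p * ω * W₀))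
              ≡⟨ b₁ x ω p B σ S W₀ ⟩
            3 * (ω * (p * p * 1 * x) * B + p * ((2 * p * x * σ) * S) + (2 * p * x * ω) * W₀)
              ≤⟨ *-monoʳ-≤ 3 hp ⟩
            3 * (ω * (1 * y * 1) * B₀ + (2 * p * x * σ) * S₀ + p * ((2 * p * x * ω) * W))
              ≡⟨ b₂ ω y B₀ p x σ S₀ W ⟩
            ω * B₀ * (3 * y) + 6 * p * x * σ * S₀ + 6 * p * p * x * ω * W
              ≤⟨ +-monoˡ-≤ (6 * p * p * x * ω * W) (+-monoˡ-≤ (6 * p * x * σ * S₀) (*-monoʳ-≤ (ω * B₀) hy)) ⟩
            ω * B₀ * (4 * x) + 6 * p * x * σ * S₀ + 6 * p * p * x * ω * W
              ≡⟨ b₃ ω B₀ x p σ S₀ W ⟩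
            x * (4 * (ω * B₀) + 6 * (p * σ * S₀) + 6 * (p * p * ω * W)) ∎)
            where
            b₁ : ∀ x ω p B σ S W₀ → x * (3 * (ω * p * p * B) + 6 * (p * p * σ * S) + 6 * (p * ω * W₀)) ≡ 3 * (ω * (p * p * 1 * x) * B + p * ((2 * p * x * σ) * S) + (2 * p * x * ω) * W₀)
            b₁ = solve-∀
            b₂ : ∀ ω y B₀ p x σ S₀ W → 3 * (ω * (1 * y * 1) * B₀ + (2 * p * x * σ) * S₀ + p * ((2 * p * x * ω) * W)) ≡ ω * B₀ * (3 * y) + 6 * p * x * σ * S₀ + 6 * p * p * x * ω * W
            b₂ = solve-∀
            b₃ : ∀ ω B₀ x p σ S₀ W → ω * B₀ * (4 * x) + 6 * p * x * σ * S₀ + 6 * p * p * x * ω * W ≡ x * (4 * (ω * B₀) + 6 * (p * σ * S₀) + 6 * (p * p * ω * W))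
            b₃ = solve-∀

-- The distributed isolation procedure

module IsolateProgram (bw N cap t : ℕ) (nbrs : List ℕ) (me : ℕ) (s : ℕ → ℕ) (p : ℕ → Maybe (ℕ × ℕ))
                      (ξ m J β₀ ω σ : ℕ) (A B : ℕ → Bool) where
  open RelayProgram bw N cap t nbrs me s using (aggregate; broadcast)
  open Halvings ξ m J β₀

  recolourRound : (ℕ → ℕ) → ℕ → ℕ × (ℕ → ℕ) → Proc (ℕ × (ℕ → ℕ))
  recolourRound yV i (col , colV) =
    loop X (λ x conf → aggregate p (λ a → ∑ (upTo N) λ b → pairs A B a b * (yV b * 𝟙 (clash ⌈ colourBits i /2⌉ x (colV a) (colV b)))) >>= λ c →
                       done (λ x′ → if x′ ≡ᵇ x then c else conf x′)) (λ _ → 0) >>= λ conf →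
    broadcast (argmin conf X + line ⌈ colourBits i /2⌉ col (argmin conf X) * X) >>= λ colV′ →
    done (argmin conf X + line ⌈ colourBits i /2⌉ col (argmin conf X) * X , colV′)

  decide : ℕ → ℕ → ℕ → ℕ → ℕ → ℕ → ℕ
  decide ℓ r col c y g =
    if (y ≡ᵇ 1) ∧ (col ≡ᵇ c)
    then (if ω * coeff (suc r) (J ∸ suc r) * g + 2 ^ suc r * (2 * 2 ^ J * X ^ J * σ) ≤ᵇ 2 ^ suc r * (2 * 2 ^ J * X ^ J * ω) * ℓ then 2 else 0)
    else y

  classRound : ℕ → ℕ → ℕ → ℕ → ℕ × (ℕ → ℕ) → Proc (ℕ × (ℕ → ℕ))
  classRound ℓ r col c (y , yV) =
    aggregate p (λ a → ∑ (upTo N) λ b → pairs A B a b * yV b) >>= λ g →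
    broadcast (decide ℓ r col c y g) >>= λ yV′ → done (decide ℓ r col c y g , yV′)

  halvingRound : ℕ → ℕ → ℕ × (ℕ → ℕ) → Proc (ℕ × (ℕ → ℕ))
  halvingRound ℓ r (y , yV) =
    loop m (recolourRound yV) (me , λ a → a) >>= λ cols →
    loop classCount (classRound ℓ r (proj₁ cols)) (y , yV) >>= λ yy →
    done (proj₁ yy / 2 , λ a → proj₂ yy a / 2)

  isolate : ℕ → Proc (ℕ × (ℕ → ℕ))
  isolate y₀ =
    aggregate p (λ a → 𝟙 (A a)) >>= λ ℓ →
    broadcast y₀ >>= λ yV →
    loop J (halvingRound ℓ) (y₀ , yV)

nodes≤ : ∀ {n N} (id : Fin n → ℕ) → (∀ v → id v < N) → n ≤ n * N
nodes≤ {zero}  id id<N = z≤n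
nodes≤ {suc n} {N} id id<N = m≤m*n (suc n) N {{>-nonZero (≤-<-trans z≤n (id<N Fin.zero))}}

record Setting (n : ℕ) : Set where
  field
    G          : Graph n
    id         : Fin n → ℕ
    id-inj     : ∀ u v → id u ≡ id v → u ≡ v
    N          : ℕ
    id<N       : ∀ v → id v < N
    bw cap     : ℕ
    N≤cap      : N ≤ cap
    fits       : N * suc cap < 2 ^ bw
    fits′      : 4 * (n * N) < 2 ^ bw
    ξ m β₀ Jmax : ℕ
    N≤         : N ≤ 2 ^ β₀
    β₀<        : β₀ < 2 ^ m
    small      : 4 * (m * Jmax) ≤ suc (2 ^ ξ ∸ 1)
    cap≥       : 2 ^ (β₀ + (4 * ξ + 1)) ≤ cap

  nbrs : Fin n → List ℕ
  nbrs v = map id (neighbours G v)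

  fits-ids : N * suc N < 2 ^ bw
  fits-ids = ≤-<-trans (*-monoʳ-≤ N (s≤s N≤cap)) fits

  small-at : ∀ {J} → J ≤ Jmax → 4 * (m * J) ≤ suc (2 ^ ξ ∸ 1)
  small-at le = ≤-trans (*-monoʳ-≤ 4 (*-monoʳ-≤ m le)) small

isolateRounds : ℕ → ℕ → ℕ → ℕ → ℕ
isolateRounds ξ m J t = t + (t + J * (m * (suc (2 ^ ξ ∸ 1) * t + t) + 2 ^ (4 * ξ + 1) * (t + t)))

module Isolate {n : ℕ} (𝒮 : Setting n) (t : ℕ) (s : Fin n → ℕ → ℕ) (slots : IsSlots (Setting.G 𝒮) (Setting.id 𝒮) t s)
               (p : Fin n → ℕ → Maybe (ℕ × ℕ)) (parents : IsParents (Setting.G 𝒮) (Setting.id 𝒮) t s p)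
               (J ω σ : ℕ) (J≤ : J ≤ Setting.Jmax 𝒮)
               (A B : Fin n → ℕ → Bool) (A⊆B : ∀ v a → T (A v a) → T (B v a)) (B-listed : ∀ v a → T (B v a) → s v a < t)
               (F₀ : ℕ → ℕ) (F₀≤1 : ∀ a → F₀ a ≤ 1) where
  open Setting 𝒮
  open Execution G id bw
  open Relay G id id-inj N id<N bw cap fits t s slots using (total; Spec-aggregate; Spec-broadcast)
  open Isolation N A B A⊆B
  open Result ξ m J β₀ N≤ β₀< ω σ
  open Halvings ξ m J β₀ hiding (module Rounding)
  open Bounds β₀< (small-at J≤)
  open Quadratic N Q using (I)
  open IsSlots slots

  private
    open module Prog v = IsolateProgram bw N cap t (nbrs v) (id v) (s v) (p v) ξ m J β₀ ω σ (A v) (B v)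
           using (recolourRound; decide; classRound; halvingRound)
    open module PRelay v = RelayProgram bw N cap t (nbrs v) (id v) (s v) using (aggregate; broadcast)

  isolate : Fin n → ℕ → Proc (ℕ × (ℕ → ℕ))
  isolate v = IsolateProgram.isolate bw N cap t (nbrs v) (id v) (s v) (p v) ξ m J β₀ ω σ (A v) (B v)

  Represents : (ℕ → ℕ) → (Fin n → ℕ × (ℕ → ℕ)) → Set
  Represents g x = (∀ v → proj₁ (x v) ≡ g (id v)) × (∀ v u → s v (id u) < t → proj₂ (x v) (id u) ≡ g (id u))

  private
    listed : ∀ (x : Fin n → ℕ × (ℕ → ℕ)) g → Represents g x → ∀ v a → T (B v a) → proj₂ (x v) a ≡ g a
    listed x g rep v a b with node v a (B-listed v a b)
    ... | u , refl = proj₂ rep v u (B-listed v (id u) b)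

    pairs-support : ∀ v a b → (T (B v a) → T (B v b) → ⊥) → pairs (A v) (B v) a b ≡ 0
    pairs-support v a b h with a ≡ᵇ b
    ... | true = refl
    ... | false with A v a in Aa | B v b in Bb | A v b in Ab | B v a in Ba
    ...   | true  | true  | _     | true  = ⊥-elim (h _ _)
    ...   | true  | true  | _     | false = ⊥-elim (subst T Ba (A⊆B v a (subst T (sym Aa) _)))
    ...   | true  | false | true  | _     = ⊥-elim (subst T Bb (A⊆B v b (subst T (sym Ab) _)))
    ...   | true  | false | false | _     = refl
    ...   | false | _     | false | _     = refl
    ...   | false | true  | true  | true  = ⊥-elim (h _ _)
    ...   | false | _     | true  | false = refl
    ...   | false | false | true  | true  = ⊥-elim (subst T Bb (A⊆B v b (subst T (sym Ab) _)))

    total-pairs : (k : Fin n → ℕ → ℕ → ℕ) (g : ℕ → ℕ → ℕ) → (∀ v a b → T (B v a) → T (B v b) → k v a b ≡ g a b) →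
                  ∀ a → total p parents (λ v a → ∑ I λ b → pairs (A v) (B v) a b * k v a b) a ≡ ∑ I (λ b → Q a b * g a b)
    total-pairs k g e a = begin
      ∑ (allFin n) (λ v → 𝟙 (s v a <ᵇ t) * ∑ I λ b → pairs (A v) (B v) a b * k v a b)
        ≡⟨ ∑-cong (allFin n) (λ v → row v) ⟩
      ∑ (allFin n) (λ v → ∑ I λ b → pairs (A v) (B v) a b * g a b)
        ≡⟨ ∑-swap (allFin n) I _ ⟩
      ∑ I (λ b → ∑ (allFin n) λ v → pairs (A v) (B v) a b * g a b)
        ≡⟨ ∑-cong I (λ b → ∑-*ʳ (allFin n) (g a b) _) ⟩
      ∑ I (λ b → Q a b * g a b) ∎
      where
      open ≡-Reasoning
      row : ∀ v → 𝟙 (s v a <ᵇ t) * ∑ I (λ b → pairs (A v) (B v) a b * k v a b) ≡ ∑ I λ b → pairs (A v) (B v) a b * g a b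
      row v with T? (B v a)
      ... | yes Ba = trans (cong (_* _) (if-yes (<⇒<ᵇ (B-listed v a Ba)))) (trans (*-identityˡ _) (∑-cong I λ b → term b))
        where
        term : ∀ b → pairs (A v) (B v) a b * k v a b ≡ pairs (A v) (B v) a b * g a b
        term b with T? (B v b)
        ... | yes Bb = cong (pairs (A v) (B v) a b *_) (e v a b Ba Bb)
        ... | no ¬Bb rewrite pairs-support v a b (λ _ → ¬Bb) = refl
      ... | no ¬Ba = trans (cong (𝟙 (s v a <ᵇ t) *_) (zeros (λ b → k v a b))) (trans (*-zeroʳ (𝟙 (s v a <ᵇ t))) (sym (zeros (g a))))
        where
        zeros : ∀ f → ∑ I (λ b → pairs (A v) (B v) a b * f b) ≡ 0
        zeros f = ∑-zero∈ I λ b _ → cong (_* f b) (pairs-support v a b λ Ba _ → ¬Ba Ba)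

    sum-bound : (g : ℕ → ℕ → ℕ) → (∀ a b → g a b ≤ 2) → ∀ a → ∑ I (λ b → Q a b * g a b) < 2 ^ bw
    sum-bound g g≤ a = begin-strict
      ∑ I (λ b → Q a b * g a b)      ≤⟨ ∑-mono I (λ b → *-mono-≤ Q≤ (g≤ a b)) ⟩
      ∑ I (λ _ → n * 2 * 2)          ≡⟨ trans (∑-const I (n * 2 * 2)) (cong (_* (n * 2 * 2)) (length-upTo N)) ⟩
      N * (n * 2 * 2)                ≡⟨ e N n ⟩
      4 * (n * N)                    <⟨ fits′ ⟩
      2 ^ bw                         ∎
      where
      open ≤-Reasoning
      e : ∀ N n → N * (n * 2 * 2) ≡ 4 * (n * N)
      e = solve-∀
      Q≤ : ∀ {b} → Q a b ≤ n * 2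
      Q≤ {b} = ≤-trans (∑-mono (allFin n) λ v → pairs≤2 (A v) (B v) a b) (≤-reflexive (trans (∑-const (allFin n) 2) (cong (_* 2) (length-allFin n))))

    Spec-total : (k : Fin n → ℕ → ℕ → ℕ) (g : ℕ → ℕ → ℕ) → (∀ v a b → T (B v a) → T (B v b) → k v a b ≡ g a b) →
                 (∀ a b → g a b ≤ 2) →
                 Spec t (λ v → aggregate v (p v) (λ a → ∑ I λ b → pairs (A v) (B v) a b * k v a b)) (λ y → ∀ u → y u ≡ ∑ I (λ b → Q (id u) b * g (id u) b))
    Spec-total k g e g≤ = Spec-weaken ≤-refl (λ y h u → trans (h u) (total-pairs k g e (id u)))
      (Spec-aggregate p parents _ λ a → subst (_< 2 ^ bw) (sym (total-pairs k g e a)) (sum-bound g g≤ a))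

    Spec-publish : (y : Fin n → ℕ) (g : ℕ → ℕ) → (∀ u → y u ≡ g (id u)) → (∀ u → y u ≤ cap) →
                   Spec t (λ v → broadcast v (y v) >>= λ yV → done (y v , yV)) (Represents g)
    Spec-publish y g e y≤ = Spec-map (λ v yV → y v , yV) (Spec-broadcast y y≤) λ yV h → e , λ v u lt → trans (h v u lt) (e u)

    2≤cap : 2 ≤ cap
    2≤cap = ≤-trans (^-monoʳ-≤ 2 {1} (≤-trans (m≤n+m 1 (4 * ξ)) (m≤n+m _ β₀))) cap≥

    module Halving (ℓv : Fin n → ℕ) (ℓ≡ : ∀ v → ℓv v ≡ ℓ (id v)) (r : ℕ) (F : ℕ → ℕ) (F≤1 : ∀ a → F a ≤ 1)
                   (x′ : Fin n → ℕ × (ℕ → ℕ)) (rep : Represents F x′) where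

      yV : Fin n → ℕ → ℕ
      yV v = proj₂ (x′ v)

      Spec-recolour : ∀ i cols → Represents (colours F i) cols →
                      Spec (X * t + t) (λ v → recolourRound v (yV v) i (cols v)) (Represents (colours F (suc i)))
      Spec-recolour i cols crep = Spec-bind (Spec-loop Known X (λ _ _ ()) body) λ conf known → finish conf known
        where
        h = ⌈ colourBits i /2⌉
        module R = Quadratic.Recolour N Q h X′ F (colours F i)

        Known : ℕ → (Fin n → ℕ → ℕ) → Set
        Known j conf = ∀ v x → x < j → conf v x ≡ R.conflicts (id v) x

        body : ∀ x conf → x < X → Known x conf → Spec t _ (Known (suc x))
        body x conf _ known = Spec-map (λ v c x′ → if x′ ≡ᵇ x then c else conf v x′)
          (Spec-total (λ v a b → yV v b * 𝟙 (clash h x (proj₂ (cols v) a) (proj₂ (cols v) b)))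
            (λ a b → F b * 𝟙 (clash h x (colours F i a) (colours F i b)))
            (λ v a b Ba Bb → cong₂ (λ z w → z * 𝟙 w) (listed x′ F rep v b Bb) (cong₂ (clash h x) (listed cols (colours F i) crep v a Ba) (listed cols (colours F i) crep v b Bb)))
            λ a b → ≤-trans (*-mono-≤ (F≤1 b) (𝟙≤1 (clash h x (colours F i a) (colours F i b)))) (s≤s z≤n))
          step
          where
          step : (c : Fin n → ℕ) → (∀ u → c u ≡ R.conflicts (id u) x) → Known (suc x) (λ v x′ → if x′ ≡ᵇ x then c v else conf v x′)
          step c e v x′ (s≤s le) with x′ ≡ᵇ x in eq
          ... | true with ≡ᵇ⇒≡ x′ x (subst T (sym eq) _)
          ...   | refl = e v
          step c e v x′ (s≤s le) | false = known v x′ (≤∧≢⇒< le λ { refl → subst T eq (≡ᵇ-refl x) })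

        finish : ∀ conf → Known X conf → Spec t _ (Represents (colours F (suc i)))
        finish conf known = Spec-publish new (colours F (suc i)) new≡ λ u →
          ≤-trans (≤-reflexive (new≡ u)) (≤-trans (<⇒≤ (colours< F (suc i) (id u) (id<N u))) (≤-trans (^-monoʳ-≤ 2 (colourBits≤ (suc i))) cap≥))
          where
          new : Fin n → ℕ
          new v = argmin (conf v) X + line h (proj₁ (cols v)) (argmin (conf v) X) * X
          new≡ : ∀ v → new v ≡ colours F (suc i) (id v)
          new≡ v = cong₂ (λ z c → z + line h c z * X) (argmin-cong X (known v)) (proj₁ crep v)

      module _ (cols : Fin n → ℕ × (ℕ → ℕ)) (crep : Represents (colours F m) cols) where
        open Seq r F using (classes; class; halved)

        Spec-class : ∀ c y → Represents (classes c) y →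
                     Spec (t + t) (λ v → classRound v (ℓv v) r (proj₁ (cols v)) c (y v)) (Represents (classes (suc c)))
        Spec-class c y yrep = Spec-bind
          (Spec-total (λ v a b → proj₂ (y v) b) (λ a b → classes c b) (λ v a b _ Bb → listed y (classes c) yrep v b Bb) (λ _ b → classes≤2 c b))
          λ g g≡ → Spec-publish (λ v → decide v (ℓv v) r (proj₁ (cols v)) c (proj₁ (y v)) (g v)) (classes (suc c)) (new≡ g g≡)
                     λ u → ≤-trans (≤-reflexive (new≡ g g≡ u)) (≤-trans (classes≤2 (suc c) (id u)) 2≤cap)
          where
          classes≤2 : ∀ c a → classes c a ≤ 2
          classes≤2 zero    a = m≤n⇒m≤1+n (F≤1 a)
          classes≤2 (suc c) a with Seq.chosen r F c (classes c) a
          ... | false = classes≤2 c a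
          ... | true with Seq.keep r F c (classes c) a
          ...   | true  = ≤-refl
          ...   | false = z≤n
          new≡ : (g : Fin n → ℕ) → (∀ u → g u ≡ ∑ I (λ b → Q (id u) b * classes c b)) → ∀ v →
                 decide v (ℓv v) r (proj₁ (cols v)) c (proj₁ (y v)) (g v) ≡ classes (suc c) (id v)
          new≡ g g≡ v rewrite ℓ≡ v | proj₁ crep v | proj₁ yrep v | g≡ v = refl

        Spec-classes : Spec (classCount * (t + t)) (λ v → loop classCount (classRound v (ℓv v) r (proj₁ (cols v))) (x′ v)) (Represents (classes classCount))
        Spec-classes = Spec-loop (λ c → Represents (classes c)) classCount rep λ c y _ → Spec-class c y

      Spec-halving : Spec (m * (X * t + t) + classCount * (t + t)) (λ v → halvingRound v (ℓv v) r (x′ v)) (Represents (halve r F))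
      Spec-halving = Spec-bind (Spec-loop (λ i → Represents (colours F i)) m ((λ _ → refl) , λ _ _ _ → refl) λ i cols _ → Spec-recolour i cols)
        λ cols crep → Spec-map (λ v yy → proj₁ yy / 2 , λ a → proj₂ yy a / 2) (Spec-classes cols crep)
          λ yy yrep → (λ v → cong (_/ 2) (proj₁ yrep v)) , λ v u lt → cong (_/ 2) (proj₂ yrep v u lt)

  Selected : (Fin n → ℕ × (ℕ → ℕ)) → (ℕ → ℕ) → Set
  Selected x F = Represents F x × (∀ a → F a ≤ 1) × (∀ a → a < N → F a ≤ F₀ a) × Potential F₀ J F

  Spec-isolate : (y₀ : Fin n → ℕ) → (∀ v → y₀ v ≡ F₀ (id v)) →
                 Spec (isolateRounds ξ m J t) (λ v → isolate v (y₀ v)) (λ x → Σ (ℕ → ℕ) (Selected x))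
  Spec-isolate y₀ y₀≡ = Spec-bind weights λ ℓv ℓ≡ → Spec-bind (Spec-broadcast y₀ λ u → ≤-trans (≤-reflexive (y₀≡ u)) (≤-trans (F₀≤1 (id u)) (≤-trans (s≤s z≤n) 2≤cap)))
    λ yV yV≡ → Spec-weaken ≤-refl (λ x inv → inv)
      (Spec-loop Inv J (F₀ , (y₀≡ , λ v u lt → trans (yV≡ v u lt) (y₀≡ u)) , F₀≤1 , (λ _ _ → ≤-refl) , potential-start F₀) (body ℓv ℓ≡))
    where
    weights : Spec t (λ v → aggregate v (p v) (λ a → 𝟙 (A v a))) (λ y → ∀ u → y u ≡ ℓ (id u))
    weights = Spec-weaken ≤-refl (λ y h u → trans (h u) (total≡ (id u))) (Spec-aggregate p parents (λ v a → 𝟙 (A v a)) λ a → begin-strict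
        total p parents (λ v a → 𝟙 (A v a)) a     ≡⟨ total≡ a ⟩
        ℓ a                                       ≤⟨ ≤-trans (∑-mono (allFin n) λ v → 𝟙≤1 (A v a)) (≤-reflexive (trans (∑-const (allFin n) 1) (trans (*-identityʳ _) (length-allFin n)))) ⟩
        n                                         ≤⟨ ≤-trans (nodes≤ id id<N) (m≤m+n _ _) ⟩
        4 * (n * N)                               <⟨ fits′ ⟩
        2 ^ bw                                    ∎)
      where
      open ≤-Reasoning
      total≡ : ∀ a → total p parents (λ v a → 𝟙 (A v a)) a ≡ ℓ a
      total≡ a = ∑-cong (allFin n) term
        where
        term : ∀ v → 𝟙 (s v a <ᵇ t) * 𝟙 (A v a) ≡ 𝟙 (A v a)
        term v with A v a in eq
        ... | false = *-zeroʳ (𝟙 (s v a <ᵇ t))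
        ... | true  = trans (*-identityʳ _) (if-yes (<⇒<ᵇ (B-listed v a (A⊆B v a (subst T (sym eq) _)))))

    Inv : ℕ → (Fin n → ℕ × (ℕ → ℕ)) → Set
    Inv r x = Σ (ℕ → ℕ) λ F → Represents F x × (∀ a → F a ≤ 1) × (∀ a → a < N → F a ≤ F₀ a) × Potential F₀ r F

    body : (ℓv : Fin n → ℕ) → (∀ v → ℓv v ≡ ℓ (id v)) → ∀ r x → r < J → Inv r x →
           Spec (m * (X * t + t) + classCount * (t + t)) (λ v → halvingRound v (ℓv v) r (x v)) (Inv (suc r))
    body ℓv ℓ≡ r x r<J (F , rep , F≤1 , F≤F₀ , pot) =
      Spec-weaken ≤-refl (λ y yrep → halve r F , yrep , halve≤1 r F F≤1 , (λ a a< → ≤-trans (halve≤ r F F≤1 a a<) (F≤F₀ a a<)) , potential-step F₀ r F r<J F≤1 pot)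
        (Halving.Spec-halving ℓv ℓ≡ r F F≤1 x rep)

-- Functions on nodes as functions on identifiers

module IdSums {n : ℕ} (id : Fin n → ℕ) (id-inj : ∀ u v → id u ≡ id v → u ≡ v) (N : ℕ) (id<N : ∀ v → id v < N) where

  lift : (Fin n → ℕ) → ℕ → ℕ
  lift f a = ∑ (allFin n) λ u → 𝟙 (id u ≡ᵇ a) * f u

  lift-id : ∀ f u → lift f (id u) ≡ f u
  lift-id f u = trans (∑-allFin-single u _ λ v v≢u → cong (_* f v) (if-no (v≢u ∘ id-inj v u ∘ ≡ᵇ⇒≡ _ _)))
                  (trans (cong (_* f u) (if-yes (≡ᵇ-refl (id u)))) (*-identityˡ (f u)))

  lift-≤ : ∀ f c → (∀ u → f u ≤ c) → ∀ a → lift f a ≤ c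
  lift-≤ f c h a with findᵇ (λ u → id u ≡ᵇ a) (allFin n) in eq
  ... | just u with ≡ᵇ⇒≡ (id u) a (proj₂ (findᵇ-sound (λ u → id u ≡ᵇ a) (allFin n) eq))
  ...   | refl = ≤-trans (≤-reflexive (lift-id f u)) (h u)
  lift-≤ f c h a | nothing = ≤-trans (≤-reflexive (∑-zero∈ (allFin n) λ u u∈ → cong (_* f u) (if-no (findᵇ-none (λ u → id u ≡ᵇ a) (allFin n) eq u∈)))) z≤n

  sum-lift : ∀ f → ∑ (upTo N) (lift f) ≡ ∑ (allFin n) f
  sum-lift f = trans (∑-swap (upTo N) (allFin n) _) (∑-cong (allFin n) λ u →
    trans (∑-*ʳ (upTo N) (f u) _) (trans (cong (_* f u) (one u)) (*-identityˡ (f u))))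
    where
    one : ∀ u → ∑ (upTo N) (λ a → 𝟙 (id u ≡ᵇ a)) ≡ 1
    one u = trans (∑-cong (upTo N) λ a → 𝟙-cong {id u ≡ᵇ a} {a ≡ᵇ id u} (≡⇒≡ᵇ a (id u) ∘ sym ∘ ≡ᵇ⇒≡ (id u) a) (≡⇒≡ᵇ (id u) a ∘ sym ∘ ≡ᵇ⇒≡ a (id u))) (count-≡ N (id<N u))

  sum-restrict : ∀ (F : ℕ → ℕ) → ∑ (allFin n) (F ∘ id) ≤ ∑ (upTo N) F
  sum-restrict F = ≤-trans (≤-reflexive (sym (sum-lift (F ∘ id)))) (∑-mono (upTo N) le)
    where
    le : ∀ a → lift (F ∘ id) a ≤ F a
    le a with findᵇ (λ u → id u ≡ᵇ a) (allFin n) in eq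
    ... | just u with ≡ᵇ⇒≡ (id u) a (proj₂ (findᵇ-sound (λ u → id u ≡ᵇ a) (allFin n) eq))
    ...   | refl = ≤-reflexive (lift-id (F ∘ id) u)
    le a | nothing = ≤-trans (≤-reflexive (∑-zero∈ (allFin n) λ u u∈ → cong (_* F (id u)) (if-no (findᵇ-none (λ u → id u ≡ᵇ a) (allFin n) eq u∈)))) z≤n

∣_∣ᵛ : ∀ {n} → (Fin n → Bool) → ℕ
∣_∣ᵛ {n} S = ∑ (allFin n) (𝟙 ∘ S)

-- One phase of the first stage: a sparse set hitting the lists of Λ nearest centres of almost all nodes

module PhaseProgram (bw N cap : ℕ) (nbrs : List ℕ) (me : ℕ) (ξ m β₀ Hc J′ R b y i : ℕ) where
  J Λ t : ℕ
  J = suc J′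
  Λ = 2 ^ J′
  t = Hc + Λ

  coverWeight sizeWeight : ℕ → ℕ
  coverWeight r = 1152 * 48 ^ (b + r)
  sizeWeight r  = 47 ^ (b + r) * 2 ^ (y * i) * 2 ^ J

  round : Bool → (ℕ → ℕ) → (ℕ → Maybe (ℕ × ℕ)) → ℕ → Bool × Bool → Proc (Bool × Bool)
  round inQ s p r (q , u) =
    IsolateProgram.isolate bw N cap t nbrs me s p ξ m J β₀ (coverWeight r) (sizeWeight r) A A (𝟙 inQ) >>= λ yy →
    done (q ∨ (proj₁ yy ≡ᵇ 1) , u ∧ not (succeeds N A A (proj₂ yy)))
    where
    A : ℕ → Bool
    A a = u ∧ (s a <ᵇ t)

  phase : Bool → Bool → Proc Bool
  phase inQ inS =
    DetectProgram.detect bw N Hc Λ nbrs me (if inQ then 0 else Hc) >>= λ ds →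
    RelayProgram.setup bw N cap t nbrs me (proj₂ ds) >>= λ p →
    loop R (round inQ (proj₂ ds) p) (false , inS ∧ (Λ ≤ᵇ count N λ a → proj₂ ds a <ᵇ t)) >>= λ qu →
    done (proj₁ qu)

-- The weights balance the size of the selected set against the number of nodes that are hit.
round-sizes : ∀ n a d q P sF s₀ u u′ w → 0 < a → 0 < P →
  24 * P * (a * q * P * sF) + 1152 * d * P * u ≤ 24 * (a * q * P * s₀) + 24 * (1152 * d * P) * w →
  s₀ * q ≤ n → u * d ≤ n * a → u′ + w ≤ u →
  u′ * (48 * d) ≤ n * (47 * a) × sF * (q * P) ≤ 1153 * n
round-sizes n a@(suc _) d q P@(suc _) sF s₀ u u′ w _ _ h hs hu hw = first , second
  where
  open ≤-Reasoning
  base : a * q * P * sF + 48 * d * u ≤ a * n + 1152 * d * w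
  base = *-cancelˡ-≤ (24 * P) (begin
    24 * P * (a * q * P * sF + 48 * d * u)                 ≡⟨ c₁ P (a * q * P * sF) d u ⟩
    24 * P * (a * q * P * sF) + 1152 * d * P * u           ≤⟨ h ⟩
    24 * (a * q * P * s₀) + 24 * (1152 * d * P) * w        ≡⟨ c₂ a q P s₀ d w ⟩
    24 * P * (a * (s₀ * q)) + 24 * P * (1152 * d * w)      ≤⟨ +-monoˡ-≤ _ (*-monoʳ-≤ (24 * P) (*-monoʳ-≤ a hs)) ⟩
    24 * P * (a * n) + 24 * P * (1152 * d * w)             ≡⟨ sym (*-distribˡ-+ (24 * P) (a * n) _) ⟩
    24 * P * (a * n + 1152 * d * w)                        ∎)
    where
    c₁ : ∀ P x d u → 24 * P * (x + 48 * d * u) ≡ 24 * P * x + 1152 * d * P * u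
    c₁ = solve-∀
    c₂ : ∀ a q P s d w → 24 * (a * q * P * s) + 24 * (1152 * d * P) * w ≡ 24 * P * (a * (s * q)) + 24 * P * (1152 * d * w)
    c₂ = solve-∀
  du : d * u ≤ a * n
  du = ≤-trans (≤-reflexive (*-comm d u)) (≤-trans hu (≤-reflexive (*-comm n a)))
  first : u′ * (48 * d) ≤ n * (47 * a)
  first = *-cancelˡ-≤ 24 (+-cancelʳ-≤ (1152 * (d * w) + 48 * (d * u)) _ _ (begin
    24 * (u′ * (48 * d)) + (1152 * (d * w) + 48 * (d * u))       ≡⟨ c₃ u′ d w u ⟩
    1152 * d * (u′ + w) + 48 * d * u                              ≤⟨ +-mono-≤ (*-monoʳ-≤ (1152 * d) hw) (≤-trans (m≤n+m _ (a * q * P * sF)) base) ⟩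
    1152 * d * u + (a * n + 1152 * d * w)                         ≡⟨ c₄ d u (a * n) w ⟩
    1104 * (d * u) + a * n + (1152 * (d * w) + 48 * (d * u))      ≤⟨ +-monoˡ-≤ _ (+-monoˡ-≤ (a * n) (*-monoʳ-≤ 1104 du)) ⟩
    1104 * (a * n) + a * n + (1152 * (d * w) + 48 * (d * u))      ≤⟨ +-monoˡ-≤ (1152 * (d * w) + 48 * (d * u)) (m≤m+n (1104 * (a * n) + a * n) (23 * (a * n))) ⟩
    1104 * (a * n) + a * n + 23 * (a * n) + (1152 * (d * w) + 48 * (d * u)) ≡⟨ cong (_+ (1152 * (d * w) + 48 * (d * u))) (c₅ a n) ⟩
    24 * (n * (47 * a)) + (1152 * (d * w) + 48 * (d * u))         ∎))
    where
    c₃ : ∀ u′ d w u → 24 * (u′ * (48 * d)) + (1152 * (d * w) + 48 * (d * u)) ≡ 1152 * d * (u′ + w) + 48 * d * u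
    c₃ = solve-∀
    c₄ : ∀ d u x w → 1152 * d * u + (x + 1152 * d * w) ≡ 1104 * (d * u) + x + (1152 * (d * w) + 48 * (d * u))
    c₄ = solve-∀
    c₅ : ∀ a n → 1104 * (a * n) + a * n + 23 * (a * n) ≡ 24 * (n * (47 * a))
    c₅ = solve-∀
  second : sF * (q * P) ≤ 1153 * n
  second = *-cancelˡ-≤ a (begin
    a * (sF * (q * P))               ≡⟨ c₆ a sF q P ⟩
    a * q * P * sF                   ≤⟨ ≤-trans (m≤m+n _ (48 * d * u)) base ⟩
    a * n + 1152 * d * w             ≤⟨ +-monoʳ-≤ (a * n) (*-monoʳ-≤ (1152 * d) (≤-trans (m≤n+m w u′) hw)) ⟩
    a * n + 1152 * d * u             ≡⟨ cong (a * n +_) (*-assoc 1152 d u) ⟩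
    a * n + 1152 * (d * u)           ≤⟨ +-monoʳ-≤ (a * n) (*-monoʳ-≤ 1152 du) ⟩
    a * n + 1152 * (a * n)           ≡⟨ c₇ a n ⟩
    a * (1153 * n)                   ∎)
    where
    c₆ : ∀ a s q P → a * (s * (q * P)) ≡ a * q * P * s
    c₆ = solve-∀
    c₇ : ∀ a n → a * n + 1152 * (a * n) ≡ a * (1153 * n)
    c₇ = solve-∀

Unbeaten : ∀ {n} → Setting n → (Hc Λ : ℕ) → (Fin n → Bool) → (Fin n → Bool) → Fin n → Set
Unbeaten 𝒮 Hc Λ Q Q′ v = (X : ℕ → Bool) →
  (∀ a → a < N → T (X a) → ∃ λ u → ∃ λ r → id u ≡ a × T (Q u) × r < Hc × Within G r v u × (∀ u′ → T (Q′ u′) → ¬ Within G r v u′)) →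
  count N X ≤ Λ
  where open Setting 𝒮

module Phase {n : ℕ} (𝒮 : Setting n) (Hc J′ R b y i : ℕ) (J≤ : suc J′ ≤ Setting.Jmax 𝒮) where
  open Setting 𝒮
  open Execution G id bw
  open Walks G
  open IdSums id id-inj N id<N
  open Rank N

  centre : (Fin n → Bool) → Fin n → ℕ
  centre Q v = if Q v then 0 else Hc

  open module Prog v = PhaseProgram bw N cap (nbrs v) (id v) ξ m β₀ Hc J′ R b y i using (phase; round)
  open PhaseProgram bw N cap [] 0 ξ m β₀ Hc J′ R b y i using (J; Λ; t; coverWeight; sizeWeight)

  PhaseResult : (Q S Q′ : Fin n → Bool) → Set
  PhaseResult Q S Q′ = (∀ v → T (Q′ v) → T (Q v)) × ∣ Q′ ∣ᵛ * (2 ^ (y * i) * 2 ^ J) ≤ R * (1153 * n) ×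
    (Σ (Fin n → Bool) λ Z → ∣ Z ∣ᵛ * 48 ^ (b + R) ≤ n * 47 ^ (b + R) × (∀ v → T (S v) → ¬ T (Z v) → Unbeaten 𝒮 Hc Λ Q Q′ v))

  module _ (Q S : Fin n → Bool) (Q-small : ∣ Q ∣ᵛ * 2 ^ (y * i) ≤ n) (S-small : ∣ S ∣ᵛ * 48 ^ b ≤ n * 47 ^ b) where
    open Distance G id id-inj Hc (centre Q)
    open Top Hc Λ
    open DetectProgram bw N Hc Λ [] using (slot)

    slot<⇒top : ∀ v a → slot (E v) a < t → T (top (E v) a)
    slot<⇒top v a lt with top (E v) a
    ... | true  = _
    ... | false = <-irrefl refl lt

    top⇒slot< : ∀ v a → T (top (E v) a) → slot (E v) a < t
    top⇒slot< v a tp = subst (_< t) (sym (if-yes tp)) (+-mono-< (proj₁ (top-elim (E v) {a} tp)) (proj₂ (top-elim (E v) {a} tp)))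

    E<Hc⇒Q : ∀ v u → E v (id u) < Hc → T (Q u)
    E<Hc⇒Q v u lt with Q u | proj₁ (E-walk v u lt)
    ... | true  | _  = _
    ... | false | le = ⊥-elim (<⇒≱ lt le)

    module Main (s : Fin n → ℕ → ℕ) (s≡ : ∀ v a → s v a ≡ slot (E v) a) where
      slots : IsSlots G id t s
      slots = IsSlots-cong s≡ (Detect.E-slots G id id-inj N id<N bw fits-ids Hc Λ (centre Q))

      open IsSlots slots using (node)

      listed : Fin n → ℕ → Bool
      listed v a = s v a <ᵇ t

      listed⇒top : ∀ v a → T (listed v a) → T (top (E v) a)
      listed⇒top v a l = slot<⇒top v a (subst (_< t) (s≡ v a) (<ᵇ⇒< _ _ l))

      top⇒listed : ∀ v a → T (top (E v) a) → T (listed v a)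
      top⇒listed v a tp = <⇒<ᵇ (subst (_< t) (sym (s≡ v a)) (top⇒slot< v a tp))

      count-listed : ∀ v → count N (listed v) ≡ count N (top (E v))
      count-listed v = count-cong N (λ a _ → listed⇒top v a) (λ a _ → top⇒listed v a)

      big : Fin n → Bool
      big v = Λ ≤ᵇ count N (listed v)

      F₀ : ℕ → ℕ
      F₀ = lift (𝟙 ∘ Q)

      listed⇒F₀ : ∀ v a → T (listed v a) → F₀ a ≡ 1
      listed⇒F₀ v a l with node v a (<ᵇ⇒< _ _ l)
      ... | u , refl = trans (lift-id (𝟙 ∘ Q) u) (if-yes (E<Hc⇒Q v u (proj₁ (top-elim (E v) (listed⇒top v (id u) l)))))

      record Inv (r : ℕ) (st : Fin n → Bool × Bool) : Set where
        Q′ : Fin n → Bool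
        Q′ = proj₁ ∘ st
        U : Fin n → Bool
        U = proj₂ ∘ st
        field
          U-big   : ∀ v → T (U v) → T (big v)
          U-small : ∣ U ∣ᵛ * 48 ^ (b + r) ≤ n * 47 ^ (b + r)
          Q′⊆Q    : ∀ v → T (Q′ v) → T (Q v)
          Q′-size : ∣ Q′ ∣ᵛ * (2 ^ (y * i) * 2 ^ J) ≤ r * (1153 * n)
          hit     : ∀ v → T (S v) → T (big v) → ¬ T (U v) → ∃ λ u → T (Q′ u) × T (listed v (id u))

      module Round (r : ℕ) (st : Fin n → Bool × Bool) (inv : Inv r st) where
        open Inv inv

        A : Fin n → ℕ → Bool
        A v a = U v ∧ listed v a

        A-listed : ∀ v a → T (A v a) → s v a < t
        A-listed v a x = <ᵇ⇒< (s v a) t (proj₂ (∧-elim {U v} x))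

        wins : (ℕ → ℕ) → Fin n → Bool
        wins F v = succeeds N (A v) (A v) F

        Balance : (ℕ → ℕ) → Set
        Balance F = 24 * 2 ^ J * (sizeWeight r * ∑ (upTo N) F) + coverWeight r * 2 ^ J * ∣ U ∣ᵛ ≤
                    24 * (sizeWeight r * ∑ (upTo N) F₀) + 24 * (coverWeight r * 2 ^ J) * ∑ (allFin n) (λ v → 𝟙 (wins F v))

        module Outcome (F : ℕ → ℕ) (F≤1 : ∀ a → F a ≤ 1) (F≤F₀ : ∀ a → a < N → F a ≤ F₀ a) (yy : Fin n → ℕ × (ℕ → ℕ))
                       (y≡ : ∀ v → proj₁ (yy v) ≡ F (id v)) (view≡ : ∀ v a → T (A v a) → proj₂ (yy v) a ≡ F a) where

          new : Fin n → Bool × Bool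
          new v = proj₁ (st v) ∨ (proj₁ (yy v) ≡ᵇ 1) , proj₂ (st v) ∧ not (succeeds N (A v) (A v) (proj₂ (yy v)))

          wins≡ : ∀ v → succeeds N (A v) (A v) (proj₂ (yy v)) ≡ wins F v
          wins≡ v = cong (λ h → (h ≡ᵇ 1) ∧ (h ≡ᵇ 1)) (hits-cong N (A v) (view≡ v))

          win-hit : ∀ v → T (wins F v) → ∃ λ u → T (U v) × T (listed v (id u)) × F (id u) ≡ 1
          win-hit v w =
            let (a , _ , x , Fa) = hits-selected N (A v) F F≤1 (≡ᵇ⇒≡ _ 1 (proj₁ (∧-elim {hits N (A v) F ≡ᵇ 1} w)))
                (u , e) = node v a (A-listed v a x)
            in u , proj₁ (∧-elim {U v} x) , subst (T ∘ listed v) (sym e) (proj₂ (∧-elim {U v} x)) , trans (cong F e) Fa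

          Usize : ∣ proj₂ ∘ new ∣ᵛ + ∑ (allFin n) (λ v → 𝟙 (wins F v)) ≤ ∣ U ∣ᵛ
          Usize = ≤-trans (≤-reflexive (sym (∑-+ (allFin n) _ _))) (∑-mono (allFin n) λ v → le v (T? (wins F v)))
            where
            le : ∀ v → Dec (T (wins F v)) → 𝟙 (proj₂ (new v)) + 𝟙 (wins F v) ≤ 𝟙 (U v)
            le v (no ¬w) = ≤-trans (≤-reflexive (trans (cong (𝟙 (proj₂ (new v)) +_) (if-no ¬w)) (+-identityʳ _))) (𝟙-mono {proj₂ (new v)} λ x → proj₁ (∧-elim {U v} x))
            le v (yes w) = ≤-trans (≤-reflexive (cong₂ _+_ (if-no {b = proj₂ (new v)} λ x → not-elim (proj₂ (∧-elim {U v} x)) (subst T (sym (wins≡ v)) w)) (if-yes w)))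
                             (≤-reflexive (sym (if-yes (proj₁ (proj₂ (win-hit v w))))))

          Qsize : ∣ proj₁ ∘ new ∣ᵛ ≤ ∣ Q′ ∣ᵛ + ∑ (upTo N) F
          Qsize = ≤-trans (∑-mono (allFin n) λ v → le (Q′ v) (proj₁ (yy v)) (y≡ v))
                    (≤-trans (≤-reflexive (∑-+ (allFin n) _ _)) (+-monoʳ-≤ ∣ Q′ ∣ᵛ (sum-restrict F)))
            where
            le : ∀ q x {z} → x ≡ z → 𝟙 (q ∨ (x ≡ᵇ 1)) ≤ 𝟙 q + z
            le true  _             _    = s≤s z≤n
            le false zero          _    = z≤n
            le false (suc zero)    refl = ≤-refl
            le false (suc (suc x)) _    = z≤n

          sizes : Balance F → ∣ proj₂ ∘ new ∣ᵛ * 48 ^ (b + suc r) ≤ n * 47 ^ (b + suc r) × ∑ (upTo N) F * (2 ^ (y * i) * 2 ^ J) ≤ 1153 * n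
          sizes balance = subst (λ e → ∣ proj₂ ∘ new ∣ᵛ * 48 ^ e ≤ n * 47 ^ e × ∑ (upTo N) F * (2 ^ (y * i) * 2 ^ J) ≤ 1153 * n) (sym (+-suc b r))
            (round-sizes n (47 ^ (b + r)) (48 ^ (b + r)) (2 ^ (y * i)) (2 ^ J) (∑ (upTo N) F) (∑ (upTo N) F₀) ∣ U ∣ᵛ ∣ proj₂ ∘ new ∣ᵛ (∑ (allFin n) (λ v → 𝟙 (wins F v)))
              (m^n>0 47 (b + r)) (m^n>0 2 J) balance (≤-trans (≤-reflexive (cong (_* 2 ^ (y * i)) (sum-lift (𝟙 ∘ Q)))) Q-small) U-small Usize)

          sub : ∀ v → T (proj₁ (new v)) → T (Q v)
          sub v x = go (Q′ v) (Q′⊆Q v) x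
            where
            go : ∀ q → (T q → T (Q v)) → T (q ∨ (proj₁ (yy v) ≡ᵇ 1)) → T (Q v)
            go true  q⊆ _ = q⊆ _
            go false _  e = 𝟙>0 (≤-trans (≤-reflexive (sym (trans (sym (y≡ v)) (≡ᵇ⇒≡ _ 1 e)))) (≤-trans (F≤F₀ (id v) (id<N v)) (≤-reflexive (lift-id (𝟙 ∘ Q) v))))

          ∨-left : ∀ {x z} → T x → T (x ∨ z)
          ∨-left {true} _ = _

          ∨-right : ∀ x {z} → T z → T (x ∨ z)
          ∨-right true  _ = _
          ∨-right false z = z

          hit′ : ∀ v → T (S v) → T (big v) → ¬ T (proj₂ (new v)) → ∃ λ u → T (proj₁ (new u)) × T (listed v (id u))
          hit′ v sv bv ¬u = go (T? (U v)) (T? (wins F v))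
            where
            go : Dec (T (U v)) → Dec (T (wins F v)) → ∃ λ u → T (proj₁ (new u)) × T (listed v (id u))
            go (no ¬U)  _       = let (u , q , l) = hit v sv bv ¬U in u , ∨-left q , l
            go (yes uv) (no ¬w) = ⊥-elim (¬u (∧-intro uv (not-intro λ w → ¬w (subst T (wins≡ v) w))))
            go (yes _)  (yes w) = let (u , _ , l , Fu) = win-hit v w in u , ∨-right (Q′ u) (≡⇒≡ᵇ _ 1 (trans (y≡ u) Fu)) , l

          Inv-step : Balance F → Inv (suc r) new
          Inv-step balance = record
            { U-big   = λ v x → U-big v (proj₁ (∧-elim {U v} x))
            ; U-small = proj₁ (sizes balance)
            ; Q′⊆Q    = sub
            ; Q′-size = begin
                ∣ proj₁ ∘ new ∣ᵛ * (2 ^ (y * i) * 2 ^ J)                                           ≤⟨ *-monoˡ-≤ (2 ^ (y * i) * 2 ^ J) Qsize ⟩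
                (∣ Q′ ∣ᵛ + ∑ (upTo N) F) * (2 ^ (y * i) * 2 ^ J)                                   ≡⟨ *-distribʳ-+ (2 ^ (y * i) * 2 ^ J) ∣ Q′ ∣ᵛ _ ⟩
                ∣ Q′ ∣ᵛ * (2 ^ (y * i) * 2 ^ J) + ∑ (upTo N) F * (2 ^ (y * i) * 2 ^ J)             ≤⟨ +-mono-≤ Q′-size (proj₂ (sizes balance)) ⟩
                r * (1153 * n) + 1153 * n                                                          ≡⟨ +-comm (r * (1153 * n)) _ ⟩
                suc r * (1153 * n)                                                                 ∎
            ; hit     = hit′
            }
            where open ≤-Reasoning

        module _ (p : Fin n → ℕ → Maybe (ℕ × ℕ)) (parents : IsParents G id t s p) where

          F₀≤1 : ∀ a → F₀ a ≤ 1
          F₀≤1 = lift-≤ (𝟙 ∘ Q) 1 λ u → 𝟙≤1 (Q u)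

          Selected : (Fin n → ℕ × (ℕ → ℕ)) → (ℕ → ℕ) → Set
          Selected = Isolate.Selected 𝒮 t s slots p parents J (coverWeight r) (sizeWeight r) J≤ A A (λ _ _ x → x) A-listed F₀ F₀≤1

          balance : ∀ yy F → Selected yy F → Balance F
          balance yy F sel = Isolation.Result.isolation N A A (λ _ _ x → x) ξ m J β₀ N≤ β₀< (coverWeight r) (sizeWeight r) (small-at J≤) U scale
            (λ v ¬u a x → ¬u (proj₁ (∧-elim {U v} x))) F₀ F F₀≤1 (proj₁ (proj₂ sel)) (λ v a x → listed⇒F₀ v a (proj₂ (∧-elim {U v} x))) (proj₂ (proj₂ (proj₂ sel)))
            where
            scale : ∀ v → T (U v) → 2 * count N (A v) ≤ 2 ^ J × 2 ^ J ≤ 8 * count N (A v)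
            scale v u = *-monoʳ-≤ 2 (≤-trans (count-mono N λ a _ x → proj₂ (∧-elim {U v} x)) (≤-trans (≤-reflexive (count-listed v)) (count-top≤ (E v)))) ,
                        *-mono-≤ {2} {8} (s≤s (s≤s z≤n)) (≤-trans (≤ᵇ⇒≤ Λ _ (U-big v u)) (count-mono N λ a _ l → ∧-intro u l))

          view≡ : ∀ yy F → Selected yy F → ∀ v a → T (A v a) → proj₂ (yy v) a ≡ F a
          view≡ yy F sel v a x = let (u , e) = node v a (A-listed v a x) in
            subst (λ c → proj₂ (yy v) c ≡ F c) e (proj₂ (proj₁ sel) v u (subst (λ c → s v c < t) (sym e) (A-listed v a x)))

          Spec-round : Spec (isolateRounds ξ m J t) (λ v → round v (Q v) (s v) (p v) r (st v)) (Inv (suc r))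
          Spec-round = Spec-map (λ v yy → proj₁ (st v) ∨ (proj₁ yy ≡ᵇ 1) , proj₂ (st v) ∧ not (succeeds N (A v) (A v) (proj₂ yy)))
            (Isolate.Spec-isolate 𝒮 t s slots p parents J (coverWeight r) (sizeWeight r) J≤ A A (λ _ _ x → x) A-listed F₀ F₀≤1 (λ v → 𝟙 (Q v)) (λ v → sym (lift-id (𝟙 ∘ Q) v)))
            λ yy (F , sel) → Outcome.Inv-step F (proj₁ (proj₂ sel)) (proj₁ (proj₂ (proj₂ sel))) yy (proj₁ (proj₁ sel)) (view≡ yy F sel) (balance yy F sel)

      start : Inv 0 (λ v → false , S v ∧ big v)
      start = record
        { U-big   = λ v x → proj₂ (∧-elim {S v} x)
        ; U-small = subst (λ e → ∣ (λ v → S v ∧ big v) ∣ᵛ * 48 ^ e ≤ n * 47 ^ e) (sym (+-identityʳ b))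
                      (≤-trans (*-monoˡ-≤ (48 ^ b) (∑-mono (allFin n) λ v → 𝟙-mono {S v ∧ big v} λ x → proj₁ (∧-elim {S v} x))) S-small)
        ; Q′⊆Q    = λ _ ()
        ; Q′-size = ≤-reflexive (cong (_* (2 ^ (y * i) * 2 ^ J)) (∑-0 (allFin n)))
        ; hit     = λ v sv bv ¬u → ⊥-elim (¬u (∧-intro sv bv))
        }

      finish : ∀ st → Inv R st → PhaseResult Q S (proj₁ ∘ st)
      finish st inv = Q′⊆Q , Q′-size , U , U-small , unbeaten
        where
        open Inv inv
        unbeaten : ∀ v → T (S v) → ¬ T (U v) → Unbeaten 𝒮 Hc Λ Q Q′ v
        unbeaten v sv ¬u X hX with count N X ≤? Λ
        ... | yes le = le
        ... | no gt with hit v sv bv ¬u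
          where
          Xactive : ∀ a → a < N → T (X a) → E v a < Hc
          Xactive a a<N x with hX a a<N x
          ... | u , r , refl , qu , r< , w , _ = ≤-<-trans (≤-trans (E-reach v u w) (≤-reflexive (cong (_+ r) (if-yes qu)))) r<
          bv : T (big v)
          bv = ≤⇒≤ᵇ (≤-trans (count-top≥ (E v) (≤-trans (<⇒≤ (≰⇒> gt)) (count-mono N λ a a<N x → <⇒<ᵇ (Xactive a a<N x)))) (≤-reflexive (sym (count-listed v))))
        ...   | u′ , q′ , l with count<⇒∃ N (top (E v)) X (≤-<-trans (count-top≤ (E v)) (≰⇒> gt))
        ...     | a , a<N , x , ¬top with hX a a<N x
        ...       | u , r , refl , qu , r< , w , no′ = ⊥-elim (no′ u′ q′ (Within-mono le walk))
          where
          Ea≤ : E v (id u) ≤ r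
          Ea≤ = ≤-trans (E-reach v u w) (≤-reflexive (cong (_+ r) (if-yes qu)))
          tp = top-elim (E v) {id u′} (listed⇒top v (id u′) l)
          closer : E v (id u′) ≤ E v (id u)
          closer = key-≤⁻ (E v) (id<N u) (<⇒≤ (rank-<⁻ (E v) (<-≤-trans (proj₂ tp) (≮⇒≥ λ lt → ¬top (top-intro (E v) (≤-<-trans Ea≤ r<) lt)))))
          walk = proj₂ (E-walk v u′ (proj₁ tp))
          le : E v (id u′) ∸ centre Q u′ ≤ r
          le = ≤-trans (m∸n≤m (E v (id u′)) (centre Q u′)) (≤-trans closer Ea≤)

    phaseTime : ℕ
    phaseTime = t + (t + R * isolateRounds ξ m J t)

    Spec-phase : Spec phaseTime (λ v → phase v (Q v) (S v)) (PhaseResult Q S)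
    Spec-phase = Spec-bind (Detect.Spec-detect G id id-inj N id<N bw fits-ids Hc Λ (centre Q)) λ ds ds≡ →
      Spec-bind (Relay.Spec-setup G id id-inj N id<N bw cap fits t (proj₂ ∘ ds) (Main.slots (proj₂ ∘ ds) (proj₂ ds≡))) λ p parents →
      Spec-map (λ _ → proj₁)
        (Spec-loop (Main.Inv (proj₂ ∘ ds) (proj₂ ds≡)) R (Main.start (proj₂ ∘ ds) (proj₂ ds≡))
          λ r st _ inv → Main.Round.Spec-round (proj₂ ∘ ds) (proj₂ ds≡) r st inv p parents)
        (Main.finish (proj₂ ∘ ds) (proj₂ ds≡))

module LevelsProgram (bw N cap : ℕ) (nbrs : List ℕ) (me : ℕ) (ξ m β₀ Hc J′ R y L : ℕ) where

  levels : ℕ → Bool → Proc ℕ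
  levels b inS = loop L (λ i lev → PhaseProgram.phase bw N cap nbrs me ξ m β₀ Hc J′ R b y i (lev ≡ᵇ i) inS >>= λ q →
                                   done (if q then suc i else lev)) 0

module Levels {n : ℕ} (𝒮 : Setting n) (Hc J′ R y L : ℕ) (J≤ : suc J′ ≤ Setting.Jmax 𝒮)
              (shrink : R * 1153 * 2 ^ y ≤ 2 ^ suc J′) (n< : n < 2 ^ (y * L)) where
  open Setting 𝒮
  open Execution G id bw

  Λ : ℕ
  Λ = 2 ^ J′

  levels : Fin n → ℕ → Bool → Proc ℕ
  levels v = LevelsProgram.levels bw N cap (nbrs v) (id v) ξ m β₀ Hc J′ R y L

  Unbeaten-mono : ∀ {Q₁ Q₂ Q₁′ Q₂′ v} → (∀ u → T (Q₂ u) → T (Q₁ u)) → (∀ u → T (Q₁′ u) → T (Q₂′ u)) →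
                  Unbeaten 𝒮 Hc Λ Q₁ Q₁′ v → Unbeaten 𝒮 Hc Λ Q₂ Q₂′ v
  Unbeaten-mono i j unb X hX = unb X λ a a< x → case hX a a< x of λ where
    (u , r , e , q , r< , w , no′) → u , r , e , i u q , r< , w , λ u′ q′ → no′ u′ (j u′ q′)

  LevelsOK : ℕ → (S : Fin n → Bool) → ℕ → (Fin n → ℕ) → Set
  LevelsOK b S i lev = Σ (Fin n → Bool) λ Z → ∣ Z ∣ᵛ * 48 ^ (b + R) ≤ i * (n * 47 ^ (b + R)) ×
    (∀ v → T (S v) → ¬ T (Z v) → ∀ j → j < i → Unbeaten 𝒮 Hc Λ (λ u → j ≤ᵇ lev u) (λ u → suc j ≤ᵇ lev u) v)

  levelsTime : ℕ
  levelsTime = L * (Hc + Λ + (Hc + Λ + R * isolateRounds ξ m (suc J′) (Hc + Λ)))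

  Spec-levels : ∀ b (S : Fin n → Bool) → ∣ S ∣ᵛ * 48 ^ b ≤ n * 47 ^ b →
                Spec levelsTime (λ v → levels v b (S v)) (λ lev → (∀ v → lev v < L) × LevelsOK b S L lev)
  Spec-levels b S S-small = Spec-weaken ≤-refl finish (Spec-loop Inv L start body)
    where
    Inv : ℕ → (Fin n → ℕ) → Set
    Inv i lev = (∀ v → lev v ≤ i) × ∣ (λ v → lev v ≡ᵇ i) ∣ᵛ * 2 ^ (y * i) ≤ n × LevelsOK b S i lev

    start : Inv 0 (λ _ → 0)
    start = (λ _ → z≤n) ,
      ≤-reflexive (trans (cong (λ e → ∣ (λ (v : Fin n) → true) ∣ᵛ * 2 ^ e) (*-zeroʳ y)) (trans (*-identityʳ _) (trans (∑-const (allFin n) 1) (trans (*-identityʳ _) (length-allFin n))))) ,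
      (λ _ → false) , ≤-reflexive (cong (_* 48 ^ (b + R)) (∑-0 (allFin n))) , λ _ _ _ _ ()

    body : ∀ i lev → i < L → Inv i lev → Spec _ _ (Inv (suc i))
    body i lev _ (lev≤ , Q-small , Z , Z-small , unb) =
      Spec-map (λ v q → if q then suc i else lev v) (Phase.Spec-phase 𝒮 Hc J′ R b y i J≤ (λ v → lev v ≡ᵇ i) S Q-small S-small) step
      where
      step : (Q′ : Fin n → Bool) → Phase.PhaseResult 𝒮 Hc J′ R b y i J≤ (λ v → lev v ≡ᵇ i) S Q′ → Inv (suc i) (λ v → if Q′ v then suc i else lev v)
      step Q′ (Q′⊆Q , Q′-size , Z₁ , Z₁-small , unb₁) = lev≤′ , Q′-small , (λ v → Z v ∨ Z₁ v) , Zs , unb′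
        where
        lev′ : Fin n → ℕ
        lev′ v = if Q′ v then suc i else lev v
        lev≤′ : ∀ v → lev′ v ≤ suc i
        lev≤′ v with Q′ v
        ... | true  = ≤-refl
        ... | false = m≤n⇒m≤1+n (lev≤ v)
        lev-inc : ∀ v → lev v ≤ lev′ v
        lev-inc v with Q′ v
        ... | true  = m≤n⇒m≤1+n (lev≤ v)
        ... | false = ≤-refl
        below : ∀ {j} v → j ≤ i → j ≤ lev′ v → j ≤ lev v
        below v j≤ le with Q′ v in eq
        ... | true  = ≤-trans j≤ (≤-reflexive (sym (≡ᵇ⇒≡ (lev v) i (Q′⊆Q v (subst T (sym eq) _)))))
        ... | false = le
        top⇒Q′ : ∀ v → T (lev′ v ≡ᵇ suc i) → T (Q′ v)
        top⇒Q′ v e with Q′ v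
        ... | true  = _
        ... | false = <⇒≢ (s≤s (lev≤ v)) (≡ᵇ⇒≡ (lev v) (suc i) e)
        Q′-small : ∣ (λ v → lev′ v ≡ᵇ suc i) ∣ᵛ * 2 ^ (y * suc i) ≤ n
        Q′-small = *-cancelʳ-≤ _ n (2 ^ suc J′) {{m^n≢0 2 (suc J′)}} (begin
          ∣ (λ v → lev′ v ≡ᵇ suc i) ∣ᵛ * 2 ^ (y * suc i) * 2 ^ suc J′
            ≤⟨ *-monoˡ-≤ (2 ^ suc J′) (*-monoˡ-≤ (2 ^ (y * suc i)) (∑-mono (allFin n) λ v → 𝟙-mono {lev′ v ≡ᵇ suc i} (top⇒Q′ v))) ⟩
          ∣ Q′ ∣ᵛ * 2 ^ (y * suc i) * 2 ^ suc J′
            ≡⟨ cong (λ e → ∣ Q′ ∣ᵛ * e * 2 ^ suc J′) (trans (cong (2 ^_) (*-suc y i)) (^-distribˡ-+-* 2 y (y * i))) ⟩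
          ∣ Q′ ∣ᵛ * (2 ^ y * 2 ^ (y * i)) * 2 ^ suc J′
            ≡⟨ r₁ ∣ Q′ ∣ᵛ (2 ^ y) (2 ^ (y * i)) (2 ^ suc J′) ⟩
          ∣ Q′ ∣ᵛ * (2 ^ (y * i) * 2 ^ suc J′) * 2 ^ y
            ≤⟨ *-monoˡ-≤ (2 ^ y) Q′-size ⟩
          R * (1153 * n) * 2 ^ y
            ≡⟨ r₂ R 1153 n (2 ^ y) ⟩
          n * (R * 1153 * 2 ^ y)
            ≤⟨ *-monoʳ-≤ n shrink ⟩
          n * 2 ^ suc J′ ∎)
          where
          open ≤-Reasoning
          r₁ : ∀ q a b c → q * (a * b) * c ≡ q * (b * c) * a
          r₁ = solve-∀
          r₂ : ∀ r c n a → r * (c * n) * a ≡ n * (r * c * a)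
          r₂ = solve-∀
        Zs : ∣ (λ v → Z v ∨ Z₁ v) ∣ᵛ * 48 ^ (b + R) ≤ suc i * (n * 47 ^ (b + R))
        Zs = begin
          ∣ (λ v → Z v ∨ Z₁ v) ∣ᵛ * 48 ^ (b + R)
            ≤⟨ *-monoˡ-≤ (48 ^ (b + R)) (≤-trans (∑-mono (allFin n) λ v → or (Z v) (Z₁ v)) (≤-reflexive (∑-+ (allFin n) _ _))) ⟩
          (∣ Z ∣ᵛ + ∣ Z₁ ∣ᵛ) * 48 ^ (b + R)
            ≡⟨ *-distribʳ-+ (48 ^ (b + R)) ∣ Z ∣ᵛ ∣ Z₁ ∣ᵛ ⟩
          ∣ Z ∣ᵛ * 48 ^ (b + R) + ∣ Z₁ ∣ᵛ * 48 ^ (b + R)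
            ≤⟨ +-mono-≤ Z-small Z₁-small ⟩
          i * (n * 47 ^ (b + R)) + n * 47 ^ (b + R)
            ≡⟨ +-comm (i * (n * 47 ^ (b + R))) _ ⟩
          suc i * (n * 47 ^ (b + R)) ∎
          where
          open ≤-Reasoning
          or : ∀ x z → 𝟙 (x ∨ z) ≤ 𝟙 x + 𝟙 z
          or true  z = s≤s z≤n
          or false z = ≤-refl
        unb′ : ∀ v → T (S v) → ¬ T (Z v ∨ Z₁ v) → ∀ j → j < suc i → Unbeaten 𝒮 Hc Λ (λ u → j ≤ᵇ lev′ u) (λ u → suc j ≤ᵇ lev′ u) v
        unb′ v sv ¬z j (s≤s j≤) with m≤n⇒m<n∨m≡n j≤
        ... | inj₁ j<i = Unbeaten-mono (λ u q → ≤⇒≤ᵇ (below u j≤ (≤ᵇ⇒≤ j _ q))) (λ u q → ≤⇒≤ᵇ (≤-trans (≤ᵇ⇒≤ (suc j) _ q) (lev-inc u)))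
                           (unb v sv (λ z → ¬z (∨ˡ z)) j j<i)
          where
          ∨ˡ : ∀ {x z} → T x → T (x ∨ z)
          ∨ˡ {true} _ = _
        ... | inj₂ refl = Unbeaten-mono (λ u q → ≡⇒≡ᵇ (lev u) i (≤-antisym (lev≤ u) (below u ≤-refl (≤ᵇ⇒≤ j _ q)))) (λ u q → ≤⇒≤ᵇ (≤-reflexive (sym (if-yes q))))
                            (unb₁ v sv (λ z → ¬z (∨ʳ (Z v) z)))
          where
          ∨ʳ : ∀ x {z} → T z → T (x ∨ z)
          ∨ʳ true  _ = _
          ∨ʳ false z = z

    finish : ∀ lev → Inv L lev → (∀ v → lev v < L) × LevelsOK b S L lev
    finish lev (lev≤ , Q-small , ok) = (λ v → ≤∧≢⇒< (lev≤ v) (none v)) , ok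
      where
      none : ∀ v → lev v ≢ L
      none v e = <⇒≱ n< (≤-trans (≤-trans (≤-reflexive (sym (*-identityˡ _))) (*-monoˡ-≤ (2 ^ (y * L))
        (≤-trans (≤-reflexive (sym (if-yes (≡⇒≡ᵇ (lev v) L e)))) (term≤∑ (allFin n) {λ v → 𝟙 (lev v ≡ᵇ L)} (∈-allFin v))))) Q-small)

-- Windows around the nearest centre

module Windows (N Hc w τ Λ₂ : ℕ) (D : ℕ → ℕ) where

  best : ℕ
  best = least (λ r → 1 ≤ᵇ count N λ a → D a ≤ᵇ r) Hc

  near : ℕ → ℕ → Bool
  near j a = D a ≤ᵇ best + j * w

  width : ℕ
  width = least (λ j → count N (near (suc j)) ≤ᵇ 2 * count N (near j)) τ

  inner outer : ℕ → Bool
  inner = near width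
  outer = near (suc width)

  scale : ℕ
  scale = least (λ j → count N outer ≤ᵇ 2 ^ j) τ

  fair : Bool
  fair = count N (near τ) <ᵇ Λ₂

  near-mono : ∀ {i j} → i ≤ j → ∀ a → T (near i a) → T (near j a)
  near-mono i≤j a t = ≤⇒≤ᵇ (≤-trans (≤ᵇ⇒≤ (D a) _ t) (+-monoʳ-≤ best (*-monoˡ-≤ w i≤j)))

  inner⊆outer : ∀ a → T (inner a) → T (outer a)
  inner⊆outer = near-mono (n≤1+n width)

  module Facts (Λ₂≤ : Λ₂ ≤ 2 ^ τ) (nonempty : ∃ λ a → a < N × D a < Hc) (is-fair : T fair) where

    best<Hc : best < Hc
    best<Hc = ≤-<-trans (least-minimal _ Hc (≤⇒≤ᵇ (≤-trans (≤-reflexive (sym (if-yes (≤⇒≤ᵇ (≤-refl {D a})))))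
                (term≤∑ (upTo N) {λ b → 𝟙 (D b ≤ᵇ D a)} (∈-upTo⁺ (proj₁ (proj₂ nonempty))))))) (proj₂ (proj₂ nonempty))
      where
      a = proj₁ nonempty

    best-attained : ∃ λ a → a < N × D a ≤ best
    best-attained with ∑>0 (upTo N) {λ a → 𝟙 (D a ≤ᵇ best)} (≤ᵇ⇒≤ 1 _ (least-sound (λ r → 1 ≤ᵇ count N λ a → D a ≤ᵇ r) Hc best<Hc))
    ... | a , a∈ , pos = a , ∈-upTo⁻ a∈ , ≤ᵇ⇒≤ (D a) best (𝟙>0 pos)

    near≥1 : ∀ j → 1 ≤ count N (near j)
    near≥1 j with best-attained
    ... | a , a<N , le = ≤-trans (≤-reflexive (sym (if-yes (≤⇒≤ᵇ {D a} (≤-trans le (m≤m+n best (j * w))))))) (term≤∑ (upTo N) {λ a → 𝟙 (near j a)} (∈-upTo⁺ a<N))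

    width<τ : width < τ
    width<τ = ≤∧≢⇒< (least≤ _ τ) λ e → <⇒≱ (<ᵇ⇒< _ _ is-fair) (≤-trans Λ₂≤ (grow τ ≤-refl e))
      where
      grow : ∀ j → j ≤ τ → width ≡ τ → 2 ^ j ≤ count N (near j)
      grow zero    _  _ = near≥1 0
      grow (suc j) j< e = ≤-trans (*-monoʳ-≤ 2 (grow j (<⇒≤ j<) e)) (<⇒≤ (≰⇒> λ le →
        <⇒≱ j< (≤-trans (≤-reflexive (sym e)) (least-minimal _ τ (≤⇒≤ᵇ le)))))

    width-sound : count N outer ≤ 2 * count N inner
    width-sound = ≤ᵇ⇒≤ _ _ (least-sound (λ j → count N (near (suc j)) ≤ᵇ 2 * count N (near j)) τ width<τ)

    outer< : count N outer ≤ 2 ^ τ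
    outer< = ≤-trans (count-mono N λ a _ → near-mono width<τ a) (≤-trans (<⇒≤ (<ᵇ⇒< _ _ is-fair)) Λ₂≤)

    outer≤ : count N outer ≤ 2 ^ scale
    outer≤ with m≤n⇒m<n∨m≡n (least≤ (λ j → count N outer ≤ᵇ 2 ^ j) τ)
    ... | inj₁ lt = ≤ᵇ⇒≤ _ _ (least-sound (λ j → count N outer ≤ᵇ 2 ^ j) τ lt)
    ... | inj₂ e  = ≤-trans outer< (≤-reflexive (cong (2 ^_) (sym e)))

    scale≤ : 2 ^ suc scale ≤ 8 * count N inner
    scale≤ = bound scale λ j lt le → <⇒≱ lt (least-minimal (λ j → count N outer ≤ᵇ 2 ^ j) τ (≤⇒≤ᵇ le))
      where
      bound : ∀ z → (∀ j → j < z → ¬ (count N outer ≤ 2 ^ j)) → 2 ^ suc z ≤ 8 * count N inner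
      bound zero    _ = ≤-trans (s≤s (s≤s z≤n)) (*-monoʳ-≤ 8 (near≥1 width))
      bound (suc z) h = begin
        2 * (2 * 2 ^ z)              ≡⟨ sym (*-assoc 2 2 (2 ^ z)) ⟩
        4 * 2 ^ z                    ≤⟨ *-monoʳ-≤ 4 (<⇒≤ (≰⇒> (h z ≤-refl))) ⟩
        4 * count N outer            ≤⟨ *-monoʳ-≤ 4 width-sound ⟩
        4 * (2 * count N inner)      ≡⟨ sym (*-assoc 4 2 (count N inner)) ⟩
        8 * count N inner            ∎
        where open ≤-Reasoning

-- Clusters of one colour

record ColourOK {n : ℕ} (G : Graph n) (k ρ : ℕ) (R : Fin n → ℕ → Set) : Set where
  field
    separate : ∀ v v′ a a′ → R v a → R v′ a′ → a ≢ a′ → ¬ Within G k v v′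
    tree     : ℕ → STree G
    steiner  : ∀ a → IsSteinerTree G (tree a) (λ v → R v a) ρ
    disjoint : ∀ v v′ a a′ → R v a → R v′ a′ → a ≢ a′ → ∀ x z → TreeEdge (tree a) x z → ¬ TreeEdge (tree a′) x z

ColourOK-⊆ : ∀ {n} {G : Graph n} {k ρ} {R R′ : Fin n → ℕ → Set} → (∀ v a → R′ v a → R v a) → ColourOK G k ρ R → ColourOK G k ρ R′
ColourOK-⊆ i ok = record
  { separate = λ v v′ a a′ r r′ → separate v v′ a a′ (i v a r) (i v′ a′ r′)
  ; tree     = tree
  ; steiner  = λ a → record
      { root-in   = IsSteinerTree.root-in (steiner a)
      ; parent-ok = IsSteinerTree.parent-ok (steiner a)
      ; radius    = IsSteinerTree.radius (steiner a)
      ; terminals = λ v r → IsSteinerTree.terminals (steiner a) v (i v a r)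
      }
  ; disjoint = λ v v′ a a′ r r′ → disjoint v v′ a a′ (i v a r) (i v′ a′ r′)
  }
  where open ColourOK ok

iter-shift : ∀ {A : Set} (f : A → A) m x → iter f m (f x) ≡ f (iter f m x)
iter-shift f zero    x = refl
iter-shift f (suc m) x = cong f (iter-shift f m x)

single : ∀ {n} {G : Graph n} → Fin n → STree G
single u = record { member = λ z → ⌊ z FinP.≟ u ⌋ ; root = u ; parent = λ z → z }

single-ok : ∀ {n} {G : Graph n} {ρ} u {C : Fin n → Set} → (∀ v → ¬ C v) → IsSteinerTree G (single u) C ρ
single-ok u none = record
  { root-in   = fromWitness {a? = u FinP.≟ u} refl
  ; parent-ok = λ v t v≢u → ⊥-elim (v≢u (toWitness {a? = v FinP.≟ u} t))
  ; radius    = λ v t → 0 , z≤n , toWitness {a? = v FinP.≟ u} t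
  ; terminals = λ v c → ⊥-elim (none v c)
  }

ColourOK-∅ : ∀ {n} {G : Graph n} {k ρ} {R : Fin n → ℕ → Set} → Fin n → (∀ v a → ¬ R v a) → ColourOK G k ρ R
ColourOK-∅ v₀ none = record
  { separate = λ v v′ a a′ r → ⊥-elim (none v a r)
  ; tree     = λ _ → single v₀
  ; steiner  = λ a → single-ok v₀ λ v → none v a
  ; disjoint = λ v v′ a a′ r → ⊥-elim (none v a r)
  }

-- Trees along shortest paths in the strict Voronoi cells of the selected centres

module Cells {n : ℕ} (G : Graph n) (id : Fin n → ℕ) (id-inj : ∀ u v → id u ≡ id v → u ≡ v)
             (N : ℕ) (Hc : ℕ) (src : Fin n → ℕ) (F : ℕ → ℕ) (v₀ : Fin n) where
  open Distance G id id-inj Hc src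

  rivals : ℕ → Fin n → ℕ → Bool
  rivals a z b = not (b ≡ᵇ a) ∧ ((F b ≡ᵇ 1) ∧ (E z b ≤ᵇ E z a))

  cell : ℕ → Fin n → Bool
  cell a z = (E z a <ᵇ Hc) ∧ (count N (rivals a z) ≡ᵇ 0)

  cell-intro : ∀ a z → E z a < Hc → (∀ b → b < N → b ≢ a → F b ≡ 1 → E z a < E z b) → T (cell a z)
  cell-intro a z lt h = ∧-intro (<⇒<ᵇ lt) (≡⇒≡ᵇ _ 0 (∑-zero∈ (upTo N) λ b b∈ → if-no λ t →
    case ∧-elim {not (b ≡ᵇ a)} t of λ where
      (ne , t′) → case ∧-elim {F b ≡ᵇ 1} t′ of λ where
        (Fb , le) → <⇒≱ (h b (∈-upTo⁻ b∈) (λ e → not-elim ne (≡⇒≡ᵇ b a e)) (≡ᵇ⇒≡ _ 1 Fb)) (≤ᵇ⇒≤ (E z b) (E z a) le)))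

  cell-elim : ∀ a z → T (cell a z) → E z a < Hc × (∀ b → b < N → b ≢ a → F b ≡ 1 → E z a < E z b)
  cell-elim a z t = <ᵇ⇒< _ _ (proj₁ (∧-elim {E z a <ᵇ Hc} t)) , λ b b<N b≢a Fb → ≰⇒> λ le →
    <⇒≢ (≤-trans (≤-reflexive (sym (if-yes (∧-intro (not-intro (b≢a ∘ ≡ᵇ⇒≡ b a)) (∧-intro (≡⇒≡ᵇ _ 1 Fb) (≤⇒≤ᵇ le))))))
           (term≤∑ (upTo N) {λ b → 𝟙 (rivals a z b)} (∈-upTo⁺ b<N)))
      (sym (≡ᵇ⇒≡ _ 0 (proj₂ (∧-elim {E z a <ᵇ Hc} t))))

  cell-down : ∀ a z w → T (cell a z) → Adj G z w → suc (E w a) ≡ E z a → T (cell a w)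
  cell-down a z w c zw e with cell-elim a z c
  ... | lt , strict = cell-intro a w (<-trans (≤-reflexive e) lt) λ b b<N b≢a Fb →
    ≤-pred (≤-trans (s≤s (≤-reflexive e)) (≤-trans (strict b b<N b≢a Fb) (E-lip z w b zw)))

  orElse : Fin n → Maybe (Fin n) → Fin n
  orElse z (just w) = w
  orElse z nothing  = z

  toward : ℕ → Fin n → Fin n
  toward a z = orElse z (findᵇ (λ w → adj G z w ∧ (suc (E w a) ≡ᵇ E z a)) (allFin n))

  toward-ok : ∀ a z → E z a < Hc → a ≢ id z → Adj G z (toward a z) × suc (E (toward a z) a) ≡ E z a
  toward-ok a z lt ne with E-descend z a lt
  ... | inj₁ (e , _) = ⊥-elim (ne e)
  ... | inj₂ (w , zw , e) with findᵇ-complete (λ w → adj G z w ∧ (suc (E w a) ≡ᵇ E z a)) (allFin n) (∈-allFin w) (∧-intro zw (≡⇒≡ᵇ _ _ e))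
  ...   | x , eq with ∧-elim {adj G z x} (proj₂ (findᵇ-sound (λ w → adj G z w ∧ (suc (E w a) ≡ᵇ E z a)) (allFin n) eq))
  ...     | zx , ex = subst (λ y → Adj G z y × suc (E y a) ≡ E z a) (sym (cong (orElse z) eq)) (zx , ≡ᵇ⇒≡ _ _ ex)

  cellTree : Fin n → STree G
  cellTree u = record
    { member = cell (id u)
    ; root   = u
    ; parent = λ z → if ⌊ z FinP.≟ u ⌋ then u else toward (id u) z
    }

  treeAt : Maybe (Fin n) → STree G
  treeAt nothing  = single v₀
  treeAt (just u) = if cell (id u) u then cellTree u else single u

  tree : ℕ → STree G
  tree a = treeAt (nodeOf a)

  module _ (u : Fin n) where
    private
      par = parent (cellTree u)

      par-toward : ∀ z → z ≢ u → par z ≡ toward (id u) z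
      par-toward z z≢u = if-no {b = ⌊ z FinP.≟ u ⌋} λ t → z≢u (toWitness {a? = z FinP.≟ u} t)

    descend : ∀ e z → E z (id u) ≡ e → T (cell (id u) z) → T (cell (id u) u) × (∃ λ m → m ≤ e × iter par m z ≡ u)
    descend e z eq c with z FinP.≟ u
    ... | yes refl = c , 0 , z≤n , refl
    ... | no z≢u with toward-ok (id u) z (proj₁ (cell-elim (id u) z c)) (λ i → z≢u (sym (id-inj u z i)))
    descend zero    z eq c | no z≢u | _  , s = ⊥-elim (0≢1+n (trans (sym eq) (sym s)))
    descend (suc e) z eq c | no z≢u | zw , s
      with descend e (toward (id u) z) (suc-injective (trans s eq)) (cell-down (id u) z (toward (id u) z) c zw s)
    ...   | cu , m , m≤ , it = cu , suc m , s≤s m≤ , trans (sym (iter-shift par m z)) (trans (cong (iter par m) (par-toward z z≢u)) it)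

    cellTree-ok : ∀ {C : Fin n → Set} → T (cell (id u) u) → (∀ v → C v → T (cell (id u) v)) → IsSteinerTree G (cellTree u) C Hc
    cellTree-ok cu C⊆ = record
      { root-in   = cu
      ; parent-ok = λ z c z≢u → subst (λ w → T (cell (id u) w) × Adj G z w) (sym (par-toward z z≢u))
                      (let (zw , s) = toward-ok (id u) z (proj₁ (cell-elim (id u) z c)) (λ i → z≢u (sym (id-inj u z i)))
                       in cell-down (id u) z (toward (id u) z) c zw s , zw)
      ; radius    = λ z c → let (_ , m , m≤ , it) = descend (E z (id u)) z refl c in m , ≤-trans m≤ (E≤Hc z (id u)) , it
      ; terminals = C⊆
      }

  module Colour (k : ℕ) (R : Fin n → ℕ → Set) (R-node : ∀ v a → R v a → a < N × F a ≡ 1 × T (cell a v))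
                (R-separate : ∀ v v′ a a′ → R v a → R v′ a′ → a ≢ a′ → ¬ Within G k v v′) where

    private
      tree≡ : ∀ v a → R v a → ∃ λ u → id u ≡ a × T (cell a u) × tree a ≡ cellTree u
      tree≡ v a r with R-node v a r
      ... | a<N , Fa , c with E-node v a (proj₁ (cell-elim a v c))
      ...   | u , refl with proj₁ (descend u (E v (id u)) v refl c)
      ...     | cu = u , refl , cu , trans (cong treeAt (nodeOf-id u)) (if-yes cu)

      steiner′ : ∀ a → IsSteinerTree G (tree a) (λ v → R v a) Hc
      steiner′ a with nodeOf a in eq
      ... | nothing = single-ok v₀ λ v r → case tree≡ v a r of λ where
              (u , refl , _) → case trans (sym eq) (nodeOf-id u) of λ ()
      ... | just u with ≡ᵇ⇒≡ (id u) a (proj₂ (findᵇ-sound (λ u → id u ≡ᵇ a) (allFin n) eq))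
      ...   | refl with cell (id u) u in cu
      ...     | true  = cellTree-ok u (subst T (sym cu) _) λ v r → proj₂ (proj₂ (R-node v (id u) r))
      ...     | false = single-ok u λ v r → case tree≡ v (id u) r of λ where
                (u′ , e , c , _) → subst T (trans (cong (cell (id u)) (id-inj u′ u e)) cu) c

      edge-cells : ∀ a v x z → R v a → TreeEdge (tree a) x z → T (cell a x)
      edge-cells a v x z r e with tree≡ v a r
      ... | u , refl , cu , eq rewrite eq with e
      ...   | inj₁ (c , _ , _)      = c
      ...   | inj₂ (c , z≢ , refl) = proj₁ (IsSteinerTree.parent-ok (cellTree-ok u {λ _ → ⊥} cu λ _ ()) z c z≢)

    colourOK : ColourOK G k Hc R
    colourOK = record
      { separate = R-separate
      ; tree     = tree
      ; steiner  = steiner′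
      ; disjoint = λ v v′ a a′ r r′ ne x z e e′ →
          <-asym (proj₂ (cell-elim a x (edge-cells a v x z r e)) a′ (proj₁ (R-node v′ a′ r′)) (ne ∘ sym) (proj₁ (proj₂ (R-node v′ a′ r′))))
                 (proj₂ (cell-elim a′ x (edge-cells a′ v′ x z r′ e′)) a (proj₁ (R-node v a r)) ne (proj₁ (proj₂ (R-node v a r))))
      }

-- The second stage: in each colour the nodes of one scale isolate a centre

join : ℕ → Maybe ℕ → Maybe (ℕ × ℕ) → Maybe (ℕ × ℕ)
join c (just a) old = just (c , a)
join c nothing  old = old

module CarveProgram (bw N cap : ℕ) (nbrs : List ℕ) (me : ℕ) (ξ m β₀ Hc w τ Λ₂ L h : ℕ) where
  t : ℕ
  t = Hc + Λ₂

  module _ (b : ℕ) (inS : Bool) (D s : ℕ → ℕ) (p : ℕ → Maybe (ℕ × ℕ)) where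
    open Windows N Hc w τ Λ₂ D

    takes : ℕ → Bool
    takes j = inS ∧ (fair ∧ (scale ≡ᵇ j))

    A B : ℕ → ℕ → Bool
    A j a = takes j ∧ inner a
    B j a = takes j ∧ outer a

    centreOf : ℕ → (ℕ → ℕ) → Maybe ℕ
    centreOf j view = findᵇ (λ a → B j a ∧ (view a ≡ᵇ 1)) (upTo N)

    carveRound : ℕ → Maybe (ℕ × ℕ) → Proc (Maybe (ℕ × ℕ))
    carveRound j old =
      IsolateProgram.isolate bw N cap t nbrs me s p ξ m (suc j) β₀ 1 0 (A j) (B j) 1 >>= λ yy →
      done (if succeeds N (A j) (B j) (proj₂ yy) then join (b * suc τ + j) (centreOf j (proj₂ yy)) old else old)

  carve : ℕ → ℕ → Maybe (ℕ × ℕ) → Proc (Maybe (ℕ × ℕ))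
  carve b lev old =
    DetectProgram.detect bw N Hc Λ₂ nbrs me ((L ∸ lev) * h) >>= λ ds →
    RelayProgram.setup bw N cap t nbrs me (proj₂ ds) >>= λ p →
    loop (suc τ) (carveRound b (is-nothing old) (proj₁ ds) (proj₂ ds) p) old

module Carve {n : ℕ} (𝒮 : Setting n) (k τ L Λ w h Hc Λ₂ : ℕ) (τ< : suc τ ≤ Setting.Jmax 𝒮)
             (w≡ : w ≡ 2 * k) (h> : τ * w < h) (Hc> : L * h + τ * w < Hc) (Λ₂> : L * Λ < Λ₂) (Λ₂≤ : Λ₂ ≤ 2 ^ τ) (v₀ : Fin n) where
  open Setting 𝒮
  open Execution G id bw
  open Walks G
  open IdSums id id-inj N id<N
  open Rank N
  open Top Hc Λ₂
  open module Prog v = CarveProgram bw N cap (nbrs v) (id v) ξ m β₀ Hc w τ Λ₂ L h using (carve; carveRound)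
  open CarveProgram bw N cap [] 0 ξ m β₀ Hc w τ Λ₂ L h using (t)
  open DetectProgram bw N Hc Λ₂ [] using (slot; dist)

  module Geometry (lev : Fin n → ℕ) (D : Fin n → ℕ → ℕ) where
    src : Fin n → ℕ
    src v = (L ∸ lev v) * h

    open Distance G id id-inj Hc src public hiding (D)
    open module Win v = Windows N Hc w τ Λ₂ (D v) public
      using (best; near; width; inner; outer; scale; fair; near-mono; inner⊆outer)

    module _ (D≡ : ∀ v a → D v a ≡ dist (E v) a) where

      D-top : ∀ v a → T (top (E v) a) → D v a ≡ E v a
      D-top v a tp = trans (D≡ v a) (if-yes tp)

      E≤D : ∀ v a → E v a ≤ D v a
      E≤D v a with T? (top (E v) a)
      ... | yes tp = ≤-reflexive (sym (D-top v a tp))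
      ... | no ¬tp = ≤-trans (E≤Hc v a) (≤-reflexive (sym (trans (D≡ v a) (if-no ¬tp))))

      E-own : ∀ v → E v (id v) ≤ L * h
      E-own v = ≤-trans (E-self v) (*-monoˡ-≤ h (m∸n≤m L (lev v)))

      L*h<Hc : L * h < Hc
      L*h<Hc = ≤-<-trans (m≤m+n _ _) Hc>

      best≤E : ∀ v a → a < N → best v ≤ E v a
      best≤E v a a<N with E v a <? Hc
      ... | no ge = ≤-trans (least≤ _ Hc) (≮⇒≥ ge)
      ... | yes lt with rank (E v) a <? Λ₂
      ...   | yes r< = attained a a<N (D-top v a (top-intro (E v) lt r<)) ≤-refl
        where
        attained : ∀ c → c < N → D v c ≡ E v c → E v c ≤ E v a → best v ≤ E v a
        attained c c<N e le = least-minimal _ Hc (≤⇒≤ᵇ (≤-trans (≤-reflexive (sym (if-yes (≤⇒≤ᵇ (≤-trans (≤-reflexive e) le)))))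
          (term≤∑ (upTo N) {λ x → 𝟙 (D v x ≤ᵇ E v a)} (∈-upTo⁺ c<N))))
      ...   | no r≥ with ∑>0 (upTo N) {𝟙 ∘ top (E v)} (≤-trans (≤-<-trans z≤n Λ₂>) (count-top-full (E v) a<N lt (≮⇒≥ r≥)))
      ...     | c , c∈ , pos = least-minimal _ Hc (≤⇒≤ᵇ (≤-trans (≤-reflexive (sym (if-yes (≤⇒≤ᵇ (≤-trans (≤-reflexive (D-top v c tp)) le)))))
          (term≤∑ (upTo N) {λ x → 𝟙 (D v x ≤ᵇ E v a)} c∈)))
        where
        tp = 𝟙>0 pos
        le : E v c ≤ E v a
        le = key-≤⁻ (E v) a<N (<⇒≤ (rank-<⁻ (E v) (<-≤-trans (proj₂ (top-elim (E v) {c} tp)) (≮⇒≥ r≥))))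

      best≤ : ∀ v → best v ≤ L * h
      best≤ v = ≤-trans (best≤E v (id v) (id<N v)) (E-own v)

      window<Hc : ∀ v j → j ≤ τ → best v + j * w < Hc
      window<Hc v j j≤ = ≤-<-trans (+-mono-≤ (best≤ v) (*-monoˡ-≤ w j≤)) Hc>

      listed-own : ∀ v → ∃ λ a → a < N × D v a < Hc
      listed-own v = a , a<N , ≤-<-trans Da≤ (≤-<-trans (best≤ v) L*h<Hc)
        where
        best<Hc = ≤-<-trans (best≤ v) L*h<Hc
        found = ∑>0 (upTo N) {λ a → 𝟙 (D v a ≤ᵇ best v)} (≤ᵇ⇒≤ 1 _ (least-sound (λ r → 1 ≤ᵇ count N λ a → D v a ≤ᵇ r) Hc best<Hc))
        a   = proj₁ found
        a<N = ∈-upTo⁻ (proj₁ (proj₂ found))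
        Da≤ : D v a ≤ best v
        Da≤ = ≤ᵇ⇒≤ _ _ (𝟙>0 (proj₂ (proj₂ found)))

      module Fair v = Windows.Facts N Hc w τ Λ₂ (D v) Λ₂≤ (listed-own v)

      near⇒E : ∀ v j a → T (near v j a) → E v a ≤ best v + j * w
      near⇒E v j a t = ≤-trans (E≤D v a) (≤ᵇ⇒≤ (D v a) _ t)

      near⇒top : ∀ v j a → j ≤ τ → T (near v j a) → T (top (E v) a)
      near⇒top v j a j≤ t with T? (top (E v) a)
      ... | yes tp = tp
      ... | no ¬tp = ⊥-elim (<⇒≱ (window<Hc v j j≤) (≤-trans (≤-reflexive (sym (trans (D≡ v a) (if-no ¬tp)))) (≤ᵇ⇒≤ (D v a) _ t)))

      -- A fair node knows all centres in its windows.
      E⇒near : ∀ v j a → T (fair v) → j ≤ τ → a < N → E v a ≤ best v + j * w → T (near v j a)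
      E⇒near v j a fv j≤ a<N le with T? (top (E v) a)
      ... | yes tp = ≤⇒≤ᵇ (≤-trans (≤-reflexive (D-top v a tp)) le)
      ... | no ¬tp = ⊥-elim (<⇒≱ (<ᵇ⇒< _ Λ₂ fv) (≤-trans (count-top-full (E v) a<N Ea< r≥) (count-mono N inc)))
        where
        Ea< : E v a < Hc
        Ea< = ≤-<-trans le (window<Hc v j j≤)
        r≥ : Λ₂ ≤ rank (E v) a
        r≥ = ≮⇒≥ λ r< → ¬tp (top-intro (E v) Ea< r<)
        inc : ∀ c → c < N → T (top (E v) c) → T (near v τ c)
        inc c c<N tp = ≤⇒≤ᵇ (≤-trans (≤-reflexive (D-top v c tp))
          (≤-trans (key-≤⁻ (E v) a<N (<⇒≤ (rank-<⁻ (E v) (<-≤-trans (proj₂ (top-elim (E v) {c} tp)) r≥))))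
            (≤-trans le (+-monoʳ-≤ (best v) (*-monoˡ-≤ w j≤)))))

      best-lip : ∀ v v′ → T (fair v) → Within G k v v′ → best v′ ≤ best v + k
      best-lip v v′ fv vv′ with Fair.best-attained v fv
      ... | a , a<N , le = ≤-trans (best≤E v′ a a<N) (≤-trans (E-lip-walk v′ v a (Within-sym vv′)) (+-monoˡ-≤ k (≤-trans (E≤D v a) le)))

      transfer : ∀ v v′ a → T (fair v) → T (fair v′) → width v ≤ width v′ → Within G k v v′ → a < N → T (inner v a) → T (outer v′ a)
      transfer v v′ a fv fv′ le vv′ a<N i = E⇒near v′ (suc (width v′)) a fv′ (Fair.width<τ v′ fv′) a<N (begin
        E v′ a                                ≤⟨ E-lip-walk v′ v a (Within-sym vv′) ⟩
        E v a + k                             ≤⟨ +-monoˡ-≤ k (near⇒E v (width v) a i) ⟩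
        best v + width v * w + k              ≤⟨ +-monoˡ-≤ k (+-mono-≤ (best-lip v′ v fv′ (Within-sym vv′)) (*-monoˡ-≤ w le)) ⟩
        best v′ + k + width v′ * w + k        ≡⟨ trans (e (best v′) k (width v′ * w)) (cong (λ z → best v′ + (z + width v′ * w)) (sym w≡)) ⟩
        best v′ + suc (width v′) * w          ∎)
        where
        open ≤-Reasoning
        e : ∀ b k x → b + k + x + k ≡ b + (2 * k + x)
        e = solve-∀

      -- A centre beaten by a centre of a higher level lies outside all windows.
      fair-if-unbeaten : ∀ v → (∀ u → lev u < L) → (∀ j → j < L → Unbeaten 𝒮 Hc Λ (λ u → j ≤ᵇ lev u) (λ u → suc j ≤ᵇ lev u) v) → T (fair v)
      fair-if-unbeaten v lev< unb = <⇒<ᵇ (≤-<-trans (begin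
        count N (near v τ)                                          ≤⟨ ∑-mono∈ (upTo N) (λ a a∈ → split a) ⟩
        ∑ (upTo N) (λ a → ∑ (upTo L) λ i → 𝟙 (X i a))               ≡⟨ ∑-swap (upTo N) (upTo L) _ ⟩
        ∑ (upTo L) (λ i → count N (X i))                            ≤⟨ ∑-mono∈ (upTo L) (λ i i∈ → unb i (∈-upTo⁻ i∈) (X i) (beat i)) ⟩
        ∑ (upTo L) (λ _ → Λ)                                        ≡⟨ trans (∑-const (upTo L) Λ) (cong (_* Λ) (length-upTo L)) ⟩
        L * Λ                                                       ∎) Λ₂>)
        where
        open ≤-Reasoning
        X : ℕ → ℕ → Bool
        X i a = near v τ a ∧ (lift lev a ≡ᵇ i)
        E< : ∀ a → T (near v τ a) → E v a < Hc
        E< a t = ≤-<-trans (near⇒E v τ a t) (window<Hc v τ ≤-refl)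
        split : ∀ a → 𝟙 (near v τ a) ≤ ∑ (upTo L) λ i → 𝟙 (X i a)
        split a with T? (near v τ a)
        ... | no ¬t = ≤-trans (≤-reflexive (if-no ¬t)) z≤n
        ... | yes t with E-node v a (E< a t)
        ...   | u , refl = ≤-trans (𝟙≤1 _) (≤-trans (≤-reflexive (sym (if-yes (∧-intro t (≡⇒≡ᵇ _ _ (lift-id lev u))))))
                             (term≤∑ (upTo L) {λ i → 𝟙 (X i (id u))} (∈-upTo⁺ (lev< u))))
        beat : ∀ i a → a < N → T (X i a) → ∃ λ u → ∃ λ r → id u ≡ a × T (i ≤ᵇ lev u) × r < Hc × Within G r v u ×
               (∀ u′ → T (suc i ≤ᵇ lev u′) → ¬ Within G r v u′)
        beat i a a<N x with ∧-elim {near v τ a} x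
        ... | t , li with E-node v a (E< a t)
        ...   | u , refl with E-walk v u (E< (id u) t)
        ...     | s≤ , walk = u , E v (id u) ∸ src u , refl , ≤⇒≤ᵇ (≤-reflexive (sym lev≡)) , ≤-<-trans (m∸n≤m _ (src u)) (E< (id u) t) , walk , none
          where
          lev≡ : lev u ≡ i
          lev≡ = trans (sym (lift-id lev u)) (≡ᵇ⇒≡ _ i li)
          none : ∀ u′ → T (suc i ≤ᵇ lev u′) → ¬ Within G (E v (id u) ∸ src u) v u′
          none u′ hi wu′ = <⇒≱ h> (+-cancelˡ-≤ (best v) h (τ * w) (begin
            best v + h                                       ≤⟨ +-monoˡ-≤ h (≤-trans (best≤E v (id u′) (id<N u′)) (E-reach v u′ wu′)) ⟩
            src u′ + (E v (id u) ∸ src u) + h                ≤⟨ +-monoˡ-≤ h (+-monoˡ-≤ _ (*-monoˡ-≤ h (∸-monoʳ-≤ L (≤ᵇ⇒≤ (suc i) (lev u′) hi)))) ⟩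
            (L ∸ suc i) * h + (E v (id u) ∸ src u) + h       ≡⟨ e ((L ∸ suc i) * h) (E v (id u) ∸ src u) h ⟩
            suc (L ∸ suc i) * h + (E v (id u) ∸ src u)       ≡⟨ cong (λ z → z * h + (E v (id u) ∸ src u)) (sym (+-∸-assoc 1 i<L)) ⟩
            (L ∸ i) * h + (E v (id u) ∸ src u)               ≡⟨ cong (λ z → (L ∸ z) * h + (E v (id u) ∸ src u)) (sym lev≡) ⟩
            src u + (E v (id u) ∸ src u)                     ≡⟨ m+[n∸m]≡n s≤ ⟩
            E v (id u)                                       ≤⟨ near⇒E v τ (id u) t ⟩
            best v + τ * w                                   ∎))
            where
            i<L : i < L
            i<L = subst (_< L) lev≡ (lev< u)
            e : ∀ a b c → a + b + c ≡ c + a + b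
            e = solve-∀

  CarveResult : ℕ → ℕ → (old new : Fin n → Maybe (ℕ × ℕ)) → Set
  CarveResult b z old new =
    (∀ v x → old v ≡ just x → new v ≡ just x) ×
    (∀ v c a → old v ≡ nothing → new v ≡ just (c , a) → (∃ λ j → j < suc τ × c ≡ b * suc τ + j) × a < N) ×
    (∀ j → j < suc τ → ColourOK G k Hc (λ v a → old v ≡ nothing × new v ≡ just (b * suc τ + j , a))) ×
    24 * ∣ is-nothing ∘ new ∣ᵛ ≤ 23 * ∣ is-nothing ∘ old ∣ᵛ + z

  module Rounds (b : ℕ) (lev : Fin n → ℕ) (old : Fin n → Maybe (ℕ × ℕ)) (D : Fin n → ℕ → ℕ) where
    open Geometry lev D

    S : Fin n → Bool
    S = is-nothing ∘ old

    U : ℕ → Fin n → Bool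
    U j v = S v ∧ (fair v ∧ (scale v ≡ᵇ j))

    U-elim : ∀ j v → T (U j v) → T (S v) × T (fair v) × scale v ≡ j
    U-elim j v u with ∧-elim {S v} u
    ... | sv , x with ∧-elim {fair v} x
    ...   | fv , e = sv , fv , ≡ᵇ⇒≡ _ j e

    A B : ℕ → Fin n → ℕ → Bool
    A j v a = U j v ∧ inner v a
    B j v a = U j v ∧ outer v a

    A⊆B : ∀ j v a → T (A j v a) → T (B j v a)
    A⊆B j v a x with ∧-elim {U j v} x
    ... | u , i = ∧-intro u (inner⊆outer v a i)

    B-near : ∀ v j a → T (B j v a) → T (U j v) × T (near v (suc (width v)) a)
    B-near v j a x = ∧-elim {U j v} x

    early : ℕ → Fin n → Bool
    early j v = S v ∧ (fair v ∧ (scale v <ᵇ j))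

    colour : ℕ → ℕ
    colour j = b * suc τ + j

    record Inv (j : ℕ) (st : Fin n → Maybe (ℕ × ℕ)) : Set where
      field
        kept    : ∀ v x → old v ≡ just x → st v ≡ just x
        shape   : ∀ v c a → old v ≡ nothing → st v ≡ just (c , a) → c ≡ colour (scale v) × scale v < j × a < N
        good    : ∀ i → i < j → ColourOK G k Hc (λ v a → old v ≡ nothing × st v ≡ just (colour i , a))
        counted : ∣ early j ∣ᵛ ≤ 24 * ∣ (λ v → S v ∧ is-just (st v)) ∣ᵛ

    start : Inv 0 old
    start = record
      { kept    = λ _ _ e → e
      ; shape   = λ v c a e e′ → case trans (sym e) e′ of λ ()
      ; good    = λ _ ()
      ; counted = ≤-trans (≤-reflexive (∑-zero∈ (allFin n) λ v _ → if-no {b = early 0 v} λ x → case proj₂ (∧-elim {fair v} (proj₂ (∧-elim {S v} x))) of λ ())) z≤n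
      }

    S⇒nothing : ∀ v → T (S v) → old v ≡ nothing
    S⇒nothing v sv with old v
    ... | nothing = refl

    module Step (D≡ : ∀ v a → D v a ≡ dist (E v) a) (j : ℕ) (st : Fin n → Maybe (ℕ × ℕ)) (inv : Inv j st)
                (F : ℕ → ℕ) (F≤1 : ∀ a → F a ≤ 1) (view : Fin n → ℕ → ℕ) (view≡ : ∀ v a → T (B j v a) → view v a ≡ F a) where
      open Inv inv

      wins : (ℕ → ℕ) → Fin n → Bool
      wins F v = succeeds N (A j v) (B j v) F

      centreOf : Fin n → Maybe ℕ
      centreOf v = findᵇ (λ a → B j v a ∧ (view v a ≡ᵇ 1)) (upTo N)

      new : Fin n → Maybe (ℕ × ℕ)
      new v = if succeeds N (A j v) (B j v) (view v) then join (colour j) (centreOf v) (st v) else st v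

      wins≡ : ∀ v → succeeds N (A j v) (B j v) (view v) ≡ wins F v
      wins≡ v = cong₂ (λ x z → (x ≡ᵇ 1) ∧ (z ≡ᵇ 1)) (hits-cong N (A j v) λ a x → view≡ v a (A⊆B j v a x)) (hits-cong N (B j v) (view≡ v))

      Centre : Fin n → ℕ → Set
      Centre v a = T (U j v) × a < N × F a ≡ 1 × T (inner v a) × T (B j v a) × hits N (B j v) F ≡ 1

      won : ∀ v → T (wins F v) → ∃ λ a → new v ≡ just (colour j , a) × Centre v a
      won v wv with ∧-elim {hits N (A j v) F ≡ᵇ 1} wv
      ... | ha , hb with hits-selected N (A j v) F F≤1 (≡ᵇ⇒≡ _ 1 ha)
      ...   | a , a<N , Aa , Fa with ∧-elim {U j v} Aa
      ...     | u , i = a , trans (if-yes (subst T (sym (wins≡ v)) wv)) (cong (λ c → join (colour j) c (st v)) found) ,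
                        u , a<N , Fa , i , A⊆B j v a Aa , ≡ᵇ⇒≡ _ 1 hb
        where
        found : centreOf v ≡ just a
        found = findᵇ-unique _ (upTo N) (∈-upTo⁺ a<N) (∧-intro (A⊆B j v a Aa) (≡⇒≡ᵇ _ 1 (trans (view≡ v a (A⊆B j v a Aa)) Fa)))
          λ c c∈ x → case ∧-elim {B j v c} x of λ where
            (Bc , Fc) → hits-unique N (B j v) F (∈-upTo⁻ c∈) a<N Bc (A⊆B j v a Aa) (trans (sym (view≡ v c Bc)) (≡ᵇ⇒≡ _ 1 Fc)) Fa (≡ᵇ⇒≡ _ 1 hb)

      lost : ∀ v → ¬ T (wins F v) → new v ≡ st v
      lost v ¬w = if-no λ x → ¬w (subst T (wins≡ v) x)

      colour-inj : ∀ {i i′} → colour i ≡ colour i′ → i ≡ i′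
      colour-inj = +-cancelˡ-≡ (b * suc τ) _ _

      st-nothing : ∀ v → T (U j v) → st v ≡ nothing
      st-nothing v u with st v in eq | U-elim j v u
      ... | nothing      | _ = refl
      ... | just (c , a) | sv , _ , e = ⊥-elim (<-irrefl e (proj₁ (proj₂ (shape v c a (S⇒nothing v sv) eq))))

      R : Fin n → ℕ → Set
      R v a = old v ≡ nothing × new v ≡ just (colour j , a)

      st-fresh : ∀ v a → old v ≡ nothing → st v ≢ just (colour j , a)
      st-fresh v a o e = <-irrefl {scale v} (colour-inj {scale v} {j} (sym (proj₁ (shape v (colour j) a o e)))) (proj₁ (proj₂ (shape v (colour j) a o e)))

      R⇒Centre : ∀ v a → R v a → Centre v a
      R⇒Centre v a (o , e) = go (T? (wins F v))
        where
        go : Dec (T (wins F v)) → Centre v a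
        go (no ¬w)  = ⊥-elim (st-fresh v a o (trans (sym (lost v ¬w)) e))
        go (yes wv) = subst (Centre v) (cong proj₂ (just-injective (trans (sym (proj₁ (proj₂ (won v wv)))) e))) (proj₂ (proj₂ (won v wv)))

      module C = Cells G id id-inj N Hc src F v₀

      R-node : ∀ v a → R v a → a < N × F a ≡ 1 × T (C.cell a v)
      R-node v a r with R⇒Centre v a r
      ... | u , a<N , Fa , i , Ba , hb = a<N , Fa , C.cell-intro a v (≤-<-trans (near⇒E D≡ v (width v) a i) (window<Hc D≡ v (width v) (<⇒≤ wτ)))
          λ c c<N c≢a Fc → ≰⇒> λ le → c≢a (hits-unique N (B j v) F c<N a<N
            (∧-intro u (near-mono v (n≤1+n (width v)) c (E⇒near D≡ v (width v) c fv (<⇒≤ wτ) c<N (≤-trans le (near⇒E D≡ v (width v) a i))))) Ba Fc Fa hb)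
        where
        fv = proj₁ (proj₂ (U-elim j v u))
        wτ = Fair.width<τ D≡ v fv

      Centre-fair : ∀ v a → Centre v a → T (fair v)
      Centre-fair v a c = proj₁ (proj₂ (U-elim j v (proj₁ c)))

      R-separate : ∀ v v′ a a′ → R v a → R v′ a′ → a ≢ a′ → ¬ Within G k v v′
      R-separate v v′ a a′ r r′ ne vv′ = go (R⇒Centre v a r) (R⇒Centre v′ a′ r′) (≤-total (width v) (width v′))
        where
        go : Centre v a → Centre v′ a′ → (width v ≤ width v′ ⊎ width v′ ≤ width v) → ⊥
        go c@(u , a<N , Fa , i , Ba , hb) c′@(u′ , a′<N , Fa′ , i′ , Ba′ , hb′) (inj₁ le) =
          ne (hits-unique N (B j v′) F a<N a′<N (∧-intro u′ (transfer D≡ v v′ a (Centre-fair v a c) (Centre-fair v′ a′ c′) le vv′ a<N i)) Ba′ Fa Fa′ hb′)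
        go c@(u , a<N , Fa , i , Ba , hb) c′@(u′ , a′<N , Fa′ , i′ , Ba′ , hb′) (inj₂ le) =
          ne (hits-unique N (B j v) F a<N a′<N Ba (∧-intro u (transfer D≡ v′ v a′ (Centre-fair v′ a′ c′) (Centre-fair v a c) le (Within-sym vv′) a′<N i′)) Fa Fa′ hb)

      split : ∀ v → 𝟙 (early (suc j) v) ≤ 𝟙 (early j v) + 𝟙 (U j v)
      split v = three (S v) (fair v) (scale v)
        where
        three : ∀ x y z → 𝟙 (x ∧ (y ∧ (z <ᵇ suc j))) ≤ 𝟙 (x ∧ (y ∧ (z <ᵇ j))) + 𝟙 (x ∧ (y ∧ (z ≡ᵇ j)))
        three false _     _ = z≤n
        three true  false _ = z≤n
        three true  true  z with T? (z <ᵇ suc j)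
        ... | no ¬lt = ≤-trans (≤-reflexive (if-no ¬lt)) z≤n
        ... | yes lt with m≤n⇒m<n∨m≡n (≤-pred (<ᵇ⇒< z (suc j) lt))
        ...   | inj₁ l = ≤-trans (𝟙≤1 _) (≤-trans (≤-reflexive (sym (if-yes (<⇒<ᵇ l)))) (m≤m+n _ _))
        ...   | inj₂ e = ≤-trans (𝟙≤1 _) (≤-trans (≤-reflexive (sym (if-yes (≡⇒≡ᵇ z j e)))) (m≤n+m _ (𝟙 (z <ᵇ j))))

      joined : ∀ v → 𝟙 (S v ∧ is-just (st v)) + 𝟙 (wins F v) ≤ 𝟙 (S v ∧ is-just (new v))
      joined v = go (T? (wins F v))
        where
        go : Dec (T (wins F v)) → 𝟙 (S v ∧ is-just (st v)) + 𝟙 (wins F v) ≤ 𝟙 (S v ∧ is-just (new v))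
        go (no ¬w)  = ≤-reflexive (trans (cong₂ _+_ (cong (λ z → 𝟙 (S v ∧ is-just z)) (sym (lost v ¬w))) (if-no ¬w)) (+-identityʳ _))
        go (yes wv) = ≤-trans (≤-reflexive (cong₂ _+_ (if-no {b = S v ∧ is-just (st v)} λ x → subst (λ z → T (is-just z)) (st-nothing v u) (proj₂ (∧-elim {S v} x))) (if-yes wv)))
          (≤-reflexive (sym (if-yes (∧-intro (proj₁ (U-elim j v u)) (subst (λ z → T (is-just z)) (sym (proj₁ (proj₂ (won v wv)))) _)))))
          where
          u : T (U j v)
          u = proj₁ (proj₂ (proj₂ (won v wv)))

      count-step : ∣ U j ∣ᵛ ≤ 24 * ∑ (allFin n) (λ v → 𝟙 (wins F v)) → ∣ early (suc j) ∣ᵛ ≤ 24 * ∣ (λ v → S v ∧ is-just (new v)) ∣ᵛ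
      count-step U≤wins = begin
        ∣ early (suc j) ∣ᵛ                                       ≤⟨ ≤-trans (∑-mono (allFin n) split) (≤-reflexive (∑-+ (allFin n) _ _)) ⟩
        ∣ early j ∣ᵛ + ∣ U j ∣ᵛ                                  ≤⟨ +-mono-≤ counted U≤wins ⟩
        24 * ∣ (λ v → S v ∧ is-just (st v)) ∣ᵛ + 24 * W           ≡⟨ sym (*-distribˡ-+ 24 ∣ (λ v → S v ∧ is-just (st v)) ∣ᵛ W) ⟩
        24 * (∣ (λ v → S v ∧ is-just (st v)) ∣ᵛ + W)              ≤⟨ *-monoʳ-≤ 24 (≤-trans (≤-reflexive (sym (∑-+ (allFin n) _ _))) (∑-mono (allFin n) joined)) ⟩
        24 * ∣ (λ v → S v ∧ is-just (new v)) ∣ᵛ                   ∎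
        where
        open ≤-Reasoning
        W = ∑ (allFin n) (λ v → 𝟙 (wins F v))

      kept′ : ∀ v x → old v ≡ just x → new v ≡ just x
      kept′ v x e = go (T? (wins F v))
        where
        go : Dec (T (wins F v)) → new v ≡ just x
        go (no ¬w)  = trans (lost v ¬w) (kept v x e)
        go (yes wv) = ⊥-elim (just≢nothing (trans (sym e) (S⇒nothing v (proj₁ (U-elim j v (proj₁ (proj₂ (proj₂ (won v wv)))))))))
          where
          just≢nothing : just x ≢ nothing
          just≢nothing ()

      shape′ : ∀ v c a → old v ≡ nothing → new v ≡ just (c , a) → c ≡ colour (scale v) × scale v < suc j × a < N
      shape′ v c a o e = go (T? (wins F v))
        where
        go : Dec (T (wins F v)) → c ≡ colour (scale v) × scale v < suc j × a < N
        go (no ¬w)  = let (p₁ , p₂ , p₃) = shape v c a o (trans (sym (lost v ¬w)) e) in p₁ , m<n⇒m<1+n p₂ , p₃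
        go (yes wv) = trans (sym (cong proj₁ same)) (cong colour (sym sc)) , s≤s (≤-reflexive sc) , subst (_< N) (cong proj₂ same) (proj₁ (proj₂ (proj₂ (proj₂ (won v wv)))))
          where
          same : (colour j , proj₁ (won v wv)) ≡ (c , a)
          same = just-injective (trans (sym (proj₁ (proj₂ (won v wv)))) e)
          sc : scale v ≡ j
          sc = proj₂ (proj₂ (U-elim j v (proj₁ (proj₂ (proj₂ (won v wv))))))

      earlier : ∀ i → i < j → ∀ v a → old v ≡ nothing × new v ≡ just (colour i , a) → old v ≡ nothing × st v ≡ just (colour i , a)
      earlier i i<j v a (o , e) = o , go (T? (wins F v))
        where
        go : Dec (T (wins F v)) → st v ≡ just (colour i , a)
        go (no ¬w)  = trans (sym (lost v ¬w)) e
        go (yes wv) = ⊥-elim (<⇒≢ i<j (sym (colour-inj {j} {i} (cong proj₁ (just-injective (trans (sym (proj₁ (proj₂ (won v wv)))) e))))))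

      good′ : ∀ i → i < suc j → ColourOK G k Hc (λ v a → old v ≡ nothing × new v ≡ just (colour i , a))
      good′ i (s≤s i≤) = go (m≤n⇒m<n∨m≡n i≤)
        where
        go : i < j ⊎ i ≡ j → ColourOK G k Hc (λ v a → old v ≡ nothing × new v ≡ just (colour i , a))
        go (inj₁ i<j)  = ColourOK-⊆ (earlier i i<j) (good i i<j)
        go (inj₂ refl) = C.Colour.colourOK k R R-node R-separate

      Inv-step : ∣ U j ∣ᵛ ≤ 24 * ∑ (allFin n) (λ v → 𝟙 (wins F v)) → Inv (suc j) new
      Inv-step U≤wins = record { kept = kept′ ; shape = shape′ ; good = good′ ; counted = count-step U≤wins }

    finish : (Z : Fin n → Bool) → (∀ v → T (S v) → ¬ T (Z v) → T (fair v)) → ∀ st → Inv (suc τ) st → CarveResult b ∣ Z ∣ᵛ old st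
    finish Z unlost st inv = kept , shape″ , good , arith ∣ is-nothing ∘ st ∣ᵛ ∣ S ∣ᵛ ∣ Z ∣ᵛ ∣ early (suc τ) ∣ᵛ ∣ (λ v → S v ∧ is-just (st v)) ∣ᵛ covers counted splits
      where
      open Inv inv
      shape″ : ∀ v c a → old v ≡ nothing → st v ≡ just (c , a) → (∃ λ j → j < suc τ × c ≡ b * suc τ + j) × a < N
      shape″ v c a o e with shape v c a o e
      ... | c≡ , lt , a<N = (scale v , lt , c≡) , a<N
      covers : ∣ S ∣ᵛ ≤ ∣ Z ∣ᵛ + ∣ early (suc τ) ∣ᵛ
      covers = ≤-trans (∑-mono (allFin n) le) (≤-reflexive (∑-+ (allFin n) _ _))
        where
        le : ∀ v → 𝟙 (S v) ≤ 𝟙 (Z v) + 𝟙 (early (suc τ) v)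
        le v with T? (S v) | T? (Z v)
        ... | no ¬s | _     = ≤-trans (≤-reflexive (if-no ¬s)) z≤n
        ... | yes _ | yes z = ≤-trans (𝟙≤1 _) (≤-trans (≤-reflexive (sym (if-yes z))) (m≤m+n _ _))
        ... | yes x | no ¬z = ≤-trans (𝟙≤1 _) (≤-trans (≤-reflexive (sym (if-yes (∧-intro x (∧-intro (unlost v x ¬z) (<⇒<ᵇ (s≤s (least≤ _ τ)))))))) (m≤n+m _ (𝟙 (Z v))))
      splits : ∣ is-nothing ∘ st ∣ᵛ + ∣ (λ v → S v ∧ is-just (st v)) ∣ᵛ ≤ ∣ S ∣ᵛ
      splits = ≤-trans (≤-reflexive (sym (∑-+ (allFin n) _ _))) (∑-mono (allFin n) le)
        where
        le : ∀ v → 𝟙 (is-nothing (st v)) + 𝟙 (S v ∧ is-just (st v)) ≤ 𝟙 (S v)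
        le v with old v in eo | st v in es
        ... | nothing | nothing = ≤-refl
        ... | nothing | just _  = ≤-refl
        ... | just x  | just _  = z≤n
        ... | just x  | nothing = case trans (sym es) (kept v x eo) of λ ()
      arith : ∀ x S z e c → S ≤ z + e → e ≤ 24 * c → x + c ≤ S → 24 * x ≤ 23 * S + z
      arith x S z e c h₁ h₂ h₃ = +-cancelʳ-≤ (24 * c + S) _ _ (begin
        24 * x + (24 * c + S)       ≡⟨ e₁ x c S ⟩
        24 * (x + c) + S            ≤⟨ +-mono-≤ (*-monoʳ-≤ 24 h₃) (≤-trans h₁ (+-monoʳ-≤ z h₂)) ⟩
        24 * S + (z + 24 * c)       ≡⟨ e₂ S z c ⟩
        23 * S + z + (24 * c + S)   ∎)
        where
        open ≤-Reasoning
        e₁ : ∀ x c S → 24 * x + (24 * c + S) ≡ 24 * (x + c) + S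
        e₁ = solve-∀
        e₂ : ∀ S z c → 24 * S + (z + 24 * c) ≡ 23 * S + z + (24 * c + S)
        e₂ = solve-∀

    module Run (D≡ : ∀ v a → D v a ≡ dist (E v) a) (s : Fin n → ℕ → ℕ) (s≡ : ∀ v a → s v a ≡ slot (E v) a) where
      slots : IsSlots G id t s
      slots = IsSlots-cong s≡ (Detect.E-slots G id id-inj N id<N bw fits-ids Hc Λ₂ src)
      open IsSlots slots using (node)

      B-listed : ∀ j v a → T (B j v a) → s v a < t
      B-listed j v a x = subst (_< t) (sym (trans (s≡ v a) (if-yes tp))) (+-mono-< (proj₁ (top-elim (E v) {a} tp)) (proj₂ (top-elim (E v) {a} tp)))
        where
        tp : T (top (E v) a)
        tp = near⇒top D≡ v (suc (width v)) a (Fair.width<τ D≡ v (proj₁ (proj₂ (U-elim j v (proj₁ (B-near v j a x)))))) (proj₂ (B-near v j a x))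

      module _ (p : Fin n → ℕ → Maybe (ℕ × ℕ)) (parents : IsParents G id t s p) (j : ℕ) (j≤ : j < suc τ) where

        F₀ : ℕ → ℕ
        F₀ = lift (λ _ → 1)

        F₀≤1 : ∀ a → F₀ a ≤ 1
        F₀≤1 = lift-≤ (λ _ → 1) 1 λ _ → ≤-refl

        J≤ : suc j ≤ Jmax
        J≤ = ≤-trans j≤ τ<

        Selected : (Fin n → ℕ × (ℕ → ℕ)) → (ℕ → ℕ) → Set
        Selected = Isolate.Selected 𝒮 t s slots p parents (suc j) 1 0 J≤ (A j) (B j) (A⊆B j) (B-listed j) F₀ F₀≤1

        B⇒F₀ : ∀ v a → T (B j v a) → F₀ a ≡ 1
        B⇒F₀ v a x = let (u , e) = node v a (B-listed j v a x) in trans (cong F₀ (sym e)) (lift-id (λ _ → 1) u)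

        view≡ : ∀ yy F → Selected yy F → ∀ v a → T (B j v a) → proj₂ (yy v) a ≡ F a
        view≡ yy F sel v a x = let (u , e) = node v a (B-listed j v a x) in
          subst (λ c → proj₂ (yy v) c ≡ F c) e (proj₂ (proj₁ sel) v u (subst (λ c → s v c < t) (sym e) (B-listed j v a x)))

        U≤wins : ∀ yy F → Selected yy F → ∣ U j ∣ᵛ ≤ 24 * ∑ (allFin n) (λ v → 𝟙 (succeeds N (A j v) (B j v) F))
        U≤wins yy F sel = *-cancelˡ-≤ (2 ^ suc j) {{m^n≢0 2 (suc j)}} (begin
          2 ^ suc j * ∣ U j ∣ᵛ                                       ≡⟨ cong (_* ∣ U j ∣ᵛ) (sym (*-identityˡ (2 ^ suc j))) ⟩
          1 * 2 ^ suc j * ∣ U j ∣ᵛ                                   ≤⟨ m≤n+m _ _ ⟩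
          24 * 2 ^ suc j * (0 * ∑ (upTo N) F) + 1 * 2 ^ suc j * ∣ U j ∣ᵛ ≤⟨ star ⟩
          24 * (0 * ∑ (upTo N) F₀) + 24 * (1 * 2 ^ suc j) * W       ≡⟨ e (2 ^ suc j) W ⟩
          2 ^ suc j * (24 * W)                                       ∎)
          where
          open ≤-Reasoning
          W = ∑ (allFin n) (λ v → 𝟙 (succeeds N (A j v) (B j v) F))
          e : ∀ P W → 24 * (0 * 0) + 24 * (1 * P) * W ≡ P * (24 * W)
          e = solve-∀
          scaleOK : ∀ v → T (U j v) → 2 * count N (B j v) ≤ 2 ^ suc j × 2 ^ suc j ≤ 8 * count N (A j v)
          scaleOK v u with U-elim j v u
          ... | _ , fv , sc =
            *-monoʳ-≤ 2 (≤-trans (count-mono N λ a _ x → proj₂ (∧-elim {U j v} x)) (≤-trans (Fair.outer≤ D≡ v fv) (≤-reflexive (cong (2 ^_) sc)))) ,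
            ≤-trans (≤-trans (≤-reflexive (cong (λ z → 2 ^ suc z) (sym sc))) (Fair.scale≤ D≡ v fv)) (*-monoʳ-≤ 8 (count-mono N λ a _ x → ∧-intro u x))
          star = Isolation.Result.isolation N (A j) (B j) (A⊆B j) ξ m (suc j) β₀ N≤ β₀< 1 0 (small-at J≤) (U j) scaleOK
                   (λ v ¬u a x → ¬u (proj₁ (∧-elim {U j v} x))) F₀ F F₀≤1 (proj₁ (proj₂ sel))
                   B⇒F₀ (proj₂ (proj₂ (proj₂ sel)))

        Spec-round : ∀ st → Inv j st → Spec (isolateRounds ξ m (suc j) t) (λ v → carveRound v b (S v) (D v) (s v) (p v) j (st v)) (Inv (suc j))
        Spec-round st inv = Spec-map (λ v yy → if succeeds N (A j v) (B j v) (proj₂ yy) then join (colour j) (findᵇ (λ a → B j v a ∧ (proj₂ yy a ≡ᵇ 1)) (upTo N)) (st v) else st v)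
          (Isolate.Spec-isolate 𝒮 t s slots p parents (suc j) 1 0 J≤ (A j) (B j) (A⊆B j) (B-listed j) F₀ F₀≤1 (λ _ → 1) (λ v → sym (lift-id (λ _ → 1) v)))
          λ yy sel → Step.Inv-step D≡ j st inv (proj₁ sel) (proj₁ (proj₂ (proj₂ sel))) (proj₂ ∘ yy) (view≡ yy (proj₁ sel) (proj₂ sel)) (U≤wins yy (proj₁ sel) (proj₂ sel))

  carveTime : ℕ
  carveTime = t + (t + suc τ * isolateRounds ξ m (suc τ) t)

  Spec-carve : ∀ b (lev : Fin n → ℕ) (old : Fin n → Maybe (ℕ × ℕ)) → (∀ v → lev v < L) → (Z : Fin n → Bool) →
    (∀ v → T (is-nothing (old v)) → ¬ T (Z v) → ∀ j → j < L → Unbeaten 𝒮 Hc Λ (λ u → j ≤ᵇ lev u) (λ u → suc j ≤ᵇ lev u) v) →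
    Spec carveTime (λ v → carve v b (lev v) (old v)) (CarveResult b ∣ Z ∣ᵛ old)
  Spec-carve b lev old lev< Z unb = Spec-bind (Detect.Spec-detect G id id-inj N id<N bw fits-ids Hc Λ₂ _) λ ds ds≡ →
    Spec-bind (Relay.Spec-setup G id id-inj N id<N bw cap fits t (proj₂ ∘ ds) (Rounds.Run.slots b lev old (proj₁ ∘ ds) (proj₁ ds≡) (proj₂ ∘ ds) (proj₂ ds≡))) λ p parents →
    Spec-weaken ≤-refl
      (Rounds.finish b lev old (proj₁ ∘ ds) Z λ v sv ¬z → Geometry.fair-if-unbeaten lev (proj₁ ∘ ds) (proj₁ ds≡) v lev< (unb v sv ¬z))
      (Spec-loop (Rounds.Inv b lev old (proj₁ ∘ ds)) (suc τ) (Rounds.start b lev old (proj₁ ∘ ds))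
        λ j st j< inv → Spec-weaken (rounds-mono j<) (λ _ φ → φ)
          (Rounds.Run.Spec-round b lev old (proj₁ ∘ ds) (proj₁ ds≡) (proj₂ ∘ ds) (proj₂ ds≡) p parents j j< st inv))
    where
    rounds-mono : ∀ {j} → j < suc τ → isolateRounds ξ m (suc j) t ≤ isolateRounds ξ m (suc τ) t
    rounds-mono j< = +-monoʳ-≤ t (+-monoʳ-≤ t (*-monoˡ-≤ _ j<))

-- The complete algorithm

module BatchProgram (bw N cap : ℕ) (nbrs : List ℕ) (me : ℕ) (ξ m β₀ Hc J′ R y L w τ Λ₂ h batches : ℕ) where

  batch : ℕ → Maybe (ℕ × ℕ) → Proc (Maybe (ℕ × ℕ))
  batch b old = LevelsProgram.levels bw N cap nbrs me ξ m β₀ Hc J′ R y L b (is-nothing old) >>= λ lev →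
                CarveProgram.carve bw N cap nbrs me ξ m β₀ Hc w τ Λ₂ L h b lev old

  label : Maybe (ℕ × ℕ) → ℕ × ℕ
  label nothing        = 0 , 0
  label (just (c , a)) = a + c * N , c

  decompose : Proc (ℕ × ℕ)
  decompose = loop batches batch nothing >>= λ res → done (label res)

tree-walk : ∀ {n} {G : Graph n} {S : STree G} {C ρ} → IsSteinerTree G S C ρ → ∀ v → InTree S v → Within G ρ v (root S)
tree-walk {G = G} {S} st v t with IsSteinerTree.radius st v t
... | m , m≤ , e = Walks.Within-mono G m≤ (go m v t e)
  where
  go : ∀ m v → InTree S v → iter (parent S) m v ≡ root S → Within G m v (root S)
  go m v t e with v FinP.≟ root S
  ... | yes refl = here′
  go zero    v t e | no v≢ = ⊥-elim (v≢ e)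
  go (suc m) v t e | no v≢ = let (t′ , a) = IsSteinerTree.parent-ok st v t v≢ in
    step′ a (go m (parent S v) t′ (trans (iter-shift (parent S) m v) e))

module Batches {n : ℕ} (𝒮 : Setting n) (k τ L w h Hc Λ₂ J′ R y batches : ℕ)
               (τ< : suc τ ≤ Setting.Jmax 𝒮) (J≤ : suc J′ ≤ Setting.Jmax 𝒮)
               (shrink : R * 1153 * 2 ^ y ≤ 2 ^ suc J′) (n< : n < 2 ^ (y * L))
               (w≡ : w ≡ 2 * k) (h> : τ * w < h) (Hc> : L * h + τ * w < Hc)
               (Λ₂> : L * 2 ^ J′ < Λ₂) (Λ₂≤ : Λ₂ ≤ 2 ^ τ)
               (losses : 8 * L * 47 ^ R ≤ 48 ^ R) (enough : n * 47 ^ batches < 48 ^ batches) (v₀ : Fin n) where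
  open Setting 𝒮
  open Execution G id bw

  open module Prog v = BatchProgram bw N cap (nbrs v) (id v) ξ m β₀ Hc J′ R y L w τ Λ₂ h batches using (batch; decompose)
  open BatchProgram bw N cap [] 0 ξ m β₀ Hc J′ R y L w τ Λ₂ h batches using (label)

  record Inv (b : ℕ) (res : Fin n → Maybe (ℕ × ℕ)) : Set where
    field
      range : ∀ v c a → res v ≡ just (c , a) → c < b * suc τ × a < N
      good  : ∀ c → ColourOK G k Hc (λ v a → res v ≡ just (c , a))
      rest  : ∣ is-nothing ∘ res ∣ᵛ * 48 ^ b ≤ n * 47 ^ b

  private
    rest-step : ∀ b x x′ z → x * 48 ^ b ≤ n * 47 ^ b → z * 48 ^ (b + R) ≤ L * (n * 47 ^ (b + R)) → 24 * x′ ≤ 23 * x + z →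
                x′ * 48 ^ suc b ≤ n * 47 ^ suc b
    rest-step b x x′ z hx hz h = *-cancelˡ-≤ 4 (begin
      4 * (x′ * (48 * 48 ^ b))                        ≡⟨ e₁ x′ (48 ^ b) ⟩
      8 * (24 * x′) * 48 ^ b                          ≤⟨ *-monoˡ-≤ (48 ^ b) (*-monoʳ-≤ 8 h) ⟩
      8 * (23 * x + z) * 48 ^ b                       ≡⟨ e₂ x z (48 ^ b) ⟩
      184 * (x * 48 ^ b) + 8 * z * 48 ^ b             ≤⟨ +-mono-≤ (*-monoʳ-≤ 184 hx) z-small ⟩
      184 * (n * 47 ^ b) + n * 47 ^ b                 ≤⟨ m≤m+n _ (3 * (n * 47 ^ b)) ⟩
      184 * (n * 47 ^ b) + n * 47 ^ b + 3 * (n * 47 ^ b) ≡⟨ e₃ n (47 ^ b) ⟩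
      4 * (n * (47 * 47 ^ b))                         ∎)
      where
      open ≤-Reasoning
      e₁ : ∀ x p → 4 * (x * (48 * p)) ≡ 8 * (24 * x) * p
      e₁ = solve-∀
      e₂ : ∀ x z p → 8 * (23 * x + z) * p ≡ 184 * (x * p) + 8 * z * p
      e₂ = solve-∀
      e₃ : ∀ n p → 184 * (n * p) + n * p + 3 * (n * p) ≡ 4 * (n * (47 * p))
      e₃ = solve-∀
      z-small : 8 * z * 48 ^ b ≤ n * 47 ^ b
      z-small = *-cancelʳ-≤ (8 * z * 48 ^ b) (n * 47 ^ b) (48 ^ R) {{m^n≢0 48 R}} (begin
        8 * z * 48 ^ b * 48 ^ R               ≡⟨ trans (e₄ z (48 ^ b) (48 ^ R)) (cong (λ p → 8 * (z * p)) (sym (^-distribˡ-+-* 48 b R))) ⟩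
        8 * (z * 48 ^ (b + R))                ≤⟨ *-monoʳ-≤ 8 hz ⟩
        8 * (L * (n * 47 ^ (b + R)))          ≡⟨ trans (cong (λ p → 8 * (L * (n * p))) (^-distribˡ-+-* 47 b R)) (e₅ L n (47 ^ b) (47 ^ R)) ⟩
        n * 47 ^ b * (8 * L * 47 ^ R)         ≤⟨ *-monoʳ-≤ (n * 47 ^ b) losses ⟩
        n * 47 ^ b * 48 ^ R                   ∎)
        where
        e₄ : ∀ z p q → 8 * z * p * q ≡ 8 * (z * (p * q))
        e₄ = solve-∀
        e₅ : ∀ L n p q → 8 * (L * (n * (p * q))) ≡ n * p * (8 * L * q)
        e₅ = solve-∀

    Inv-step : ∀ b res → Inv b res → ∀ z → z * 48 ^ (b + R) ≤ L * (n * 47 ^ (b + R)) → ∀ new → Carve.CarveResult 𝒮 k τ L (2 ^ J′) w h Hc Λ₂ τ< w≡ h> Hc> Λ₂> Λ₂≤ v₀ b z res new → Inv (suc b) new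
    Inv-step b res inv z hz new (kept , shape , colours , counted) = record
      { range = range′ ; good = good′ ; rest = rest-step b ∣ is-nothing ∘ res ∣ᵛ ∣ is-nothing ∘ new ∣ᵛ z rest hz counted }
      where
      open Inv inv
      cases : ∀ v c a → new v ≡ just (c , a) →
              (res v ≡ just (c , a) × c < b * suc τ) ⊎ (res v ≡ nothing × (∃ λ j → j < suc τ × c ≡ b * suc τ + j) × a < N)
      cases v c a e with res v in eq
      ... | nothing = inj₂ (refl , shape v c a eq e)
      ... | just x with just-injective (trans (sym (kept v x eq)) e)
      ...   | refl = inj₁ (refl , proj₁ (range v c a eq))
      range′ : ∀ v c a → new v ≡ just (c , a) → c < suc b * suc τ × a < N
      range′ v c a e with cases v c a e
      ... | inj₁ (r , _) = <-≤-trans (proj₁ (range v c a r)) (m≤n+m _ (suc τ)) , proj₂ (range v c a r)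
      ... | inj₂ (_ , (j , j< , refl) , a<N) = subst (b * suc τ + j <_) (+-comm (b * suc τ) (suc τ)) (+-monoʳ-< (b * suc τ) j<) , a<N
      good′ : ∀ c → ColourOK G k Hc (λ v a → new v ≡ just (c , a))
      good′ c with c <? b * suc τ
      ... | yes c< = ColourOK-⊆ sub (good c)
        where
        sub : ∀ v a → new v ≡ just (c , a) → res v ≡ just (c , a)
        sub v a e with cases v c a e
        ... | inj₁ (r , _) = r
        ... | inj₂ (_ , (j , _ , refl) , _) = ⊥-elim (<⇒≱ c< (m≤m+n _ j))
      ... | no c≥ with c ∸ b * suc τ <? suc τ
      ...   | yes j< = ColourOK-⊆ sub (colours (c ∸ b * suc τ) j<)
        where
        sub : ∀ v a → new v ≡ just (c , a) → res v ≡ nothing × new v ≡ just (b * suc τ + (c ∸ b * suc τ) , a)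
        sub v a e with cases v c a e
        ... | inj₁ (_ , c<) = ⊥-elim (c≥ c<)
        ... | inj₂ (r , _)  = r , trans e (cong (λ x → just (x , a)) (sym (m+[n∸m]≡n (≮⇒≥ c≥))))
      ...   | no j≥ = ColourOK-∅ v₀ none
        where
        none : ∀ v a → ¬ (new v ≡ just (c , a))
        none v a e with cases v c a e
        ... | inj₁ (_ , c<) = c≥ c<
        ... | inj₂ (_ , (j , j< , refl) , _) = j≥ (subst (_< suc τ) (sym (m+n∸m≡n (b * suc τ) j)) j<)

    start : Inv 0 (λ _ → nothing)
    start = record
      { range = λ _ _ _ ()
      ; good  = λ c → ColourOK-∅ v₀ λ _ _ ()
      ; rest  = *-monoˡ-≤ 1 (≤-reflexive (trans (∑-const (allFin n) 1) (trans (*-identityʳ _) (length-allFin n))))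
      }

  batchTime : ℕ
  batchTime = Levels.levelsTime 𝒮 Hc J′ R y L J≤ shrink n< + Carve.carveTime 𝒮 k τ L (2 ^ J′) w h Hc Λ₂ τ< w≡ h> Hc> Λ₂> Λ₂≤ v₀

  Decomposition : (Fin n → ℕ × ℕ) → Set
  Decomposition out = IsNetworkDecomposition G (proj₁ ∘ out) (proj₂ ∘ out) (batches * suc τ) k (Hc + Hc) ×
    Σ (ℕ → STree G) λ tr → (∀ c → IsSteinerTree G (tr c) (λ v → proj₁ (out v) ≡ c) Hc) ×
      (∀ u v → proj₂ (out u) ≡ proj₂ (out v) → proj₁ (out u) ≢ proj₁ (out v) →
         ∀ a b → TreeEdge (tr (proj₁ (out u))) a b → ¬ TreeEdge (tr (proj₁ (out v))) a b)

  private
    finish : ∀ res → Inv batches res → Decomposition (label ∘ res)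
    finish res inv = record
      { color-bound   = λ v → subst (_< batches * suc τ) (sym (cong proj₂ (out≡ v))) (proj₁ (range′ v))
      ; cluster-color = λ u v e → trans (cong proj₂ (out≡ u)) (trans (proj₁ (same u v e)) (sym (cong proj₂ (out≡ v))))
      ; weak-diameter = λ u v e → Walks.Within-trans G (walk u) (subst (λ x → Within G Hc (root (tr x)) v) (sym e) (Walks.Within-sym G (walk v)))
      ; separated     = λ u v ec ne → ColourOK.separate (good (cOf u)) u v (aOf u) (aOf v) (res≡ u)
                          (trans (res≡ v) (cong (λ c → just (c , aOf v)) (sym (colour≡ u v ec)))) (λ ea → ne (clusters u v ec ea))
      } , tr , trees , disj
      where
      open Inv inv
      assigned : ∀ v → ∃ λ ca → res v ≡ just ca
      assigned v with res v in eq
      ... | just ca = ca , refl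
      ... | nothing = ⊥-elim (<⇒≱ enough (≤-trans (≤-trans (≤-reflexive (sym (*-identityˡ _))) (*-monoˡ-≤ (48 ^ batches)
              (≤-trans (≤-reflexive (sym (cong (𝟙 ∘ is-nothing) eq))) (term≤∑ (allFin n) {𝟙 ∘ is-nothing ∘ res} (∈-allFin v))))) rest))
      cOf aOf : Fin n → ℕ
      cOf v = proj₁ (proj₁ (assigned v))
      aOf v = proj₂ (proj₁ (assigned v))
      res≡ : ∀ v → res v ≡ just (cOf v , aOf v)
      res≡ v = proj₂ (assigned v)
      out≡ : ∀ v → label (res v) ≡ (aOf v + cOf v * N , cOf v)
      out≡ v = cong label (res≡ v)
      range′ : ∀ v → cOf v < batches * suc τ × aOf v < N
      range′ v = range v (cOf v) (aOf v) (res≡ v)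
      same : ∀ u v → proj₁ (label (res u)) ≡ proj₁ (label (res v)) → cOf u ≡ cOf v × aOf u ≡ aOf v
      same u v e with pair-inj N (cOf u) (cOf v) (proj₂ (range′ u)) (proj₂ (range′ v)) (trans (sym (cong proj₁ (out≡ u))) (trans e (cong proj₁ (out≡ v))))
      ... | ea , ec = ec , ea
      colour≡ : ∀ u v → proj₂ (label (res u)) ≡ proj₂ (label (res v)) → cOf u ≡ cOf v
      colour≡ u v e = trans (sym (cong proj₂ (out≡ u))) (trans e (cong proj₂ (out≡ v)))
      clusters : ∀ u v → proj₂ (label (res u)) ≡ proj₂ (label (res v)) → aOf u ≡ aOf v → proj₁ (label (res u)) ≡ proj₁ (label (res v))
      clusters u v ec ea = trans (cong proj₁ (out≡ u)) (trans (cong₂ (λ a c → a + c * N) ea (colour≡ u v ec)) (sym (cong proj₁ (out≡ v))))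
      instance
        N≢0 : NonZero N
        N≢0 = >-nonZero (≤-<-trans z≤n (id<N v₀))
      tr : ℕ → STree G
      tr x = ColourOK.tree (good (x / N)) (x % N)
      decode : ∀ v → (proj₁ (label (res v)) / N ≡ cOf v) × (proj₁ (label (res v)) % N ≡ aOf v)
      decode v rewrite cong proj₁ (out≡ v) =
        trans (+-distrib-/-∣ʳ (aOf v) (divides (cOf v) refl)) (cong₂ _+_ (m<n⇒m/n≡0 (proj₂ (range′ v))) (m*n/n≡m (cOf v) N)) ,
        trans ([m+kn]%n≡m%n (aOf v) (cOf v) N) (m<n⇒m%n≡m (proj₂ (range′ v)))
      res-at : ∀ v → res v ≡ just (proj₁ (label (res v)) / N , proj₁ (label (res v)) % N)
      res-at v = trans (res≡ v) (sym (cong₂ (λ c a → just (c , a)) (proj₁ (decode v)) (proj₂ (decode v))))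
      trees : ∀ x → IsSteinerTree G (tr x) (λ v → proj₁ (label (res v)) ≡ x) Hc
      trees x = record
        { root-in   = IsSteinerTree.root-in st
        ; parent-ok = IsSteinerTree.parent-ok st
        ; radius    = IsSteinerTree.radius st
        ; terminals = λ v e → IsSteinerTree.terminals st v (subst (λ z → res v ≡ just (z / N , z % N)) e (res-at v))
        }
        where st = ColourOK.steiner (good (x / N)) (x % N)
      walk : ∀ v → Within G Hc v (root (tr (proj₁ (label (res v)))))
      walk v = tree-walk (trees (proj₁ (label (res v)))) v (IsSteinerTree.terminals (trees (proj₁ (label (res v)))) v refl)
      tr≡ : ∀ v → tr (proj₁ (label (res v))) ≡ ColourOK.tree (good (cOf v)) (aOf v)
      tr≡ v = cong₂ (λ c a → ColourOK.tree (good c) a) (proj₁ (decode v)) (proj₂ (decode v))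
      disj : ∀ u v → proj₂ (label (res u)) ≡ proj₂ (label (res v)) → proj₁ (label (res u)) ≢ proj₁ (label (res v)) →
             ∀ a b → TreeEdge (tr (proj₁ (label (res u)))) a b → ¬ TreeEdge (tr (proj₁ (label (res v)))) a b
      disj u v ec ne a b e e′ = ColourOK.disjoint (good (cOf u)) u v (aOf u) (aOf v) (res≡ u)
        (trans (res≡ v) (cong (λ c → just (c , aOf v)) (sym (colour≡ u v ec)))) (λ ea → ne (clusters u v ec ea)) a b
        (subst (λ S → TreeEdge S a b) (tr≡ u) e)
        (subst (λ S → TreeEdge S a b) (trans (tr≡ v) (cong (λ c → ColourOK.tree (good c) (aOf v)) (sym (colour≡ u v ec)))) e′)

  Spec-decompose : Spec (batches * batchTime) decompose Decomposition
  Spec-decompose = Spec-map (λ _ → label) (Spec-loop Inv batches start body) finish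
    where
    body : ∀ b res → b < batches → Inv b res → Spec batchTime (λ v → batch v b (res v)) (Inv (suc b))
    body b res _ inv = Spec-bind (Levels.Spec-levels 𝒮 Hc J′ R y L J≤ shrink n< b (is-nothing ∘ res) (Inv.rest inv)) λ lev ok →
      Spec-weaken ≤-refl (λ new cr → Inv-step b res inv _ (proj₁ (proj₂ (proj₂ ok))) new cr)
        (Carve.Spec-carve 𝒮 k τ L (2 ^ J′) w h Hc Λ₂ τ< w≡ h> Hc> Λ₂> Λ₂≤ v₀ b lev res (proj₁ ok) (proj₁ (proj₂ ok)) (proj₂ (proj₂ (proj₂ ok))))

-- Logarithms

lg-upper : ∀ n → n < 2 ^ lg n
lg-upper n = ≰⇒> λ le → <⇒≱ (≤-reflexive (+-comm 1 ⌊log₂ n ⌋))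
  (subst (_≤ ⌊log₂ n ⌋) (⌊log₂[2^n]⌋≡n (lg n)) (⌊log₂⌋-mono-≤ le))

2^⌊log₂⌋≤ : ∀ n → 1 ≤ n → 2 ^ ⌊log₂ n ⌋ ≤ n
2^⌊log₂⌋≤ n = go n n ≤-refl
  where
  double : ∀ n → 2 * ⌊ n /2⌋ ≤ n
  double zero          = z≤n
  double (suc zero)    = z≤n
  double (suc (suc n)) = ≤-trans (≤-reflexive (*-suc 2 ⌊ n /2⌋)) (s≤s (s≤s (double n)))
  go : ∀ f n → n ≤ f → 1 ≤ n → 2 ^ ⌊log₂ n ⌋ ≤ n
  go (suc f) 1 _ _ = ≤-reflexive (cong (2 ^_) (⌊log₂[2^n]⌋≡n 0))
  go (suc f) n@(suc (suc n′)) (s≤s n≤f) _ = begin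
    2 ^ ⌊log₂ n ⌋                   ≡⟨ cong (2 ^_) (sym (m+[n∸m]≡n log≥1)) ⟩
    2 * 2 ^ (⌊log₂ n ⌋ ∸ 1)         ≡⟨ cong (λ e → 2 * 2 ^ e) (sym (⌊log₂⌊n/2⌋⌋≡⌊log₂n⌋∸1 n)) ⟩
    2 * 2 ^ ⌊log₂ ⌊ n /2⌋ ⌋         ≤⟨ *-monoʳ-≤ 2 (go f ⌊ n /2⌋ (≤-trans (s≤s (⌊n/2⌋≤n n′)) n≤f) (s≤s z≤n)) ⟩
    2 * ⌊ n /2⌋                     ≤⟨ double n ⟩
    n                               ∎
    where
    open ≤-Reasoning
    log≥1 : 1 ≤ ⌊log₂ n ⌋
    log≥1 = subst (_≤ ⌊log₂ n ⌋) (⌊log₂[2^n]⌋≡n 1) (⌊log₂⌋-mono-≤ {2} {n} (s≤s (s≤s z≤n)))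

lg-lower : ∀ n → 1 ≤ n → 2 ^ lg n ≤ 2 * n
lg-lower n n≥1 = ≤-trans (≤-reflexive (cong (2 ^_) (+-comm ⌊log₂ n ⌋ 1))) (*-monoʳ-≤ 2 (2^⌊log₂⌋≤ n n≥1))

lg-mono : ∀ {a b} → a ≤ b → lg a ≤ lg b
lg-mono le = +-monoˡ-≤ 1 (⌊log₂⌋-mono-≤ le)

lg≥1 : ∀ n → 1 ≤ lg n
lg≥1 n = m≤n+m 1 ⌊log₂ n ⌋

lg≤ : ∀ z e → 1 ≤ e → z < 2 ^ e → lg z ≤ e
lg≤ zero    e e≥1 _  = ≤-trans (+-monoˡ-≤ 1 (≤-trans (⌊log₂⌋-mono-≤ {0} {1} z≤n) (≤-reflexive (⌊log₂[2^n]⌋≡n 0)))) e≥1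
lg≤ (suc z) e _ z< = ≤-trans (≤-reflexive (+-comm ⌊log₂ suc z ⌋ 1))
  (≰⇒> λ le → <⇒≱ z< (≤-trans (^-monoʳ-≤ 2 le) (2^⌊log₂⌋≤ (suc z) (s≤s z≤n))))

lg-* : ∀ a b → lg (a * b) ≤ lg a + lg b
lg-* a b = lg≤ (a * b) (lg a + lg b) (≤-trans (lg≥1 a) (m≤m+n _ _))
  (subst (a * b <_) (sym (^-distribˡ-+-* 2 (lg a) (lg b))) (*-mono-< (lg-upper a) (lg-upper b)))

n<2^n : ∀ n → n < 2 ^ n
n<2^n zero    = s≤s z≤n
n<2^n (suc n) = ≤-trans (+-mono-≤ (m^n>0 2 n) (n<2^n n)) (≤-reflexive (cong (2 ^ n +_) (sym (+-identityʳ _))))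

lg≤suc : ∀ n → lg n ≤ suc n
lg≤suc n = lg≤ n (suc n) (s≤s z≤n) (<-trans (n<2^n n) (^-monoʳ-< 2 (s≤s (s≤s z≤n)) (n<1+n n)))

decay : ∀ j → 2 ^ j * 47 ^ (48 * j) ≤ 48 ^ (48 * j)
decay j = begin
  2 ^ j * 47 ^ (48 * j)      ≡⟨ cong (2 ^ j *_) (sym (^-*-assoc 47 48 j)) ⟩
  2 ^ j * (47 ^ 48) ^ j      ≡⟨ sym (^-distribʳ-* j 2 (47 ^ 48)) ⟩
  (2 * 47 ^ 48) ^ j          ≤⟨ ^-monoˡ-≤ j halving ⟩
  (48 ^ 48) ^ j              ≡⟨ ^-*-assoc 48 48 j ⟩
  48 ^ (48 * j)              ∎
  where
  open ≤-Reasoning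
  halving : 2 * 47 ^ 48 ≤ 48 ^ 48
  halving = ≤ᵇ⇒≤ (2 * 47 ^ 48) (48 ^ 48) tt
  ^-distribʳ-* : ∀ j a b → (a * b) ^ j ≡ a ^ j * b ^ j
  ^-distribʳ-* zero    a b = refl
  ^-distribʳ-* (suc j) a b = trans (cong (a * b *_) (^-distribʳ-* j a b)) (e a b (a ^ j) (b ^ j))
    where
    e : ∀ a b c d → a * b * (c * d) ≡ a * c * (b * d)
    e = solve-∀

-- Orders of growth in n and k

record Point : Set where
  field
    n k : ℕ
    n≥1 : 1 ≤ n
    k≥1 : 1 ≤ k

  lgₙ lglgₙ : ℕ
  lgₙ = lg n
  lglgₙ = lg lgₙ

open Point using (lgₙ; lglgₙ)

monomial : ℕ → ℕ → ℕ → Point → ℕ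
monomial a b c p = Point.k p ^ a * (lgₙ p ^ b * lglgₙ p ^ c)

1≤^ : ∀ {x} → 1 ≤ x → ∀ e → 1 ≤ x ^ e
1≤^ {x} x≥1 e = subst (_≤ x ^ e) (^-zeroˡ e) (^-monoˡ-≤ e x≥1)

monomial≥1 : ∀ a b c p → 1 ≤ monomial a b c p
monomial≥1 a b c p = *-mono-≤ {1} (1≤^ (Point.k≥1 p) a) (*-mono-≤ {1} (1≤^ (lg≥1 (Point.n p)) b) (1≤^ (lg≥1 (lgₙ p)) c))

monomial-mono : ∀ {a b c a′ b′ c′} → a ≤ a′ → b ≤ b′ → c ≤ c′ → ∀ p → monomial a b c p ≤ monomial a′ b′ c′ p
monomial-mono ha hb hc p = *-mono-≤ (^-monoʳ-≤ (Point.k p) {{>-nonZero (Point.k≥1 p)}} ha)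
  (*-mono-≤ (^-monoʳ-≤ (lgₙ p) {{>-nonZero (lg≥1 (Point.n p))}} hb) (^-monoʳ-≤ (lglgₙ p) {{>-nonZero (lg≥1 (lgₙ p))}} hc))

record Order (f : Point → ℕ) (a b c : ℕ) : Set where
  constructor order
  field
    factor : ℕ
    bound  : ∀ p → f p ≤ factor * monomial a b c p

private variable
  f g : Point → ℕ
  a b c a′ b′ c′ : ℕ

O-≤ : (∀ p → f p ≤ g p) → Order g a b c → Order f a b c
O-≤ h (order d i) = order d λ p → ≤-trans (h p) (i p)

O-weaken : a ≤ a′ → b ≤ b′ → c ≤ c′ → Order f a b c → Order f a′ b′ c′
O-weaken ha hb hc (order d i) = order d λ p → ≤-trans (i p) (*-monoʳ-≤ d (monomial-mono ha hb hc p))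

O-const : ∀ x → Order (λ _ → x) a b c
O-const {a} {b} {c} x = order x λ p → ≤-trans (≤-reflexive (sym (*-identityʳ x))) (*-monoʳ-≤ x (monomial≥1 a b c p))

O-+ : Order f a b c → Order g a b c → Order (λ p → f p + g p) a b c
O-+ {a = a} {b} {c} (order d i) (order e j) =
  order (d + e) λ p → ≤-trans (+-mono-≤ (i p) (j p)) (≤-reflexive (sym (*-distribʳ-+ (monomial a b c p) d e)))

O-suc : Order f a b c → Order (λ p → suc (f p)) a b c
O-suc i = O-+ (O-const 1) i

O-* : Order f a b c → Order g a′ b′ c′ → Order (λ p → f p * g p) (a + a′) (b + b′) (c + c′)
O-* {a = a} {b} {c} {a′ = a′} {b′} {c′} (order d i) (order e j) = order (d * e) λ p → begin
  _                                                                     ≤⟨ *-mono-≤ (i p) (j p) ⟩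
  d * monomial a b c p * (e * monomial a′ b′ c′ p)
    ≡⟨ r d e (Point.k p ^ a) (lgₙ p ^ b) (lglgₙ p ^ c) (Point.k p ^ a′) (lgₙ p ^ b′) (lglgₙ p ^ c′) ⟩
  d * e * (Point.k p ^ a * Point.k p ^ a′ * (lgₙ p ^ b * lgₙ p ^ b′ * (lglgₙ p ^ c * lglgₙ p ^ c′)))
    ≡⟨ sym (cong (d * e *_) (cong₂ _*_ (^-distribˡ-+-* (Point.k p) a a′) (cong₂ _*_ (^-distribˡ-+-* (lgₙ p) b b′) (^-distribˡ-+-* (lglgₙ p) c c′)))) ⟩
  d * e * monomial (a + a′) (b + b′) (c + c′) p ∎
  where
  open ≤-Reasoning
  r : ∀ d e a b c a′ b′ c′ → d * (a * (b * c)) * (e * (a′ * (b′ * c′))) ≡ d * e * (a * a′ * (b * b′ * (c * c′)))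
  r = solve-∀

O-scale : ∀ x → Order f a b c → Order (λ p → x * f p) a b c
O-scale x i = O-* (O-const {0} {0} {0} x) i

O-lg : Order f a b c → Order (λ p → lg (f p)) a b c
O-lg {f} i = O-≤ (λ p → lg≤suc (f p)) (O-suc i)

O-k : Order Point.k 1 0 0
O-k = order 1 λ p → ≤-reflexive (e (Point.k p))
  where
  e : ∀ x → x ≡ 1 * (x * 1 * 1)
  e = solve-∀

O-ℓ : Order lgₙ 0 1 0
O-ℓ = order 1 λ p → ≤-reflexive (e (lgₙ p))
  where
  e : ∀ x → x ≡ 1 * (1 * (x * 1 * 1))
  e = solve-∀

O-y : Order lglgₙ 0 0 1
O-y = order 1 λ p → ≤-reflexive (e (lglgₙ p))
  where
  e : ∀ x → x ≡ 1 * (1 * (1 * (x * 1)))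
  e = solve-∀

O-yℓ : Order f a b 1 → Order f a (b + 1) 0
O-yℓ {f} {a} {b} (order d i) = O-≤ (λ p → ≤-trans (i p) (≤-reflexive (cong (d *_) (e (Point.k p ^ a) (lgₙ p ^ b) (lglgₙ p)))))
  (subst₂ (λ x z → Order (λ p → d * (Point.k p ^ a * (lgₙ p ^ b * 1) * lglgₙ p)) x z 0) (+-identityʳ a) refl
    (O-scale d (O-* {a = a} {b} {0} {a′ = 0} {1} {0} (order 1 λ p → ≤-reflexive (sym (*-identityˡ _))) (O-lg O-ℓ))))
  where
  e : ∀ x z w → x * (z * (w * 1)) ≡ x * (z * 1) * w
  e = solve-∀

-- Choice of the parameters

module Parameters (cID n k : ℕ) where
  ℓ y N β₀ m R J′ L τ Jmax ξ cap w h Hc Λ₂ batches : ℕ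
  ℓ       = lg n
  y       = lg ℓ
  N       = n ^ cID
  β₀      = cID * ℓ
  m       = lg β₀
  R       = 48 * (y + 3)
  J′      = y + ⌊log₂ R * 1153 ⌋
  L       = suc (_/_ ℓ y {{>-nonZero (lg≥1 ℓ)}})
  τ       = suc J′ + y
  Jmax    = suc τ
  ξ       = lg (4 * (m * Jmax))
  cap     = 2 ^ (β₀ + (4 * ξ + 1))
  w       = 2 * k
  h       = suc (τ * w)
  Hc      = suc (L * h + τ * w)
  Λ₂      = suc (L * 2 ^ J′)
  batches = 48 * ℓ

  N≤ : N ≤ 2 ^ β₀
  N≤ = ≤-trans (^-monoˡ-≤ cID (<⇒≤ (lg-upper n))) (≤-reflexive (trans (^-*-assoc 2 ℓ cID) (cong (2 ^_) (*-comm ℓ cID))))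

  N≤cap : N ≤ cap
  N≤cap = ≤-trans N≤ (^-monoʳ-≤ 2 (m≤m+n β₀ _))

  small : 4 * (m * Jmax) ≤ suc (2 ^ ξ ∸ 1)
  small = ≤-trans (<⇒≤ (lg-upper (4 * (m * Jmax)))) (≤-reflexive (sym (m+[n∸m]≡n (m^n>0 2 ξ))))

  sucJ′ : suc J′ ≡ y + lg (R * 1153)
  sucJ′ = trans (sym (+-suc y ⌊log₂ R * 1153 ⌋)) (cong (y +_) (+-comm 1 ⌊log₂ R * 1153 ⌋))

  shrink : R * 1153 * 2 ^ y ≤ 2 ^ suc J′
  shrink = begin
    R * 1153 * 2 ^ y                ≤⟨ *-monoˡ-≤ (2 ^ y) (<⇒≤ (lg-upper (R * 1153))) ⟩
    2 ^ lg (R * 1153) * 2 ^ y       ≡⟨ *-comm (2 ^ lg (R * 1153)) (2 ^ y) ⟩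
    2 ^ y * 2 ^ lg (R * 1153)       ≡⟨ sym (^-distribˡ-+-* 2 y (lg (R * 1153))) ⟩
    2 ^ (y + lg (R * 1153))         ≡⟨ cong (2 ^_) (sym sucJ′) ⟩
    2 ^ suc J′                      ∎
    where open ≤-Reasoning

  ℓ≤y*L : ℓ ≤ y * L
  ℓ≤y*L = begin
    ℓ                                       ≡⟨ m≡m%n+[m/n]*n ℓ y {{>-nonZero (lg≥1 ℓ)}} ⟩
    _%_ ℓ y {{>-nonZero (lg≥1 ℓ)}} + q * y  ≤⟨ +-monoˡ-≤ (q * y) (<⇒≤ (m%n<n ℓ y {{>-nonZero (lg≥1 ℓ)}})) ⟩
    suc q * y                               ≡⟨ *-comm (suc q) y ⟩
    y * suc q                               ∎
    where
    open ≤-Reasoning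
    q = _/_ ℓ y {{>-nonZero (lg≥1 ℓ)}}

  L*y≤ : L * y ≤ y + ℓ
  L*y≤ = +-monoʳ-≤ y (m/n*n≤m ℓ y {{>-nonZero (lg≥1 ℓ)}})

  L≤ : L ≤ suc ℓ
  L≤ = s≤s (m/n≤m ℓ y {{>-nonZero (lg≥1 ℓ)}})

  L≤2^y : L ≤ 2 ^ y
  L≤2^y = ≤-trans L≤ (lg-upper ℓ)

  n< : n < 2 ^ (y * L)
  n< = <-≤-trans (lg-upper n) (^-monoʳ-≤ 2 ℓ≤y*L)

  Λ₂≤ : Λ₂ ≤ 2 ^ τ
  Λ₂≤ = begin
    suc (L * 2 ^ J′)                          ≤⟨ s≤s (*-monoˡ-≤ (2 ^ J′) L≤2^y) ⟩
    suc (2 ^ y * 2 ^ J′)                      ≤⟨ +-monoˡ-≤ (2 ^ y * 2 ^ J′) (*-mono-≤ {1} (m^n>0 2 y) (m^n>0 2 J′)) ⟩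
    2 ^ y * 2 ^ J′ + 2 ^ y * 2 ^ J′           ≡⟨ e (2 ^ y) (2 ^ J′) ⟩
    2 * 2 ^ J′ * 2 ^ y                        ≡⟨ sym (^-distribˡ-+-* 2 (suc J′) y) ⟩
    2 ^ τ                                     ∎
    where
    open ≤-Reasoning
    e : ∀ a b → a * b + a * b ≡ 2 * b * a
    e = solve-∀

  losses : 8 * L * 47 ^ R ≤ 48 ^ R
  losses = begin
    8 * L * 47 ^ R                    ≤⟨ *-monoˡ-≤ (47 ^ R) (*-monoʳ-≤ 8 L≤2^y) ⟩
    8 * 2 ^ y * 47 ^ R                ≡⟨ cong (_* 47 ^ R) (trans (*-comm 8 (2 ^ y)) (sym (^-distribˡ-+-* 2 y 3))) ⟩
    2 ^ (y + 3) * 47 ^ R              ≤⟨ decay (y + 3) ⟩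
    48 ^ R                            ∎
    where open ≤-Reasoning

  enough : n * 47 ^ batches < 48 ^ batches
  enough = <-≤-trans (*-monoˡ-< (47 ^ batches) {{m^n≢0 47 batches}} (lg-upper n)) (decay ℓ)

  bits : ℕ
  bits = (β₀ + (β₀ + (4 * ξ + 1) + 1)) + 1 + (2 + (ℓ + β₀))

  fits : ∀ bw → bits ≤ bw → N * suc cap < 2 ^ bw
  fits bw le = begin-strict
    N * suc cap                                     ≤⟨ *-mono-≤ N≤ (≤-trans (+-monoˡ-≤ cap (m^n>0 2 (β₀ + (4 * ξ + 1)))) (≤-reflexive (e cap))) ⟩
    2 ^ β₀ * (cap * 2)                              ≡⟨ cong (2 ^ β₀ *_) (sym (^-distribˡ-+-* 2 (β₀ + (4 * ξ + 1)) 1)) ⟩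
    2 ^ β₀ * 2 ^ (β₀ + (4 * ξ + 1) + 1)             ≡⟨ sym (^-distribˡ-+-* 2 β₀ _) ⟩
    2 ^ (β₀ + (β₀ + (4 * ξ + 1) + 1))               <⟨ ^-monoʳ-< 2 (s≤s (s≤s z≤n)) (m<m+n e₀ (s≤s z≤n)) ⟩
    2 ^ (β₀ + (β₀ + (4 * ξ + 1) + 1) + 1)           ≤⟨ ^-monoʳ-≤ 2 (≤-trans (m≤m+n (e₀ + 1) (2 + (ℓ + β₀))) le) ⟩
    2 ^ bw                                          ∎
    where
    open ≤-Reasoning
    e₀ = β₀ + (β₀ + (4 * ξ + 1) + 1)
    e : ∀ c → c + c ≡ c * 2
    e = solve-∀

  fits′ : ∀ bw → bits ≤ bw → 4 * (n * N) < 2 ^ bw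
  fits′ bw le = begin-strict
    4 * (n * N)                    ≤⟨ *-monoʳ-≤ 4 (*-monoʳ-≤ n N≤) ⟩
    4 * (n * 2 ^ β₀)               <⟨ *-monoʳ-< 4 (*-monoˡ-< (2 ^ β₀) {{m^n≢0 2 β₀}} (lg-upper n)) ⟩
    4 * (2 ^ ℓ * 2 ^ β₀)           ≡⟨ cong (4 *_) (sym (^-distribˡ-+-* 2 ℓ β₀)) ⟩
    4 * 2 ^ (ℓ + β₀)               ≡⟨ sym (^-distribˡ-+-* 2 2 (ℓ + β₀)) ⟩
    2 ^ (2 + (ℓ + β₀))             ≤⟨ ^-monoʳ-≤ 2 (≤-trans (m≤n+m (2 + (ℓ + β₀)) _) le) ⟩
    2 ^ bw                         ∎
    where open ≤-Reasoning

  t₁ t₂ rounds : ℕ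
  t₁ = Hc + 2 ^ J′
  t₂ = Hc + Λ₂
  rounds = batches * (L * (t₁ + (t₁ + R * isolateRounds ξ m (suc J′) t₁)) + (t₂ + (t₂ + suc τ * isolateRounds ξ m (suc τ) t₂)))

  program : ℕ → ℕ → List ℕ → Proc (ℕ × ℕ)
  program bw me nbrs = BatchProgram.decompose bw N cap nbrs me ξ m β₀ Hc J′ R y L w τ Λ₂ h batches

module Growth (cID : ℕ) where
  module Par p = Parameters cID (Point.n p) (Point.k p)
  open Par using (R; J′; L; τ; m; ξ; β₀; Hc; Λ₂; t₁; t₂; rounds; batches; bits; Jmax; w)

  abstract
    O-R : Order R 0 0 1
    O-R = O-scale 48 (O-+ O-y (O-const 3))

    O-sucJ′ : Order (λ p → suc (J′ p)) 0 0 1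
    O-sucJ′ = O-≤ (λ p → ≤-reflexive (Par.sucJ′ p)) (O-+ O-y (O-lg (O-≤ (λ p → ≤-reflexive (*-comm (R p) 1153)) (O-scale 1153 O-R))))

    O-τ : Order τ 0 0 1
    O-τ = O-+ O-sucJ′ O-y

    O-β₀ : Order β₀ 0 1 0
    O-β₀ = O-scale cID O-ℓ

    O-m : Order m 0 0 1
    O-m = O-≤ (λ p → lg-* cID (lgₙ p)) (O-+ (O-const (lg cID)) O-y)

    O-ξ : Order ξ 0 0 1
    O-ξ = O-≤ (λ p → ≤-trans (lg-* 4 (m p * Jmax p)) (+-monoʳ-≤ (lg 4) (lg-* (m p) (Jmax p)))) (O-+ (O-const (lg 4)) (O-+ (O-lg O-m) (O-lg (O-suc O-τ))))

    O-2^ξ : Order (λ p → 2 ^ ξ p) 0 0 2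
    O-2^ξ = O-≤ (λ p → lg-lower (4 * (m p * Jmax p)) (*-mono-≤ {1} {4} (s≤s z≤n) (*-mono-≤ {1} (lg≥1 (β₀ p)) (s≤s z≤n)))) (O-scale 2 (O-scale 4 (O-* O-m (O-suc O-τ))))

    O-classes : Order (λ p → 2 ^ (4 * ξ p + 1)) 0 0 8
    O-classes = O-≤ (λ p → ≤-reflexive (e p)) (O-scale 2 (O-* O-2^ξ (O-* O-2^ξ (O-* O-2^ξ O-2^ξ))))
      where
      open ≡-Reasoning
      e : ∀ p → 2 ^ (4 * ξ p + 1) ≡ 2 * (2 ^ ξ p * (2 ^ ξ p * (2 ^ ξ p * 2 ^ ξ p)))
      e p = begin
        2 ^ (4 * ξ p + 1)                                       ≡⟨ cong (2 ^_) (r₁ (ξ p)) ⟩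
        2 * 2 ^ (ξ p + (ξ p + (ξ p + ξ p)))                     ≡⟨ cong (2 *_) (^-distribˡ-+-* 2 (ξ p) _) ⟩
        2 * (2 ^ ξ p * 2 ^ (ξ p + (ξ p + ξ p)))                 ≡⟨ cong (λ z → 2 * (2 ^ ξ p * z)) (^-distribˡ-+-* 2 (ξ p) _) ⟩
        2 * (2 ^ ξ p * (2 ^ ξ p * 2 ^ (ξ p + ξ p)))             ≡⟨ cong (λ z → 2 * (2 ^ ξ p * (2 ^ ξ p * z))) (^-distribˡ-+-* 2 (ξ p) (ξ p)) ⟩
        2 * (2 ^ ξ p * (2 ^ ξ p * (2 ^ ξ p * 2 ^ ξ p)))         ∎
        where
        r₁ : ∀ x → 4 * x + 1 ≡ suc (x + (x + (x + x)))
        r₁ = solve-∀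

    O-L : Order L 0 1 0
    O-L = O-≤ (λ p → Par.L≤ p) (O-suc O-ℓ)

    O-L*τ : Order (λ p → L p * τ p) 0 1 0
    O-L*τ = go O-τ
      where
      go : Order τ 0 0 1 → Order (λ p → L p * τ p) 0 1 0
      go (order d i) = O-≤ (λ p → begin
        L p * τ p                          ≤⟨ *-monoʳ-≤ (L p) (i p) ⟩
        L p * (d * (1 * (1 * (lglgₙ p * 1))))  ≡⟨ e (L p) d (lglgₙ p) ⟩
        d * (L p * lglgₙ p)                    ≤⟨ *-monoʳ-≤ d (Par.L*y≤ p) ⟩
        d * (lglgₙ p + lgₙ p)                    ∎) (O-scale d (O-+ (O-lg O-ℓ) O-ℓ))
        where
        open ≤-Reasoning
        e : ∀ l d y → l * (d * (1 * (1 * (y * 1)))) ≡ d * (l * y)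
        e = solve-∀

    O-w : Order w 1 0 0
    O-w = O-scale 2 O-k

    O-Hc : Order Hc 1 1 0
    O-Hc = O-suc (O-+ (O-≤ (λ p → ≤-reflexive (e (L p) (τ p) (w p))) (O-+ (O-weaken z≤n ≤-refl ≤-refl O-L) (O-* O-L*τ O-w))) (O-* (O-yℓ O-τ) O-w))
      where
      e : ∀ l t w → l * suc (t * w) ≡ l + l * t * w
      e = solve-∀

    O-Λ : Order (λ p → 2 ^ J′ p) 0 1 1
    O-Λ = O-≤ (λ p → begin
      2 ^ J′ p                                  ≤⟨ m≤m+n _ _ ⟩
      2 ^ suc (J′ p)                            ≡⟨ cong (2 ^_) (Par.sucJ′ p) ⟩
      2 ^ (lglgₙ p + lg (R p * 1153))               ≡⟨ ^-distribˡ-+-* 2 (lglgₙ p) (lg (R p * 1153)) ⟩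
      2 ^ lglgₙ p * 2 ^ lg (R p * 1153)             ≤⟨ *-mono-≤ (lg-lower (lgₙ p) (lg≥1 (Point.n p))) (lg-lower (R p * 1153) (*-mono-≤ {1} {R p} {1} {1153} (*-mono-≤ {1} {48} (s≤s z≤n) (≤-trans (lg≥1 (lgₙ p)) (m≤m+n (lglgₙ p) 3))) (s≤s z≤n))) ⟩
      2 * lgₙ p * (2 * (R p * 1153))              ≡⟨ cong (λ z → 2 * lgₙ p * (2 * z)) (*-comm (R p) 1153) ⟩
      2 * lgₙ p * (2 * (1153 * R p))              ∎) (O-* (O-scale 2 O-ℓ) (O-scale 2 (O-scale 1153 O-R)))
      where open ≤-Reasoning

    O-Λ₂ : Order Λ₂ 0 2 1
    O-Λ₂ = O-suc (O-* O-L O-Λ)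

    O-t₁ : Order t₁ 1 1 1
    O-t₁ = O-+ (O-weaken ≤-refl ≤-refl z≤n O-Hc) (O-weaken z≤n ≤-refl ≤-refl O-Λ)

    O-t₂ : Order t₂ 1 2 1
    O-t₂ = O-+ (O-weaken ≤-refl (s≤s z≤n) z≤n O-Hc) (O-weaken z≤n ≤-refl ≤-refl O-Λ₂)

    O-isolate : ∀ {J t : Point → ℕ} {b} → Order J 0 0 1 → Order t 1 b 1 → Order (λ p → isolateRounds (ξ p) (m p) (J p) (t p)) 1 b 10
    O-isolate {J} {t} {b} OJ Ot = O-+ Ot′ (O-+ Ot′ (O-* OJ (O-+
        (O-weaken ≤-refl ≤-refl (toWitness {a? = 4 ≤? 9} tt) (O-* O-m (O-+ (O-* OX Ot) (O-weaken ≤-refl ≤-refl (s≤s z≤n) Ot))))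
        (O-* O-classes (O-+ Ot Ot)))))
      where
      Ot′ : Order t 1 b 10
      Ot′ = O-weaken ≤-refl ≤-refl (s≤s z≤n) Ot
      OX : Order (λ p → suc (2 ^ ξ p ∸ 1)) 0 0 2
      OX = O-≤ (λ p → ≤-reflexive (m+[n∸m]≡n (m^n>0 2 (ξ p)))) O-2^ξ

    O-batches : Order batches 0 1 0
    O-batches = O-scale 48 O-ℓ

    O-rounds : Order rounds 1 3 11
    O-rounds = O-* O-batches (O-+
      (O-* O-L (O-+ Ot₁ (O-+ Ot₁ (O-* O-R (O-isolate O-sucJ′ O-t₁)))))
      (O-+ Ot₂ (O-+ Ot₂ (O-* (O-suc O-τ) (O-isolate (O-suc O-τ) O-t₂)))))
      where
      Ot₁ : Order t₁ 1 1 11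
      Ot₁ = O-weaken ≤-refl ≤-refl (s≤s z≤n) O-t₁
      Ot₂ : Order t₂ 1 2 11
      Ot₂ = O-weaken ≤-refl ≤-refl (s≤s z≤n) O-t₂

    O-colours : Order (λ p → batches p * suc (τ p)) 0 1 1
    O-colours = O-* O-batches (O-suc O-τ)

    O-bits : Order bits 0 1 0
    O-bits = O-+ (O-+ (O-+ O-β₀ (O-+ (O-+ O-β₀ (O-+ (O-scale 4 (O-yℓ O-ξ)) (O-const 1))) (O-const 1))) (O-const 1)) (O-+ (O-const 2) (O-+ O-ℓ O-β₀))

IsSteinerTree-mono : ∀ {n} {G : Graph n} {S : STree G} {C C′ : Fin n → Set} {ρ ρ′} → ρ ≤ ρ′ → (∀ v → C′ v → C v) →
                     IsSteinerTree G S C ρ → IsSteinerTree G S C′ ρ′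
IsSteinerTree-mono ρ≤ i st = record
  { root-in   = root-in
  ; parent-ok = parent-ok
  ; radius    = λ v t → let (m , m≤ , e) = radius v t in m , ≤-trans m≤ ρ≤ , e
  ; terminals = λ v c → terminals v (i v c)
  }
  where open IsSteinerTree st

theoremA1 : (cID : ℕ) →
    Σ Algorithm λ A →
    Σ ℕ λ cB → Σ ℕ λ cT → Σ ℕ λ dT → Σ ℕ λ cC → Σ ℕ λ cD → Σ ℕ λ cR →
    ∀ (n k : ℕ) → 1 ≤ n → 1 ≤ k →
    (G : Graph n) (id : Fin n → ℕ) →
    (∀ u v → id u ≡ id v → u ≡ v) → (∀ v → id v < n ^ cID) →
    let x = k * (lg n * lg n * lg n)
        rounds = cT * x * (lg x ^ dT)
        cl = λ v → proj₁ (output A (run A G id k rounds v))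
        co = λ v → proj₂ (output A (run A G id k rounds v))
    in BandwidthOK A G id k rounds (cB * lg n)
       × IsNetworkDecomposition G cl co (cC * lg n * lg (lg n)) k (cD * k * lg n)
       × Σ (ℕ → STree G) λ tr →
           (∀ c → IsSteinerTree G (tr c) (λ v → cl v ≡ c) (cR * k * lg n))
           × (∀ u v → co u ≡ co v → cl u ≢ cl v →
                ∀ a b → TreeEdge (tr (cl u)) a b → ¬ TreeEdge (tr (cl v)) a b)
theoremA1 cID = A , cB , cT , 11 , cC , cH + cH , cH , main
  where
  open Growth cID
  cB = Order.factor O-bits
  cT = Order.factor O-rounds
  cC = Order.factor O-colours
  cH = Order.factor O-Hc

  prog : ℕ → ℕ → ℕ → List ℕ → Proc (ℕ × ℕ)
  prog n k = Parameters.program cID n k (cB * lg n)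

  A : Algorithm
  A = procAlgorithm prog

  main : ∀ (n k : ℕ) → 1 ≤ n → 1 ≤ k → (G : Graph n) (id : Fin n → ℕ) →
    (∀ u v → id u ≡ id v → u ≡ v) → (∀ v → id v < n ^ cID) →
    let x = k * (lg n * lg n * lg n)
        rounds = cT * x * (lg x ^ 11)
        cl = λ v → proj₁ (output A (run A G id k rounds v))
        co = λ v → proj₂ (output A (run A G id k rounds v))
    in BandwidthOK A G id k rounds (cB * lg n)
       × IsNetworkDecomposition G cl co (cC * lg n * lg (lg n)) k ((cH + cH) * k * lg n)
       × Σ (ℕ → STree G) λ tr →
           (∀ c → IsSteinerTree G (tr c) (λ v → cl v ≡ c) (cH * k * lg n))
           × (∀ u v → co u ≡ co v → cl u ≢ cl v →
                ∀ a b → TreeEdge (tr (cl u)) a b → ¬ TreeEdge (tr (cl v)) a b)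
  main n k n≥1 k≥1 G id id-inj id<N = bandwidth , record
      { color-bound   = λ v → subst (_< cC * lg n * lg (lg n)) (sym (cong proj₂ (out≡ v))) (<-≤-trans (color-bound v) colours≤)
      ; cluster-color = λ u v e → trans (cong proj₂ (out≡ u)) (trans (cluster-color u v (fromOut₁ u v e)) (sym (cong proj₂ (out≡ v))))
      ; weak-diameter = λ u v e → Walks.Within-mono G diameter≤ (weak-diameter u v (fromOut₁ u v e))
      ; separated     = λ u v e ne → separated u v (fromOut₂ u v e) (λ e′ → ne (trans (cong proj₁ (out≡ u)) (trans e′ (sym (cong proj₁ (out≡ v))))))
      } , tr , (λ c → IsSteinerTree-mono Hc≤ (λ v e → trans (sym (cong proj₁ (out≡ v))) e) (trees c)) ,
      λ u v e ne a b t t′ → disjoint u v (fromOut₂ u v e) (λ e′ → ne (trans (cong proj₁ (out≡ u)) (trans e′ (sym (cong proj₁ (out≡ v)))))) a b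
        (subst (λ c → TreeEdge (tr c) a b) (cong proj₁ (out≡ u)) t) (subst (λ c → TreeEdge (tr c) a b) (cong proj₁ (out≡ v)) t′)
    where
    p : Point
    p = record { n = n ; k = k ; n≥1 = n≥1 ; k≥1 = k≥1 }
    module P = Parameters cID n k
    x = k * (lg n * lg n * lg n)

    bits≤ : P.bits ≤ cB * lg n
    bits≤ = ≤-trans (Order.bound O-bits p) (≤-reflexive (e cB (lg n)))
      where
      e : ∀ c l → c * (1 * (l * 1 * 1)) ≡ c * l
      e = solve-∀

    setting : Setting n
    setting = record
      { G = G ; id = id ; id-inj = id-inj ; N = P.N ; id<N = id<N ; bw = cB * lg n ; cap = P.cap ; N≤cap = P.N≤cap
      ; fits = P.fits (cB * lg n) bits≤ ; fits′ = P.fits′ (cB * lg n) bits≤ ; ξ = P.ξ ; m = P.m ; β₀ = P.β₀ ; Jmax = P.Jmax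
      ; N≤ = P.N≤ ; β₀< = lg-upper P.β₀ ; small = P.small ; cap≥ = ≤-refl
      }

    rounds≤ : P.rounds ≤ cT * x * (lg x ^ 11)
    rounds≤ = begin
      P.rounds                                                     ≤⟨ Order.bound O-rounds p ⟩
      cT * (k ^ 1 * (lg n ^ 3 * lg (lg n) ^ 11))                   ≡⟨ e cT k (lg n) (lg (lg n) ^ 11) ⟩
      cT * x * lg (lg n) ^ 11                                      ≤⟨ *-monoʳ-≤ (cT * x) (^-monoˡ-≤ 11 (lg-mono lgn≤x)) ⟩
      cT * x * (lg x ^ 11)                                         ∎
      where
      open ≤-Reasoning
      e : ∀ c k l z → c * (k * 1 * (l * (l * (l * 1)) * z)) ≡ c * (k * (l * l * l)) * z
      e = solve-∀
      lgn≤x : lg n ≤ x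
      lgn≤x = begin
        lg n                         ≡⟨ e′ (lg n) ⟩
        1 * (1 * 1 * lg n)           ≤⟨ *-mono-≤ {1} {k} k≥1 (*-monoˡ-≤ (lg n) (*-mono-≤ {1} {lg n} {1} {lg n} (lg≥1 n) (lg≥1 n))) ⟩
        k * (lg n * lg n * lg n)     ∎
        where
        e′ : ∀ l → l ≡ 1 * (1 * 1 * l)
        e′ = solve-∀

    colours≤ : P.batches * suc P.τ ≤ cC * lg n * lg (lg n)
    colours≤ = ≤-trans (Order.bound O-colours p) (≤-reflexive (e cC (lg n) (lg (lg n))))
      where
      e : ∀ c l y → c * (1 * (l * 1 * (y * 1))) ≡ c * l * y
      e = solve-∀

    Hc≤ : P.Hc ≤ cH * k * lg n
    Hc≤ = ≤-trans (Order.bound O-Hc p) (≤-reflexive (e cH k (lg n)))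
      where
      e : ∀ c k l → c * (k * 1 * (l * 1 * 1)) ≡ c * k * l
      e = solve-∀

    diameter≤ : P.Hc + P.Hc ≤ (cH + cH) * k * lg n
    diameter≤ = ≤-trans (+-mono-≤ Hc≤ Hc≤) (≤-reflexive (e cH k (lg n)))
      where
      e : ∀ c k l → c * k * l + c * k * l ≡ (c + c) * k * l
      e = solve-∀

    result = Execution.run-Spec G id (cB * lg n) prog k
               (Batches.Spec-decompose setting k P.τ P.L P.w P.h P.Hc P.Λ₂ P.J′ P.R P.y P.batches ≤-refl
                 (≤-trans (m≤m+n (suc P.J′) P.y) (n≤1+n P.τ)) P.shrink P.n< refl ≤-refl ≤-refl ≤-refl P.Λ₂≤ P.losses P.enough (fromℕ< n≥1))
               rounds≤
    out = proj₁ result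
    decomposition = proj₁ (proj₂ result)
    bandwidth = proj₁ (proj₂ (proj₂ result))
    out≡ = proj₂ (proj₂ (proj₂ result))
    open IsNetworkDecomposition (proj₁ decomposition)
    tr = proj₁ (proj₂ decomposition)
    trees = proj₁ (proj₂ (proj₂ decomposition))
    disjoint = proj₂ (proj₂ (proj₂ decomposition))

    fromOut₁ : ∀ u v → _ → proj₁ (out u) ≡ proj₁ (out v)
    fromOut₁ u v e = trans (sym (cong proj₁ (out≡ u))) (trans e (cong proj₁ (out≡ v)))
    fromOut₂ : ∀ u v → _ → proj₂ (out u) ≡ proj₂ (out v)
    fromOut₂ u v e = trans (sym (cong proj₂ (out≡ u))) (trans e (cong proj₂ (out≡ v)))
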